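{- If $q=14n+1$ is a prime power with $71\le q\le 9941$ or $q>Q(7,6)$, then there exists a $(\mathbb Z_2\times\mathbb Z_2\times\mathbb F_q,\{4^1,3^{4n},5^{4n},6^{4n}\},4)$-PDF which is the base (starter) parallel class of an HS$(2,\{3,4,5,6\},4q)$.
   Context: For positive integers $e,m$ let $U=\sum_{h=1}^m\binom mh(e-1)^h(h-1)$ and $Q(e,m)=\frac14\bigl(U+\sqrt{U^2+4me^{m-1}}\bigr)^2$. For a subset $B$ of an additive group, $\Delta B$ is the multiset of differences $b-b'$ over ordered pairs of distinct elements of $B$. A $(\Gamma,K,\lambda)$-PDF is a collection of subsets of $\Gamma$ partitioning $\Gamma$, with multiset of sizes $K$ (exponential notation: $\{k_1^{\mu_1},\dots\}$ means $k_i$ with multiplicity $\mu_i$), such that the multiset union of the $\Delta B$ equals $\lambda$ copies of $\Gamma\setminus\{0\}$. A linear space S$(2,K,v)$: $v$ points, blocks with sizes in $K$ (each element of $K$ occurring), every pair of points in exactly one block; a resolution partitions the blocks into parallel classes each partitioning the points. A PDF $\mathcal P$ in $\Gamma$ with $|\Gamma|=v$ is the base parallel class of an HS$(2,K,v)$ if $\{\mathcal P+x\mid x\in\Gamma\}$ is the set of parallel classes of a resolved S$(2,K,v)$ with point set $\Gamma$. -}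

module Defs where

open import Data.Nat using (ℕ; zero; suc; _+_; _*_; _∸_; _^_; _≤_; _<_; NonZero)
open import Data.Nat.DivMod using (_mod_)
open import Data.Nat.Combinatorics using (_C_)
open import Data.Fin using (Fin; toℕ)
open import Data.Fin.Properties using () renaming (_≟_ to _≟ᶠ_)
open import Data.Vec using (Vec; zipWith; replicate)
open import Data.Vec.Properties using () renaming (≡-dec to vec-≡-dec)
open import Data.Product using (Σ; ∃; ∃-syntax; _×_; _,_)
open import Data.Product.Properties using () renaming (≡-dec to ×-≡-dec)
open import Data.List using (List; []; _∷_; map; concatMap; filter; length; _++_; upTo)
open import Data.Nat.ListAction using (sum)
import Data.List as L
open import Data.List.Membership.Propositional using (_∈_)
open import Data.List.Relation.Binary.Permutation.Propositional using (_↭_)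
open import Relation.Binary.PropositionalEquality using (_≡_; _≢_)
open import Relation.Binary.Definitions using (DecidableEquality)
open import Relation.Nullary using (¬_; Dec; yes; no)
open import Relation.Nullary.Decidable using (¬?)
open import Function.Bundles using (_⇔_)

U : ℕ → ℕ → ℕ
U e m = sum (map (λ h → (m C h) * ((e ∸ 1) ^ h) * (h ∸ 1)) (L.map suc (upTo m)))

-- Q(e,m) = ¼ (U + √(U² + 4 m e^(m-1)))² is irrational in general.
-- Writing c = m e^(m-1) and U = U(e,m) ≥ 0, one has (exact algebra over ℝ)
--   q > Q(e,m)  ⇔  √q > (U + √(U² + 4c))/2
--               ⇔  q > c  and  (q - c)² > U² q .
-- We use this exact integer form of the real inequality q > Q(e,m).
AboveQ : ℕ → ℕ → ℕ → Set
AboveQ e m q = (m * e ^ (m ∸ 1) < q) × (U e m * U e m * q < (q ∸ m * e ^ (m ∸ 1)) * (q ∸ m * e ^ (m ∸ 1)))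

-- The group Z₂ × Z₂ × F_q, where (F_q,+) ≅ (Z_p)^k for q = p^k.

Zmod : ℕ → Set
Zmod m = Fin m

addMod : (m : ℕ) .{{_ : NonZero m}} → Fin m → Fin m → Fin m
addMod m a b = (toℕ a + toℕ b) mod m

negMod : (m : ℕ) .{{_ : NonZero m}} → Fin m → Fin m
negMod m a = (m ∸ toℕ a) mod m

zeroMod : (m : ℕ) .{{_ : NonZero m}} → Fin m
zeroMod m = 0 mod m

Γ : ℕ → ℕ → Set
Γ p k = Fin 2 × Fin 2 × Vec (Fin p) k

module Group (p k : ℕ) .{{nz : NonZero p}} where

  infixl 6 _⊕_ _⊖_

  _⊕_ : Γ p k → Γ p k → Γ p k
  (a , b , v) ⊕ (a' , b' , v') = addMod 2 a a' , addMod 2 b b' , zipWith (addMod p) v v'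

  ⊖_ : Γ p k → Γ p k
  ⊖ (a , b , v) = negMod 2 a , negMod 2 b , Data.Vec.map (negMod p) v

  _⊖_ : Γ p k → Γ p k → Γ p k
  x ⊖ y = x ⊕ (⊖ y)

  𝟘 : Γ p k
  𝟘 = zeroMod 2 , zeroMod 2 , replicate k (zeroMod p)

  _≟_ : DecidableEquality (Γ p k)
  _≟_ = ×-≡-dec _≟ᶠ_ (×-≡-dec _≟ᶠ_ (vec-≡-dec _≟ᶠ_))

  count : Γ p k → List (Γ p k) → ℕ
  count x xs = length (filter (x ≟_) xs)

  Δ : List (Γ p k) → List (Γ p k)
  Δ B = concatMap (λ b → map (λ b' → b ⊖ b') (filter (λ b' → ¬? (b ≟ b')) B)) B

  IsPDF : List (List (Γ p k)) → List ℕ → ℕ → Set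
  IsPDF P K λ′ =
      (∀ x → sum (map (count x) P) ≡ 1)
    × (map length P ↭ K)
    × (∀ g → g ≢ 𝟘 → count g (concatMap Δ P) ≡ λ′)

  translate : List (Γ p k) → Γ p k → List (Γ p k)
  translate B x = map (λ b → b ⊕ x) B

  _≈ₛ_ : List (Γ p k) → List (Γ p k) → Set
  A ≈ₛ B = ∀ z → (z ∈ A) ⇔ (z ∈ B)

  SameClass : List (List (Γ p k)) → Γ p k → Γ p k → Set
  SameClass P x y =
      (∀ B → B ∈ P → ∃[ B' ] (B' ∈ P × translate B x ≈ₛ translate B' y))
    × (∀ B' → B' ∈ P → ∃[ B ] (B ∈ P × translate B x ≈ₛ translate B' y))

  -- P is the base parallel class of an HS(2,K,|Γ|): the blocks
  -- {B + x | B ∈ P, x ∈ Γ} (as sets) form a linear space on Γ (every pair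
  -- of distinct points lies in exactly one block), and the distinct
  -- classes P + x are the parallel classes of a resolution, i.e. two
  -- classes sharing a block coincide.  (Each P + x partitions Γ since P does;
  -- the block sizes are those of P.)
  IsHSBase : List (List (Γ p k)) → Set
  IsHSBase P =
      (∀ u w → u ≢ w →
          ∃[ B ] ∃[ x ] (B ∈ P × u ∈ translate B x × w ∈ translate B x))
    × (∀ u w → u ≢ w → ∀ B x B' y → B ∈ P → B' ∈ P →
          u ∈ translate B x → w ∈ translate B x →
          u ∈ translate B' y → w ∈ translate B' y →
          translate B x ≈ₛ translate B' y)
    × (∀ B x B' y → B ∈ P → B' ∈ P →
          translate B x ≈ₛ translate B' y → SameClass P x y)

Ktype : ℕ → List ℕ
Ktype n = 4 ∷ (L.replicate (4 * n) 3 ++ L.replicate (4 * n) 5 ++ L.replicate (4 * n) 6)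

{-# OPTIONS --safe #-}
module Submission where

-- Let V = ℤ₂ × ℤ₂ and F = 𝔽_q. The map x ↦ x²ⁿ colours F* by the seven cosets of the group of
-- seventh powers, and S denotes a set of representatives of that group modulo ±1. Let T be
-- one of {x, y₁, y₂}, {−x, z₁, z₂, z₃, z₄}, {−y₁, −y₂, −z₁, …, −z₄}, with fixed labels in V.
-- If the seven points have distinct colours, then the sets sT + w (s ∈ S, w ∈ V) together with
-- V × {0} partition V × F. If moreover the 28 differences inside the three blocks have distinct
-- pairs (label, colour), then every nonzero difference occurs exactly four times, and up to
-- translation in exactly one block, which gives the linear space and its resolution.
--
-- For q ≤ 9941 the seven points are given explicitly. For q > Q(7,6), Weil's bound is replaced
-- by an elementary second moment: if N_c(z) is the number of b ∈ B with z − b of colour c, then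
-- Σ_z Σ_c (7 N_c(z) − |B|)² ≤ (588 n + 49) |B|. So few z are bad for B and one can choose
-- z₁, …, z₄, y₂ one after the other, keeping the sets of candidates for x and y₁ large. The last
-- step, where x and y₁ have to be adjacent in a given colour, is affordable because differences
-- with the same label may exchange their colours, which multiplies the candidates by 6 and 2.
--
-- A field with pᵏ elements is K[X]/(f) with K = ℤ/p. Start from f = X^q − X; as long as K[X]/(f) has
-- zero divisors, replace f by the minimal polynomial of X on a suitable one of them, so that f still
-- does not divide the product of the X^(pⁱ) − X with i < k, which in a field forces deg f = k.

open import Defs
open import Data.Nat using (ℕ; zero; suc; pred; _+_; _*_; _∸_; _^_; _≤_; _<_; _<?_; z≤n; s≤s; NonZero; >-nonZero; s≤s⁻¹; _%_; _≡ᵇ_; _!; ∣_-_∣; _<ᵇ_; _/_)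
open import Data.Nat.Properties
open import Data.Nat.ListAction using (sum)
open import Data.Nat.ListAction.Properties using (sum-++; sum-↭)
open import Data.Bool using (Bool; true; false; if_then_else_; _∧_; _∨_; not; T)
open import Data.Fin using (Fin; toℕ; fromℕ<; fromℕ; inject₁) renaming (zero to fzero; suc to fsuc)
open import Data.Product using (∃-syntax; _×_; _,_; proj₁; proj₂)
open import Data.Sum using (_⊎_; inj₁; inj₂)
open import Data.Empty using (⊥; ⊥-elim)
open import Data.Unit using (tt)
open import Data.List using (List; []; _∷_; _++_; length; map; filter; concatMap; cartesianProductWith; allFin; upTo)
open import Data.List.Relation.Unary.Any.Properties using (lookup-index; any⁻)
open import Data.Fin.Properties using (toℕ-injective; toℕ-fromℕ<; toℕ<n)
open import Data.List.Relation.Unary.Any using (Any; here; there)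
open import Data.List.Relation.Unary.All using (All; []; _∷_)
open import Data.List.Relation.Unary.AllPairs using (AllPairs; []; _∷_)
open import Data.List.Membership.Propositional using (_∈_; _∉_; lose; find)
open import Data.List.Membership.Propositional.Properties
open import Data.List.Membership.Propositional.Properties.WithK using (unique∧set⇒bag)
open import Data.List.Relation.Binary.BagAndSetEquality using (∼bag⇒↭)
open import Data.List.Relation.Binary.Permutation.Propositional using (_↭_; ↭-sym; prep; swap; ↭-reflexive) renaming (refl to ↭-refl; trans to ↭-trans)
open import Data.List.Relation.Unary.Unique.Propositional using (Unique)
open import Data.Vec using (Vec; []; _∷_; zipWith; replicate; _∷ʳ_)
open import Function using (_∘_; id; case_of_)
open import Function.Bundles using (_⇔_; mk⇔; Equivalence)
open import Relation.Nullary using (¬_; Dec; yes; no; does)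
open import Relation.Nullary.Decidable using (¬?; _×-dec_; toWitness; decidable-stable)
open import Relation.Binary.Definitions using (DecidableEquality; tri<; tri≈; tri>)
open import Relation.Binary.PropositionalEquality
open import Algebra.Bundles using (CommutativeRing; RawRing)
open import Algebra.Structures using (IsCommutativeRing)
open import Data.Nat.Primality using (Prime; prime⇒nonZero; prime⇒nonTrivial; euclidsLemma; prime⇒irreducible)
open import Data.Nat.Divisibility using (_∣_; ∣⇒≤; m∣m*n; divides; m%n≡0⇒n∣m; n∣m⇒m%n≡0)
open import Data.Maybe using (Maybe; just; nothing)
open import Level using (0ℓ)
open import Induction.WellFounded using (Acc; acc)
open import Data.Nat.Induction using (<-wellFounded)
open import Data.Nat.Solver using (module +-*-Solver)
open import Data.Product.Properties using () renaming (≡-dec to ×-≡-dec)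
open import Data.Nat.Combinatorics using (nCk≡n!/k![n-k]!; k![n∸k]!∣n!; nCn≡1) renaming (_C_ to _C′_)
open import Data.Nat.DivMod using (_mod_; m%n<n; %-distribˡ-+; %-distribˡ-*; m<n⇒m%n≡m; n%n≡0; m/n*n≡m; _/_; m≡m%n+[m/n]*n; m<n*o⇒m/o<n; [m+kn]%n≡m%n)
open import Data.List.Relation.Unary.Unique.DecPropositional using (unique?)
open import Data.List.Relation.Binary.Disjoint.Propositional using (Disjoint)
open import Data.Bool.ListAction using (all; any)
open import Data.Bool.Properties using (T-∧; T-≡)
import Data.List as L
import Data.List.Relation.Unary.Any as Any
import Data.List.Properties as Lₚ
import Data.List.Relation.Unary.All as All
import Data.List.Relation.Unary.All.Properties as Allₚ
import Data.List.Relation.Binary.Permutation.Propositional.Properties as Permₚ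
import Data.List.Relation.Unary.Unique.Propositional.Properties as Uniqueₚ
import Data.Vec as V
import Data.Vec.Properties as Vₚ
import Data.Fin.Properties as Fₚ
import Algebra.Solver.Ring
import Algebra.Solver.Ring.AlmostCommutativeRing as ACR
import Algebra.Properties.CommutativeSemiring.Exp
import Algebra.Properties.Semiring.Mult
import Algebra.Properties.Ring
import Algebra.Properties.CommutativeSemiring.Binomial
import Algebra.Properties.Semiring.Sum
import Data.List.Relation.Unary.AllPairs as AllPairs
import Data.List.Relation.Unary.AllPairs.Properties as AllPairsₚ

-- The obstacle is the last choice. Second moments guarantee an edge of a given colour between two
-- candidate sets only if the product of their sizes exceeds about 589 n. After colours towards 0,
-- z₁, ..., z₄ and y₂ have been prescribed, the sets for x and y₁ are expected to have 2n / 7⁵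
-- elements each, and (2n / 7⁵)² is still below 589 n at n ≈ 1.7 · 10¹⁰, the smallest value that q >
-- Q(7,6) allows. The 6 · 2 admissible patterns make up for this deficit and pay for the share of
-- the candidates lost in the earlier choices. On the side of the design, λ = 4 is produced by V
-- alone: the four blocks s T + w have the same differences. P is invariant under V × {0}, so its 4q
-- translates form only q distinct classes. Seven is the right number of colours because the 3 + 10
-- + 15 = 28 pairs inside the base blocks have to meet each of the four labels with each colour
-- once.

infix 5 ∑
∑ : ∀ {a} {A : Set a} → List A → (A → ℕ) → ℕ
∑ xs f = sum (map f xs)

syntax ∑ xs (λ x → e) = ∑[ x ∈ xs ] e

-- Indicators, finite sums and counting in lists.

𝟙 : ∀ {p} {P : Set p} → Dec P → ℕ
𝟙 d = if does d then 1 else 0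

module _ {p} {P : Set p} where

  𝟙-yes : (d : Dec P) → P → 𝟙 d ≡ 1
  𝟙-yes (yes _) _ = refl
  𝟙-yes (no ¬p) p = ⊥-elim (¬p p)

  𝟙-no : (d : Dec P) → ¬ P → 𝟙 d ≡ 0
  𝟙-no (yes p) ¬p = ⊥-elim (¬p p)
  𝟙-no (no _) _ = refl

  𝟙-sound : (d : Dec P) → 1 ≤ 𝟙 d → P
  𝟙-sound (yes p) _ = p

module _ {p} {P : Set p} where

  𝟙-⇔ : ∀ {q} {Q : Set q} (d : Dec P) (e : Dec Q) → (P → Q) → (Q → P) → 𝟙 d ≡ 𝟙 e
  𝟙-⇔ (yes p) e f g = sym (𝟙-yes e (f p))
  𝟙-⇔ (no ¬p) e f g = sym (𝟙-no e (¬p ∘ g))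

  𝟙-mono : ∀ {q} {Q : Set q} (d : Dec P) (e : Dec Q) → (P → Q) → 𝟙 d ≤ 𝟙 e
  𝟙-mono (yes p) e f = ≤-reflexive (sym (𝟙-yes e (f p)))
  𝟙-mono (no ¬p) e f = z≤n

  𝟙-× : ∀ {q} {Q : Set q} (d : Dec P) (e : Dec Q) → 𝟙 (d ×-dec e) ≡ 𝟙 d * 𝟙 e
  𝟙-× (yes p) (yes q) = refl
  𝟙-× (yes p) (no q) = refl
  𝟙-× (no p) _ = refl

module _ {a} {A : Set a} where

  ∑-cong-∈ : ∀ (xs : List A) {f g : A → ℕ} → (∀ {x} → x ∈ xs → f x ≡ g x) → ∑ xs f ≡ ∑ xs g
  ∑-cong-∈ [] h = refl
  ∑-cong-∈ (x ∷ xs) h = cong₂ _+_ (h (here refl)) (∑-cong-∈ xs (h ∘ there))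

  ∑-cong : ∀ (xs : List A) {f g : A → ℕ} → (∀ x → f x ≡ g x) → ∑ xs f ≡ ∑ xs g
  ∑-cong xs h = ∑-cong-∈ xs (λ {x} _ → h x)

  ∑-mono-∈ : ∀ (xs : List A) {f g : A → ℕ} → (∀ {x} → x ∈ xs → f x ≤ g x) → ∑ xs f ≤ ∑ xs g
  ∑-mono-∈ [] h = z≤n
  ∑-mono-∈ (x ∷ xs) h = +-mono-≤ (h (here refl)) (∑-mono-∈ xs (h ∘ there))

  ∑-mono : ∀ (xs : List A) {f g : A → ℕ} → (∀ x → f x ≤ g x) → ∑ xs f ≤ ∑ xs g
  ∑-mono xs h = ∑-mono-∈ xs (λ {x} _ → h x)

  ∑-const : ∀ (xs : List A) c → ∑ xs (λ _ → c) ≡ length xs * c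
  ∑-const [] c = refl
  ∑-const (x ∷ xs) c = cong (c +_) (∑-const xs c)

  ∑-0 : ∀ (xs : List A) → ∑ xs (λ _ → 0) ≡ 0
  ∑-0 xs = trans (∑-const xs 0) (*-zeroʳ (length xs))

  ∑-+ : ∀ (xs : List A) (f g : A → ℕ) → ∑ xs (λ x → f x + g x) ≡ ∑ xs f + ∑ xs g
  ∑-+ [] f g = refl
  ∑-+ (x ∷ xs) f g = trans (cong (f x + g x +_) (∑-+ xs f g)) (+-interchange (f x) (g x) _ _)
    where
    +-interchange : ∀ a b c d → a + b + (c + d) ≡ a + c + (b + d)
    +-interchange a b c d = trans (+-assoc a b (c + d)) (trans (cong (a +_)
      (trans (sym (+-assoc b c d)) (trans (cong (_+ d) (+-comm b c)) (+-assoc c b d)))) (sym (+-assoc a c (b + d))))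

  ∑-*ˡ : ∀ (xs : List A) c (f : A → ℕ) → ∑ xs (λ x → c * f x) ≡ c * ∑ xs f
  ∑-*ˡ [] c f = sym (*-zeroʳ c)
  ∑-*ˡ (x ∷ xs) c f = trans (cong (c * f x +_) (∑-*ˡ xs c f)) (sym (*-distribˡ-+ c (f x) _))

  ∑-*ʳ : ∀ (xs : List A) c (f : A → ℕ) → ∑ xs (λ x → f x * c) ≡ ∑ xs f * c
  ∑-*ʳ xs c f = trans (∑-cong xs (λ x → *-comm (f x) c)) (trans (∑-*ˡ xs c f) (*-comm c _))

  ∑-++ : ∀ (xs ys : List A) (f : A → ℕ) → ∑ (xs ++ ys) f ≡ ∑ xs f + ∑ ys f
  ∑-++ xs ys f = trans (cong sum (Lₚ.map-++ f xs ys)) (sum-++ (map f xs) (map f ys))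

  ∑-↭ : ∀ {xs ys : List A} (f : A → ℕ) → xs ↭ ys → ∑ xs f ≡ ∑ ys f
  ∑-↭ f p = sum-↭ (Permₚ.map⁺ f p)

  ∑-∈ : ∀ {xs : List A} {x} (f : A → ℕ) → x ∈ xs → f x ≤ ∑ xs f
  ∑-∈ f (here refl) = m≤m+n _ _
  ∑-∈ {y ∷ _} f (there i) = ≤-trans (∑-∈ f i) (m≤n+m _ (f y))

  ∑-positive : ∀ (xs : List A) (f : A → ℕ) → 1 ≤ ∑ xs f → ∃[ x ] (x ∈ xs × 1 ≤ f x)
  ∑-positive (x ∷ xs) f h with f x in eq
  ... | suc m = x , here refl , subst (1 ≤_) (sym eq) (s≤s z≤n)
  ... | zero = let y , i , l = ∑-positive xs f h in y , there i , l

  length-filter-∑ : ∀ {p} {P : A → Set p} (P? : ∀ x → Dec (P x)) xs →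
    length (filter P? xs) ≡ ∑ xs (𝟙 ∘ P?)
  length-filter-∑ P? [] = refl
  length-filter-∑ P? (x ∷ xs) with does (P? x)
  ... | true = cong suc (length-filter-∑ P? xs)
  ... | false = length-filter-∑ P? xs

  ∑-filter : ∀ {p} {P : A → Set p} (P? : ∀ x → Dec (P x)) xs (f : A → ℕ) →
    ∑ (filter P? xs) f ≡ ∑ xs (λ x → 𝟙 (P? x) * f x)
  ∑-filter P? [] f = refl
  ∑-filter P? (x ∷ xs) f with does (P? x)
  ... | true = cong₂ _+_ (sym (+-identityʳ (f x))) (∑-filter P? xs f)
  ... | false = ∑-filter P? xs f

module _ {a b} {A : Set a} {B : Set b} where

  ∑-map : ∀ (g : A → B) xs (f : B → ℕ) → ∑ (map g xs) f ≡ ∑ xs (f ∘ g)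
  ∑-map g xs f = cong sum (sym (Lₚ.map-∘ xs))

  ∑-concatMap : ∀ (g : A → List B) xs (f : B → ℕ) → ∑ (concatMap g xs) f ≡ ∑ xs (λ x → ∑ (g x) f)
  ∑-concatMap g [] f = refl
  ∑-concatMap g (x ∷ xs) f = trans (∑-++ (g x) _ f) (cong (∑ (g x) f +_) (∑-concatMap g xs f))

  ∑-swap : ∀ (xs : List A) (ys : List B) (f : A → B → ℕ) →
    ∑ xs (λ x → ∑ ys (f x)) ≡ ∑ ys (λ y → ∑ xs (λ x → f x y))
  ∑-swap [] ys f = sym (∑-0 ys)
  ∑-swap (x ∷ xs) ys f = trans (cong (∑ ys (f x) +_) (∑-swap xs ys f)) (sym (∑-+ ys (f x) _))

module _ {a} {A : Set a} where

  ∑-≟ : (_≟_ : DecidableEquality A) → ∀ {xs} → Unique xs → ∀ {x} → x ∈ xs → ∑ xs (λ y → 𝟙 (x ≟ y)) ≡ 1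
  ∑-≟ _≟_ {z ∷ xs} (p ∷ u) (here refl) = cong₂ _+_ (𝟙-yes (z ≟ z) refl)
    (trans (∑-cong-∈ xs (λ {y} i → 𝟙-no (z ≟ y) (All.lookup p i))) (∑-0 xs))
  ∑-≟ _≟_ {z ∷ xs} (p ∷ u) {x} (there i) = cong₂ _+_ (𝟙-no (x ≟ z) (λ { refl → All.lookup p i refl })) (∑-≟ _≟_ u i)

  Unique-⊆-length : ∀ {xs ys : List A} → Unique xs → (∀ {x} → x ∈ xs → x ∈ ys) → length xs ≤ length ys
  Unique-⊆-length {[]} u h = z≤n
  Unique-⊆-length {x ∷ xs} (p ∷ u) h with ∈-∃++ (h (here refl))
  ... | as , bs , refl = begin
    suc (length xs)              ≤⟨ s≤s (Unique-⊆-length u drop) ⟩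
    suc (length (as ++ bs))      ≡⟨ cong suc (Lₚ.length-++ as) ⟩
    suc (length as + length bs)  ≡⟨ +-suc (length as) (length bs) ⟨
    length as + suc (length bs)  ≡⟨ Lₚ.length-++ as ⟨
    length (as ++ x ∷ bs)        ∎
    where
    open ≤-Reasoning
    drop : ∀ {y} → y ∈ xs → y ∈ as ++ bs
    drop i with ∈-++⁻ as (h (there i))
    ... | inj₁ j = ∈-++⁺ˡ j
    ... | inj₂ (here refl) = ⊥-elim (All.lookup p i refl)
    ... | inj₂ (there j) = ∈-++⁺ʳ as j

Unique-↭ : ∀ {a} {A : Set a} {xs ys : List A} → Unique xs → Unique ys →
  (∀ {x} → x ∈ xs → x ∈ ys) → (∀ {x} → x ∈ ys → x ∈ xs) → xs ↭ ys
Unique-↭ u v f g = ∼bag⇒↭ (unique∧set⇒bag u v (mk⇔ f g))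

Unique-map-inj : ∀ {a b} {A : Set a} {B : Set b} (f : A → B) {xs} → Unique (map f xs) →
  ∀ {x y} → x ∈ xs → y ∈ xs → f x ≡ f y → x ≡ y
Unique-map-inj f (p ∷ u) (here refl) (here refl) e = refl
Unique-map-inj f (p ∷ u) (here refl) (there j) e = ⊥-elim (All.lookup p (∈-map⁺ f j) e)
Unique-map-inj f (p ∷ u) (there i) (here refl) e = ⊥-elim (All.lookup p (∈-map⁺ f i) (sym e))
Unique-map-inj f (p ∷ u) (there i) (there j) e = Unique-map-inj f u i j e

map-Unique : ∀ {a b} {A : Set a} {B : Set b} (f : A → B) {xs} →
  (∀ {x y} → x ∈ xs → y ∈ xs → f x ≡ f y → x ≡ y) → Unique xs → Unique (map f xs)
map-Unique f {[]} h [] = []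
map-Unique f {x ∷ xs} h (p ∷ u) =
  Allₚ.map⁺ (All.tabulate (λ i e → All.lookup p i (h (here refl) (there i) e)))
  ∷ map-Unique f (λ i j → h (there i) (there j)) u

module _ {a b} {A : Set a} {B : Set b} {p q} {P : A → Set p} {Q : B → Set q}
         (P? : ∀ x → Dec (P x)) (Q? : ∀ y → Dec (Q y)) where

  ∑𝟙-injection : ∀ {xs ys} → Unique xs → (f : A → B) →
    (∀ {x} → x ∈ xs → P x → f x ∈ ys × Q (f x)) →
    (∀ {x y} → x ∈ xs → y ∈ xs → P x → P y → f x ≡ f y → x ≡ y) →
    ∑ xs (𝟙 ∘ P?) ≤ ∑ ys (𝟙 ∘ Q?)
  ∑𝟙-injection {xs} {ys} u f h inj = begin
    ∑ xs (𝟙 ∘ P?)                  ≡⟨ length-filter-∑ P? xs ⟨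
    length (filter P? xs)          ≡⟨ Lₚ.length-map f (filter P? xs) ⟨
    length (map f (filter P? xs))  ≤⟨ Unique-⊆-length (map-Unique f inj′ (Uniqueₚ.filter⁺ P? u)) sub ⟩
    length (filter Q? ys)          ≡⟨ length-filter-∑ Q? ys ⟩
    ∑ ys (𝟙 ∘ Q?)                  ∎
    where
    open ≤-Reasoning
    inj′ : ∀ {x y} → x ∈ filter P? xs → y ∈ filter P? xs → f x ≡ f y → x ≡ y
    inj′ i j = let i₁ , p₁ = ∈-filter⁻ P? i ; j₁ , p₂ = ∈-filter⁻ P? j in inj i₁ j₁ p₁ p₂
    sub : ∀ {z} → z ∈ map f (filter P? xs) → z ∈ filter Q? ys
    sub i with ∈-map⁻ f i
    ... | x , j , refl = let j₁ , p₁ = ∈-filter⁻ P? {xs = xs} j ; k , q₁ = h j₁ p₁ in ∈-filter⁺ Q? k q₁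

module _ {a} {A : Set a} (_≟_ : DecidableEquality A) where

  open import Data.List.Membership.DecPropositional _≟_ using (_∈?_)

  ⊆∧length⇒⊇ : ∀ {xs ys : List A} → Unique xs → (∀ {x} → x ∈ xs → x ∈ ys) → length ys ≤ length xs →
    ∀ {y} → y ∈ ys → y ∈ xs
  ⊆∧length⇒⊇ {xs} {ys} u h l {y} i with y ∈? xs
  ... | yes j = j
  ... | no ¬j = ⊥-elim (≤⇒≯ l (Unique-⊆-length {xs = y ∷ xs}
    (All.tabulate (λ j e → ¬j (subst (_∈ xs) (sym e) j)) ∷ u) λ { (here refl) → i ; (there j) → h j }))

-- Root counting yields only upper bounds for the colour classes; together with their known total
-- this turns them into exact sizes.
∑-tight : ∀ {a} {A : Set a} (xs : List A) (f : A → ℕ) {c} → (∀ {x} → x ∈ xs → f x ≤ c) →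
  length xs * c ≤ ∑ xs f → ∀ {x} → x ∈ xs → f x ≡ c
∑-tight (x ∷ xs) f {c} h l (here refl) = ≤-antisym (h (here refl))
  (+-cancelʳ-≤ (length xs * c) c (f x) (≤-trans l (+-monoʳ-≤ (f x)
    (≤-trans (∑-mono-∈ xs (h ∘ there)) (≤-reflexive (∑-const xs c))))))
∑-tight (x ∷ xs) f {c} h l (there i) = ∑-tight xs f (h ∘ there)
  (+-cancelˡ-≤ c _ _ (≤-trans l (+-monoˡ-≤ _ (h (here refl))))) i

Unique-lookup-injective : ∀ {a} {A : Set a} {xs : List A} → Unique xs → ∀ i j → L.lookup xs i ≡ L.lookup xs j → i ≡ j
Unique-lookup-injective (p ∷ u) fzero fzero e = refl
Unique-lookup-injective (p ∷ u) fzero (fsuc j) e = ⊥-elim (All.lookup p (∈-lookup j) e)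
Unique-lookup-injective (p ∷ u) (fsuc i) fzero e = ⊥-elim (All.lookup p (∈-lookup i) (sym e))
Unique-lookup-injective (p ∷ u) (fsuc i) (fsuc j) e = cong fsuc (Unique-lookup-injective u i j e)

-- Commutative rings and finite domains.

module RingTheory {A : Set} {_⊞_ _⊠_ : A → A → A} {⊟_ : A → A} {0ᶠ 1ᶠ : A}
  (isCR : IsCommutativeRing _≡_ _⊞_ _⊠_ ⊟_ 0ᶠ 1ᶠ) where

  commutativeRing : CommutativeRing 0ℓ 0ℓ
  commutativeRing = record { isCommutativeRing = isCR }

  open CommutativeRing commutativeRing public
    using (semiring; commutativeSemiring; ring; zeroˡ; zeroʳ; distribˡ; distribʳ)
    renaming (+-assoc to ⊞-assoc; +-comm to ⊞-comm; +-identityˡ to ⊞-identityˡ; +-identityʳ to ⊞-identityʳ;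
              -‿inverseʳ to ⊞-inverseʳ; -‿inverseˡ to ⊞-inverseˡ;
              *-assoc to ⊠-assoc; *-comm to ⊠-comm; *-identityˡ to ⊠-identityˡ; *-identityʳ to ⊠-identityʳ)

  open Algebra.Properties.CommutativeSemiring.Exp commutativeSemiring public
    using () renaming (_^_ to infixr 8 _^ᶠ_; ^-homo-* to ^ᶠ-+; ^-assocʳ to ^ᶠ-*; ^-distrib-* to ^ᶠ-distrib)

  open Algebra.Properties.Semiring.Mult semiring using (×-homo-+; ×1-homo-*) renaming (_×_ to _×ᶠ_) public

  open Algebra.Properties.Ring ring public
    using () renaming (-‿distribˡ-* to ⊟-distribˡ; -‿distribʳ-* to ⊟-distribʳ;
      -‿involutive to ⊟-involutive; -0#≈0# to ⊟0; +-inverseʳ-unique to ⊟-unique;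
      x∙y⁻¹≈ε⇒x≈y to ⊟≡0⇒≡; -‿+-comm to ⊟-⊞; -‿injective to ⊟-injective)

  infixl 6 _−_
  _−_ : A → A → A
  x − y = x ⊞ (⊟ y)

  -- The ring solver runs with formal differences of natural numbers as coefficients.
  private
    rawDiff : RawRing 0ℓ 0ℓ
    rawDiff = record
      { Carrier = ℕ × ℕ ; _≈_ = _≡_
      ; _+_ = λ (a , b) (c , d) → a + c , b + d
      ; _*_ = λ (a , b) (c , d) → a * c + b * d , a * d + b * c
      ; -_ = λ (a , b) → b , a ; 0# = 0 , 0 ; 1# = 1 , 0 }

    ι : ℕ → A
    ι n = n ×ᶠ 1ᶠ

    ⟦_⟧ᵈ : ℕ × ℕ → A
    ⟦ a , b ⟧ᵈ = ι a − ι b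

    interchange : ∀ a b c d → (a ⊞ b) ⊞ (c ⊞ d) ≡ (a ⊞ c) ⊞ (b ⊞ d)
    interchange a b c d = trans (⊞-assoc a b _) (trans (cong (a ⊞_)
      (trans (sym (⊞-assoc b c d)) (trans (cong (_⊞ d) (⊞-comm b c)) (⊞-assoc c b d)))) (sym (⊞-assoc a c _)))

    −-⊞ : ∀ a b c d → (a ⊞ c) − (b ⊞ d) ≡ (a − b) ⊞ (c − d)
    −-⊞ a b c d = trans (cong ((a ⊞ c) ⊞_) (sym (⊟-⊞ b d))) (interchange a c (⊟ b) (⊟ d))

    −-⊠ : ∀ p q r s → ((p ⊠ r) ⊞ (q ⊠ s)) − ((p ⊠ s) ⊞ (q ⊠ r)) ≡ (p − q) ⊠ (r − s)
    −-⊠ p q r s = sym (begin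
      (p − q) ⊠ (r − s)
        ≡⟨ distribʳ (r − s) p (⊟ q) ⟩
      (p ⊠ (r − s)) ⊞ ((⊟ q) ⊠ (r − s))
        ≡⟨ cong₂ _⊞_ (distribˡ p r (⊟ s)) (distribˡ (⊟ q) r (⊟ s)) ⟩
      ((p ⊠ r) ⊞ (p ⊠ (⊟ s))) ⊞ (((⊟ q) ⊠ r) ⊞ ((⊟ q) ⊠ (⊟ s)))
        ≡⟨ cong₂ _⊞_ (cong ((p ⊠ r) ⊞_) (sym (⊟-distribʳ p s)))
             (cong₂ _⊞_ (sym (⊟-distribˡ q r)) (trans (sym (⊟-distribˡ q (⊟ s)))
               (trans (cong ⊟_ (sym (⊟-distribʳ q s))) (⊟-involutive _)))) ⟩
      ((p ⊠ r) ⊞ (⊟ (p ⊠ s))) ⊞ ((⊟ (q ⊠ r)) ⊞ (q ⊠ s))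
        ≡⟨ cong (((p ⊠ r) ⊞ (⊟ (p ⊠ s))) ⊞_) (⊞-comm _ _) ⟩
      ((p ⊠ r) ⊞ (⊟ (p ⊠ s))) ⊞ ((q ⊠ s) ⊞ (⊟ (q ⊠ r)))
        ≡⟨ interchange _ _ _ _ ⟩
      ((p ⊠ r) ⊞ (q ⊠ s)) ⊞ ((⊟ (p ⊠ s)) ⊞ (⊟ (q ⊠ r)))
        ≡⟨ cong (((p ⊠ r) ⊞ (q ⊠ s)) ⊞_) (⊟-⊞ _ _) ⟩
      ((p ⊠ r) ⊞ (q ⊠ s)) − ((p ⊠ s) ⊞ (q ⊠ r)) ∎)
      where
      open ≡-Reasoning

    ι-+* : ∀ a b c d → ι (a * b + c * d) ≡ (ι a ⊠ ι b) ⊞ (ι c ⊠ ι d)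
    ι-+* a b c d = trans (×-homo-+ 1ᶠ (a * b) (c * d)) (cong₂ _⊞_ (×1-homo-* a b) (×1-homo-* c d))

    almost : ACR.AlmostCommutativeRing 0ℓ 0ℓ
    almost = ACR.fromCommutativeRing commutativeRing

    morphism : rawDiff ACR.-Raw-AlmostCommutative⟶ almost
    morphism = record
      { ⟦_⟧ = ⟦_⟧ᵈ
      ; +-homo = λ (a , b) (c , d) → trans (cong₂ _−_ (×-homo-+ 1ᶠ a c) (×-homo-+ 1ᶠ b d)) (−-⊞ _ _ _ _)
      ; *-homo = λ (a , b) (c , d) → trans (cong₂ _−_ (ι-+* a c b d) (ι-+* a d b c)) (−-⊠ _ _ _ _)
      ; -‿homo = λ (a , b) → sym (trans (sym (⊟-⊞ (ι a) (⊟ ι b)))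
                   (trans (⊞-comm _ _) (cong (_⊞ (⊟ ι a)) (⊟-involutive (ι b)))))
      ; 0-homo = ⊞-inverseʳ 0ᶠ
      ; 1-homo = trans (cong₂ _⊞_ (⊞-identityʳ 1ᶠ) ⊟0) (⊞-identityʳ 1ᶠ)
      }

    -- Formal differences are compared by a + d = c + b. This is sufficient but not necessary, since
    -- in characteristic p further coefficients coincide; the solver accepts `nothing` as an answer.
    dec : ∀ x y → Maybe (⟦ x ⟧ᵈ ≡ ⟦ y ⟧ᵈ)
    dec (a , b) (c , d) with a + d ≟ c + b
    ... | no _ = nothing
    ... | yes e = just (begin
      ι a − ι b                      ≡⟨ cong (_⊞ (⊟ ι b)) (sym (trans (⊞-assoc _ _ _) (trans (cong (ι a ⊞_) (⊞-inverseʳ _)) (⊞-identityʳ _)))) ⟩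
      ((ι a ⊞ ι d) − ι d) − ι b      ≡⟨ cong (λ z → (z − ι d) − ι b) (trans (sym (×-homo-+ 1ᶠ a d)) (trans (cong ι e) (×-homo-+ 1ᶠ c b))) ⟩
      ((ι c ⊞ ι b) − ι d) − ι b      ≡⟨ trans (⊞-assoc _ _ _) (interchange (ι c) (ι b) (⊟ ι d) (⊟ ι b)) ⟩
      (ι c − ι d) ⊞ (ι b − ι b)      ≡⟨ trans (cong ((ι c − ι d) ⊞_) (⊞-inverseʳ _)) (⊞-identityʳ _) ⟩
      ι c − ι d ∎)
      where
      open ≡-Reasoning

  open Algebra.Solver.Ring rawDiff almost morphism dec public
    using (solve; _:=_; _:+_; _:*_; _:-_; :-_; _:^_; con)

  ^ᶠ-1 : ∀ n → 1ᶠ ^ᶠ n ≡ 1ᶠ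
  ^ᶠ-1 zero = refl
  ^ᶠ-1 (suc n) = trans (⊠-identityˡ _) (^ᶠ-1 n)

  0^ᶠ : ∀ {n} → 1 ≤ n → 0ᶠ ^ᶠ n ≡ 0ᶠ
  0^ᶠ (s≤s _) = zeroˡ _

  ⊟⊠⊟ : ∀ x y → (⊟ x) ⊠ (⊟ y) ≡ x ⊠ y
  ⊟⊠⊟ = solve 2 (λ x y → ((:- x) :* (:- y)) := (x :* y)) refl

  ≡⇒−≡0 : ∀ {x y} → x ≡ y → x − y ≡ 0ᶠ
  ≡⇒−≡0 {x} refl = ⊞-inverseʳ x

  ⊟−⊟ : ∀ x y → ⊟ (x − y) ≡ y − x
  ⊟−⊟ = solve 2 (λ x y → (:- (x :- y)) := (y :- x)) refl

-- Absence of zero divisors is the form in which the quotient construction delivers a field;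
-- inverses are recovered from finiteness as powers, through `lagrange`.
record IsFiniteDomain {A : Set} (_⊞_ _⊠_ : A → A → A) (⊟_ : A → A) (0ᶠ 1ᶠ : A) (q : ℕ) : Set where
  field
    isCommutativeRing : IsCommutativeRing _≡_ _⊞_ _⊠_ ⊟_ 0ᶠ 1ᶠ
    _≟ᶠ_ : DecidableEquality A
    integral : ∀ {x y} → x ⊠ y ≡ 0ᶠ → x ≡ 0ᶠ ⊎ y ≡ 0ᶠ
    1≢0 : 1ᶠ ≢ 0ᶠ
    elems : List A
    elems-unique : Unique elems
    elems-complete : ∀ x → x ∈ elems
    elems-length : length elems ≡ q

module FiniteDomain {A : Set} {_⊞_ _⊠_ : A → A → A} {⊟_ : A → A} {0ᶠ 1ᶠ : A} {q : ℕ}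
  (D : IsFiniteDomain _⊞_ _⊠_ ⊟_ 0ᶠ 1ᶠ q) where

  open IsFiniteDomain D public
  open RingTheory isCommutativeRing public

  ⊠-≢0 : ∀ {x y} → x ≢ 0ᶠ → y ≢ 0ᶠ → x ⊠ y ≢ 0ᶠ
  ⊠-≢0 p r e with integral e
  ... | inj₁ x=0 = p x=0
  ... | inj₂ y=0 = r y=0

  ⊠-cancelˡ : ∀ {x y z} → x ≢ 0ᶠ → x ⊠ y ≡ x ⊠ z → y ≡ z
  ⊠-cancelˡ {x} {y} {z} p e with integral {x} {y − z}
    (trans (solve 3 (λ x y z → (x :* (y :- z)) := (x :* y :- x :* z)) refl x y z) (≡⇒−≡0 e))
  ... | inj₁ x=0 = ⊥-elim (p x=0)
  ... | inj₂ d=0 = ⊟≡0⇒≡ y z d=0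

  ^ᶠ-≢0 : ∀ {x} n → x ≢ 0ᶠ → x ^ᶠ n ≢ 0ᶠ
  ^ᶠ-≢0 zero p = 1≢0
  ^ᶠ-≢0 (suc n) p = ⊠-≢0 p (^ᶠ-≢0 n p)

  ⊟-≢0 : ∀ {x} → x ≢ 0ᶠ → ⊟ x ≢ 0ᶠ
  ⊟-≢0 p e = p (trans (sym (⊟-involutive _)) (trans (cong ⊟_ e) ⊟0))

  −-≢0 : ∀ {x y} → x ≢ y → x − y ≢ 0ᶠ
  −-≢0 p e = p (⊟≡0⇒≡ _ _ e)

  nonzero? : ∀ x → Dec (x ≢ 0ᶠ)
  nonzero? x = ¬? (x ≟ᶠ 0ᶠ)

  units : List A
  units = filter nonzero? elems

  ∑-elems-≟ : ∀ x → (∑[ y ∈ elems ] 𝟙 (x ≟ᶠ y)) ≡ 1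
  ∑-elems-≟ x = ∑-≟ _≟ᶠ_ elems-unique (elems-complete x)

  ∑-elems-map : (f g : A → A) → (∀ x → g (f x) ≡ x) → (∀ x → f (g x) ≡ x) →
    ∀ h → ∑ elems (h ∘ f) ≡ ∑ elems h
  ∑-elems-map f g gf fg h = trans (sym (∑-map f elems h)) (∑-↭ h
    (Unique-↭ (map-Unique f (λ {x} {y} _ _ e → trans (sym (gf x)) (trans (cong g e) (gf y))) elems-unique) elems-unique
      (λ _ → elems-complete _) (λ {x} _ → subst (_∈ map f elems) (fg x) (∈-map⁺ f (elems-complete (g x))))))

  length-units : suc (length units) ≡ q
  length-units = begin
    suc (length units)                     ≡⟨ cong suc (length-filter-∑ nonzero? elems) ⟩
    1 + ∑ elems (𝟙 ∘ nonzero?)             ≡⟨ cong (_+ ∑ elems (𝟙 ∘ nonzero?)) (sym (∑-elems-≟ 0ᶠ)) ⟩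
    (∑[ x ∈ elems ] 𝟙 (0ᶠ ≟ᶠ x)) + ∑ elems (𝟙 ∘ nonzero?)  ≡⟨ ∑-+ elems _ _ ⟨
    (∑[ x ∈ elems ] 𝟙 (0ᶠ ≟ᶠ x) + 𝟙 (nonzero? x))          ≡⟨ ∑-cong elems one ⟩
    (∑[ x ∈ elems ] 1)                     ≡⟨ trans (∑-const elems 1) (*-identityʳ _) ⟩
    length elems                           ≡⟨ elems-length ⟩
    q ∎
    where
    open ≡-Reasoning
    one : ∀ x → 𝟙 (0ᶠ ≟ᶠ x) + 𝟙 (nonzero? x) ≡ 1
    one x with x ≟ᶠ 0ᶠ
    ... | yes refl = cong (_+ 0) (𝟙-yes (0ᶠ ≟ᶠ 0ᶠ) refl)
    ... | no ne = cong (_+ 1) (𝟙-no (0ᶠ ≟ᶠ x) (ne ∘ sym))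

  private
    prod : List A → A
    prod = L.foldr _⊠_ 1ᶠ

    prod-map : ∀ x xs → prod (map (x ⊠_) xs) ≡ (x ^ᶠ length xs) ⊠ prod xs
    prod-map x [] = sym (⊠-identityˡ 1ᶠ)
    prod-map x (y ∷ ys) = trans (cong ((x ⊠ y) ⊠_) (prod-map x ys))
      (solve 4 (λ x y z w → ((x :* y) :* (z :* w)) := ((x :* z) :* (y :* w))) refl x y _ _)

    prod-≢0 : ∀ xs → All (_≢ 0ᶠ) xs → prod xs ≢ 0ᶠ
    prod-≢0 [] [] = 1≢0
    prod-≢0 (x ∷ xs) (p ∷ ps) = ⊠-≢0 p (prod-≢0 xs ps)

    ∈units⁻ : ∀ {x} → x ∈ units → x ≢ 0ᶠ
    ∈units⁻ i = proj₂ (∈-filter⁻ nonzero? {xs = elems} i)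

    ∈units⁺ : ∀ {x} → x ≢ 0ᶠ → x ∈ units
    ∈units⁺ p = ∈-filter⁺ nonzero? (elems-complete _) p

    units-unique : Unique units
    units-unique = Uniqueₚ.filter⁺ nonzero? elems-unique

    prod-↭ : ∀ {xs ys} → xs ↭ ys → prod xs ≡ prod ys
    prod-↭ ↭-refl = refl
    prod-↭ (prep x p) = cong (x ⊠_) (prod-↭ p)
    prod-↭ (swap x y p) = trans (cong (λ z → x ⊠ (y ⊠ z)) (prod-↭ p))
      (solve 3 (λ x y z → (x :* (y :* z)) := (y :* (x :* z))) refl x y _)
    prod-↭ (↭-trans p r) = trans (prod-↭ p) (prod-↭ r)

  -- Multiplication by a nonzero element of a finite domain is injective, hence permutes the nonzero elements.
  lagrange : ∀ {x} → x ≢ 0ᶠ → x ^ᶠ length units ≡ 1ᶠ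
  lagrange {x} p = sym (⊠-cancelˡ (prod-≢0 units (All.tabulate ∈units⁻)) (begin
    prod units ⊠ 1ᶠ                    ≡⟨ ⊠-identityʳ _ ⟩
    prod units                         ≡⟨ prod-↭ perm ⟩
    prod (map (x ⊠_) units)            ≡⟨ prod-map x units ⟩
    (x ^ᶠ length units) ⊠ prod units   ≡⟨ ⊠-comm _ _ ⟩
    prod units ⊠ (x ^ᶠ length units)   ∎))
    where
    open ≡-Reasoning
    sub : ∀ {y} → y ∈ map (x ⊠_) units → y ∈ units
    sub i with ∈-map⁻ (x ⊠_) i
    ... | z , j , refl = ∈units⁺ (⊠-≢0 p (∈units⁻ j))
    unique′ : Unique (map (x ⊠_) units)
    unique′ = map-Unique (x ⊠_) (λ _ _ → ⊠-cancelˡ p) units-unique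
    perm : units ↭ map (x ⊠_) units
    perm = Unique-↭ units-unique unique′
      (⊆∧length⇒⊇ _≟ᶠ_ unique′ sub (≤-reflexive (sym (Lₚ.length-map (x ⊠_) units)))) sub

  lagrange′ : ∀ {m} → suc m ≡ q → ∀ {x} → x ≢ 0ᶠ → x ^ᶠ m ≡ 1ᶠ
  lagrange′ {m} e p = subst (λ k → _ ^ᶠ k ≡ 1ᶠ) (suc-injective (trans length-units (sym e))) (lagrange p)

  x^q≡x : ∀ x → x ^ᶠ q ≡ x
  x^q≡x x with x ≟ᶠ 0ᶠ
  ... | yes refl = 0^ᶠ (subst (1 ≤_) length-units (s≤s z≤n))
  ... | no p = subst (λ k → x ^ᶠ k ≡ x) length-units (trans (cong (x ⊠_) (lagrange p)) (⊠-identityʳ x))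

  inv : A → A
  inv x = x ^ᶠ pred (length units)

  inverseʳ : ∀ {x} → x ≢ 0ᶠ → x ⊠ inv x ≡ 1ᶠ
  inverseʳ {x} p = trans (cong (λ k → x ^ᶠ k) {suc (pred (length units))} {length units} (suc-pred′ {length units} (∈-length (∈units⁺ 1≢0)))) (lagrange p)
    where
    suc-pred′ : ∀ {m} → 1 ≤ m → suc (pred m) ≡ m
    suc-pred′ (s≤s _) = refl

  inv-≢0 : ∀ {x} → x ≢ 0ᶠ → inv x ≢ 0ᶠ
  inv-≢0 p = ^ᶠ-≢0 (pred (length units)) p

  -- The vector (a₀, …, aₘ₋₁) stands for the monic polynomial a₀ + a₁X + … + aₘ₋₁Xᵐ⁻¹ + Xᵐ.
  evalMonic : ∀ {m} → Vec A m → A → A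
  evalMonic [] x = 1ᶠ
  evalMonic (a ∷ as) x = a ⊞ (x ⊠ evalMonic as x)

  private
    addScaled : ∀ {m} → A → Vec A (suc m) → Vec A m → Vec A (suc m)
    addScaled r (g ∷ []) [] = (g ⊞ r) ∷ []
    addScaled r (g ∷ gs) (h ∷ hs) = (g ⊞ (r ⊠ h)) ∷ addScaled r gs hs

    eval-addScaled : ∀ {m} r (g : Vec A (suc m)) (h : Vec A m) x →
      evalMonic (addScaled r g h) x ≡ evalMonic g x ⊞ (r ⊠ evalMonic h x)
    eval-addScaled r (g ∷ []) [] x rewrite ⊠-identityʳ x | ⊠-identityʳ r =
      solve 3 (λ g r x → (g :+ r) :+ x := (g :+ x) :+ r) refl g r x
    eval-addScaled r (g ∷ g′ ∷ gs) (h ∷ hs) x =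
      trans (cong (λ z → (g ⊞ (r ⊠ h)) ⊞ (x ⊠ z)) (eval-addScaled r (g′ ∷ gs) hs x))
        (solve 6 (λ g r h x G H → (g :+ r :* h) :+ x :* (G :+ r :* H) := (g :+ x :* G) :+ r :* (h :+ x :* H)) refl g r h x _ _)

    -- Synthetic division: for f = a + X f′ and f′ = f′(r) + (X - r) h one gets f = f(r) + (X -
    -- r)(f′ + r h). Leading coefficients are implicit, so `addScaled` adds r h to a monic f′ whose
    -- degree is one higher than that of h.
    quotient : ∀ {m} → A → Vec A (suc m) → Vec A m
    quotient r (a ∷ []) = []
    quotient r (a ∷ b ∷ bs) = addScaled r (b ∷ bs) (quotient r (b ∷ bs))

    eval-quotient : ∀ {m} r (f : Vec A (suc m)) x →
      evalMonic f x ≡ evalMonic f r ⊞ ((x − r) ⊠ evalMonic (quotient r f) x)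
    eval-quotient r (a ∷ []) x rewrite ⊠-identityʳ x | ⊠-identityʳ r | ⊠-identityʳ (x − r) =
      solve 3 (λ a x r → a :+ x := (a :+ r) :+ (x :- r)) refl a x r
    eval-quotient r (a ∷ b ∷ bs) x rewrite eval-addScaled r (b ∷ bs) (quotient r (b ∷ bs)) x
      | eval-quotient r (b ∷ bs) x =
      solve 5 (λ a x r G Q → a :+ x :* (G :+ (x :- r) :* Q) := (a :+ r :* G) :+ (x :- r) :* ((G :+ (x :- r) :* Q) :+ r :* Q)) refl a x r _ _

  roots-bound : ∀ {m} (f : Vec A m) {rs} → Unique rs → All (λ r → evalMonic f r ≡ 0ᶠ) rs → length rs ≤ m
  roots-bound f {[]} u h = z≤n
  roots-bound [] {r ∷ rs} u (p ∷ _) = ⊥-elim (1≢0 p)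
  roots-bound (a ∷ as) {r ∷ rs} (p ∷ u) (e ∷ h) = s≤s (roots-bound (quotient r (a ∷ as)) u
    (All.tabulate λ {x} i → case integral (trans (sym (trans (eval-quotient r (a ∷ as) x) (trans (cong (λ z → z ⊞ ((x − r) ⊠ evalMonic (quotient r (a ∷ as)) x)) e) (⊞-identityˡ _)))) (All.lookup h i)) of λ
      { (inj₁ d) → ⊥-elim (All.lookup p i (sym (⊟≡0⇒≡ x r d))) ; (inj₂ z) → z }))

  private
    evalMonic-^ : ∀ m x → evalMonic (replicate m 0ᶠ) x ≡ x ^ᶠ m
    evalMonic-^ zero x = refl
    evalMonic-^ (suc m) x = trans (⊞-identityˡ _) (cong (x ⊠_) (evalMonic-^ m x))

  powerRoots : ∀ m → 1 ≤ m → ∀ c → (∑[ x ∈ elems ] 𝟙 ((x ^ᶠ m) ≟ᶠ c)) ≤ m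
  powerRoots (suc m) _ c = subst (_≤ suc m) (length-filter-∑ R? elems)
    (roots-bound ((⊟ c) ∷ replicate m 0ᶠ) (Uniqueₚ.filter⁺ R? elems-unique)
      (All.tabulate λ {x} i → trans (cong (λ z → (⊟ c) ⊞ (x ⊠ z)) (evalMonic-^ m x))
        (trans (cong ((⊟ c) ⊞_) (proj₂ (∈-filter⁻ R? {xs = elems} i))) (⊞-inverseˡ c))))
    where
    R? : ∀ x → Dec (x ^ᶠ suc m ≡ c)
    R? x = (x ^ᶠ suc m) ≟ᶠ c

  x^m≡x⇒size≤ : ∀ {m} → 2 ≤ m → (∀ x → x ^ᶠ m ≡ x) → q ≤ m
  x^m≡x⇒size≤ {suc (suc m)} (s≤s (s≤s _)) h = subst (_≤ suc (suc m)) elems-length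
    (roots-bound (0ᶠ ∷ (⊟ 1ᶠ) ∷ replicate m 0ᶠ) elems-unique (All.tabulate λ {x} _ → begin
      0ᶠ ⊞ (x ⊠ ((⊟ 1ᶠ) ⊞ (x ⊠ evalMonic (replicate m 0ᶠ) x)))
        ≡⟨ cong (λ z → 0ᶠ ⊞ (x ⊠ ((⊟ 1ᶠ) ⊞ (x ⊠ z)))) (evalMonic-^ m x) ⟩
      0ᶠ ⊞ (x ⊠ ((⊟ 1ᶠ) ⊞ (x ⊠ (x ^ᶠ m))))
        ≡⟨ ⊞-identityˡ _ ⟩
      x ⊠ ((⊟ 1ᶠ) ⊞ (x ⊠ (x ^ᶠ m)))
        ≡⟨ solve 3 (λ x o y → x :* (:- o :+ x :* y) := x :* (x :* y) :- x :* o) refl x 1ᶠ (x ^ᶠ m) ⟩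
      (x ^ᶠ suc (suc m)) − (x ⊠ 1ᶠ)
        ≡⟨ ≡⇒−≡0 (trans (h x) (sym (⊠-identityʳ x))) ⟩
      0ᶠ ∎))
    where
    open ≡-Reasoning

-- Colours modulo seventh powers and the representatives S.

module Colours {A : Set} {_⊞_ _⊠_ : A → A → A} {⊟_ : A → A} {0ᶠ 1ᶠ : A} {q : ℕ}
  (D : IsFiniteDomain _⊞_ _⊠_ ⊟_ 0ᶠ 1ᶠ q) (n : ℕ) (1≤n : 1 ≤ n) (q≡ : q ≡ 14 * n + 1) where

  open FiniteDomain D public

  private
    1+14n≡q : suc (14 * n) ≡ q
    1+14n≡q = trans (+-comm 1 (14 * n)) (sym q≡)

  -- The class of x modulo seventh powers, as a seventh root of unity.
  colour : A → A
  colour x = x ^ᶠ (2 * n)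

  1≤2n : 1 ≤ 2 * n
  1≤2n = ≤-trans 1≤n (m≤m+n n _)

  colour-0 : colour 0ᶠ ≡ 0ᶠ
  colour-0 = 0^ᶠ 1≤2n

  colour-≢0 : ∀ {x} → x ≢ 0ᶠ → colour x ≢ 0ᶠ
  colour-≢0 = ^ᶠ-≢0 (2 * n)

  colour≢0⇒≢0 : ∀ {x} → colour x ≢ 0ᶠ → x ≢ 0ᶠ
  colour≢0⇒≢0 p refl = p colour-0

  colour-⊠ : ∀ x y → colour (x ⊠ y) ≡ colour x ⊠ colour y
  colour-⊠ x y = ^ᶠ-distrib x y (2 * n)

  colour-⊟ : ∀ x → colour (⊟ x) ≡ colour x
  colour-⊟ x = begin
    (⊟ x) ^ᶠ (2 * n)     ≡⟨ ^ᶠ-* (⊟ x) 2 n ⟨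
    ((⊟ x) ^ᶠ 2) ^ᶠ n    ≡⟨ cong (_^ᶠ n) (square x) ⟩
    (x ^ᶠ 2) ^ᶠ n        ≡⟨ ^ᶠ-* x 2 n ⟩
    x ^ᶠ (2 * n)         ∎
    where
    open ≡-Reasoning
    square : ∀ x → (⊟ x) ^ᶠ 2 ≡ x ^ᶠ 2
    square x rewrite ⊠-identityʳ x | ⊠-identityʳ (⊟ x) = ⊟⊠⊟ x x

  μ₇? : ∀ ζ → Dec (ζ ^ᶠ 7 ≡ 1ᶠ)
  μ₇? ζ = (ζ ^ᶠ 7) ≟ᶠ 1ᶠ

  μ₇ : List A
  μ₇ = filter μ₇? elems

  μ₇-unique : Unique μ₇
  μ₇-unique = Uniqueₚ.filter⁺ μ₇? elems-unique

  ∈μ₇⇒≢0 : ∀ {ζ} → ζ ∈ μ₇ → ζ ≢ 0ᶠ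
  ∈μ₇⇒≢0 i refl = 1≢0 (trans (sym (proj₂ (∈-filter⁻ μ₇? {xs = elems} i))) (0^ᶠ {7} (s≤s z≤n)))

  colour-∈μ₇ : ∀ {x} → x ≢ 0ᶠ → colour x ∈ μ₇
  colour-∈μ₇ {x} p = ∈-filter⁺ μ₇? (elems-complete _) (trans (^ᶠ-* x (2 * n) 7)
    (trans (cong (x ^ᶠ_) (trans (*-comm (2 * n) 7) (sym (*-assoc 7 2 n)))) (lagrange′ 1+14n≡q p)))

  classSize : A → ℕ
  classSize ζ = ∑[ x ∈ elems ] 𝟙 (colour x ≟ᶠ ζ)

  ∑-colours : ∀ x → (∑[ ζ ∈ μ₇ ] 𝟙 (colour x ≟ᶠ ζ)) ≡ 𝟙 (nonzero? x)
  ∑-colours x = lemma (nonzero? x)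
    where
    lemma : (d : Dec (x ≢ 0ᶠ)) → (∑[ ζ ∈ μ₇ ] 𝟙 (colour x ≟ᶠ ζ)) ≡ 𝟙 d
    lemma (yes p) = ∑-≟ _≟ᶠ_ μ₇-unique (colour-∈μ₇ p)
    lemma (no ¬p) = trans (∑-cong-∈ μ₇ (λ {ζ} i → 𝟙-no (colour x ≟ᶠ ζ)
      (λ e → ¬p (colour≢0⇒≢0 (subst (_≢ 0ᶠ) (sym e) (∈μ₇⇒≢0 i)))))) (∑-0 μ₇)

  ∑-nonzero : ∑ elems (𝟙 ∘ nonzero?) ≡ 14 * n
  ∑-nonzero = trans (sym (length-filter-∑ nonzero? elems)) (suc-injective (trans length-units (sym 1+14n≡q)))

  private
    ∑-classSize : ∑ μ₇ classSize ≡ 14 * n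
    ∑-classSize = trans (∑-swap μ₇ elems _) (trans (∑-cong elems ∑-colours) ∑-nonzero)

    |μ₇|≤7 : length μ₇ ≤ 7
    |μ₇|≤7 = subst (_≤ 7) (sym (length-filter-∑ μ₇? elems)) (powerRoots 7 (s≤s z≤n) 1ᶠ)

    7*2n : 7 * (2 * n) ≡ 14 * n
    7*2n = sym (*-assoc 7 2 n)

    tight : 7 * (2 * n) ≤ length μ₇ * (2 * n)
    tight = subst₂ _≤_ (trans ∑-classSize (sym 7*2n)) (∑-const μ₇ (2 * n))
      (∑-mono μ₇ (powerRoots (2 * n) 1≤2n))

  -- The root bounds give at most 7 colours and at most 2n elements of each colour, while 14n
  -- nonzero elements have to be coloured. There is no slack, so both bounds are attained.
  |μ₇|≡7 : length μ₇ ≡ 7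
  |μ₇|≡7 = ≤-antisym |μ₇|≤7 (*-cancelʳ-≤ 7 _ (2 * n) {{>-nonZero 1≤2n}} tight)

  classSize≡2n : ∀ {ζ} → ζ ∈ μ₇ → classSize ζ ≡ 2 * n
  classSize≡2n = ∑-tight μ₇ classSize (λ {ζ} _ → powerRoots (2 * n) 1≤2n ζ)
    (≤-reflexive (trans (cong (_* (2 * n)) |μ₇|≡7) (trans 7*2n (sym ∑-classSize))))

  square≡1 : ∀ {z} → z ⊠ z ≡ 1ᶠ → z ≡ 1ᶠ ⊎ z ≡ ⊟ 1ᶠ
  square≡1 {z} e = case integral {z − 1ᶠ} {z ⊞ 1ᶠ}
      (trans (solve 2 (λ z o → (z :- o) :* (z :+ o) := z :* z :- o :* o) refl z 1ᶠ)
        (≡⇒−≡0 (trans e (sym (⊠-identityˡ 1ᶠ))))) of λ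
    { (inj₁ d) → inj₁ (⊟≡0⇒≡ z 1ᶠ d)
    ; (inj₂ d) → inj₂ (⊟-unique 1ᶠ z (trans (⊞-comm 1ᶠ z) d)) }

  -- If every nonzero y satisfied y^(7n) = 1, there would be too many roots; otherwise y^(7n) = −1 for some y.
  ⊟1≢1 : ⊟ 1ᶠ ≢ 1ᶠ
  ⊟1≢1 e = <⇒≱ (*-monoˡ-< n {{>-nonZero 1≤n}} {7} {14} (s≤s (s≤s (s≤s (s≤s (s≤s (s≤s (s≤s (s≤s z≤n)))))))))
    (subst (_≤ 7 * n) ∑-nonzero (≤-trans (∑-mono elems (λ x → 𝟙-mono (nonzero? x) ((x ^ᶠ (7 * n)) ≟ᶠ 1ᶠ) root))
      (powerRoots (7 * n) (≤-trans 1≤n (m≤m+n n _)) 1ᶠ)))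
    where
    root : ∀ {x} → x ≢ 0ᶠ → x ^ᶠ (7 * n) ≡ 1ᶠ
    root {x} p = case square≡1 (trans (sym (^ᶠ-+ x (7 * n) (7 * n)))
        (trans (cong (x ^ᶠ_) (sym (*-distribʳ-+ n 7 7))) (lagrange′ 1+14n≡q p))) of λ
      { (inj₁ z=1) → z=1 ; (inj₂ z=-1) → trans z=-1 e }

  x≢⊟x : ∀ {x} → x ≢ 0ᶠ → x ≢ ⊟ x
  x≢⊟x {x} p e = ⊟1≢1 (sym (⊠-cancelˡ p (trans (⊠-identityʳ x)
    (trans e (trans (cong ⊟_ (sym (⊠-identityʳ x))) (⊟-distribʳ x 1ᶠ))))))

  private
    -- The position in the enumeration serves as an arbitrary linear order, by which `S` takes the
    -- earlier of x and -x.
    index : A → ℕ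
    index x = toℕ (Any.index (elems-complete x))

    index-injective : ∀ {x y} → index x ≡ index y → x ≡ y
    index-injective {x} {y} e = trans (lookup-index (elems-complete x))
      (trans (cong (L.lookup elems) (toℕ-injective e)) (sym (lookup-index (elems-complete y))))

  -- S is a set of representatives of {±1} in the group of seventh powers.
  S? : ∀ x → Dec (colour x ≡ 1ᶠ × index x < index (⊟ x))
  S? x = (colour x ≟ᶠ 1ᶠ) ×-dec (index x <? index (⊟ x))

  S : List A
  S = filter S? elems

  ∈S⇒colour : ∀ {s} → s ∈ S → colour s ≡ 1ᶠ
  ∈S⇒colour i = proj₁ (proj₂ (∈-filter⁻ S? {xs = elems} i))

  ∈S⇒≢0 : ∀ {s} → s ∈ S → s ≢ 0ᶠ
  ∈S⇒≢0 i = colour≢0⇒≢0 (subst (_≢ 0ᶠ) (sym (∈S⇒colour i)) 1≢0)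

  ∈S⇒⊟∉S : ∀ {s} → s ∈ S → ⊟ s ∉ S
  ∈S⇒⊟∉S {s} i j = <-asym (proj₂ (proj₂ (∈-filter⁻ S? {xs = elems} i)))
    (subst (λ z → index (⊟ s) < index z) (⊟-involutive s) (proj₂ (proj₂ (∈-filter⁻ S? {xs = elems} j))))

  S±S : ∀ {z} → z ≢ 0ᶠ → 𝟙 (S? z) + 𝟙 (S? (⊟ z)) ≡ 𝟙 (colour z ≟ᶠ 1ᶠ)
  S±S {z} p with colour z ≟ᶠ 1ᶠ
  ... | no ¬c = trans (cong (_+ 𝟙 (S? (⊟ z))) refl) (𝟙-no (S? (⊟ z)) λ (c , _) → ¬c (trans (sym (colour-⊟ z)) c))
  ... | yes c with <-cmp (index z) (index (⊟ z))
  ... | tri≈ _ e _ = ⊥-elim (x≢⊟x p (index-injective e))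
  ... | tri< l _ ¬g = cong₂ _+_ (𝟙-yes (index z <? index (⊟ z)) l)
    (𝟙-no (S? (⊟ z)) λ (_ , g) → ¬g (subst (λ w → index (⊟ z) < index w) (⊟-involutive z) g))
  ... | tri> ¬l _ g = cong₂ _+_ (𝟙-no (index z <? index (⊟ z)) ¬l)
    (𝟙-yes (S? (⊟ z)) (trans (colour-⊟ z) c , subst (λ w → index (⊟ z) < index w) (sym (⊟-involutive z)) g))

  length-S : length S ≡ n
  length-S = *-cancelˡ-≡ (length S) n 2 (begin
    2 * length S                                                ≡⟨ cong (length S +_) (+-identityʳ _) ⟩
    length S + length S                                         ≡⟨ cong₂ _+_ (length-filter-∑ S? elems) (length-filter-∑ S? elems) ⟩
    ∑ elems (𝟙 ∘ S?) + ∑ elems (𝟙 ∘ S?)                         ≡⟨ cong (∑ elems (𝟙 ∘ S?) +_) (∑-elems-map ⊟_ ⊟_ ⊟-involutive ⊟-involutive (𝟙 ∘ S?)) ⟨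
    ∑ elems (𝟙 ∘ S?) + (∑[ z ∈ elems ] 𝟙 (S? (⊟ z)))            ≡⟨ ∑-+ elems _ _ ⟨
    (∑[ z ∈ elems ] 𝟙 (S? z) + 𝟙 (S? (⊟ z)))                    ≡⟨ ∑-cong elems pm ⟩
    classSize 1ᶠ                                                ≡⟨ classSize≡2n (∈-filter⁺ μ₇? (elems-complete 1ᶠ) (^ᶠ-1 7)) ⟩
    2 * n ∎)
    where
    open ≡-Reasoning
    pm : ∀ z → 𝟙 (S? z) + 𝟙 (S? (⊟ z)) ≡ 𝟙 (colour z ≟ᶠ 1ᶠ)
    pm z = case nonzero? z of λ
      { (yes p) → S±S p
      ; (no ¬p) → trans (cong₂ _+_ (𝟙-no (S? z) (λ (c , _) → ¬p (colour≢0⇒≢0 (subst (_≢ 0ᶠ) (sym c) 1≢0))))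
                    (𝟙-no (S? (⊟ z)) (λ (c , _) → ¬p (colour≢0⇒≢0 (subst (_≢ 0ᶠ) (trans (sym c) (colour-⊟ z)) 1≢0)))))
                    (sym (𝟙-no (colour z ≟ᶠ 1ᶠ) (λ c → ¬p (colour≢0⇒≢0 (subst (_≢ 0ᶠ) (sym c) 1≢0))))) }

  private
    dilates : A → A → ℕ
    dilates t y = ∑[ s ∈ S ] 𝟙 ((s ⊠ t) ≟ᶠ y)

    dilates-S : ∀ {t} y → t ≢ 0ᶠ → dilates t y ≡ 𝟙 (S? (y ⊠ inv t))
    dilates-S {t} y p = begin
      dilates t y                                             ≡⟨ ∑-filter S? elems _ ⟩
      (∑[ s ∈ elems ] 𝟙 (S? s) * 𝟙 ((s ⊠ t) ≟ᶠ y))             ≡⟨ ∑-cong elems only ⟩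
      (∑[ s ∈ elems ] 𝟙 (S? (y ⊠ inv t)) * 𝟙 ((y ⊠ inv t) ≟ᶠ s))  ≡⟨ ∑-*ˡ elems (𝟙 (S? (y ⊠ inv t))) _ ⟩
      𝟙 (S? (y ⊠ inv t)) * (∑[ s ∈ elems ] 𝟙 ((y ⊠ inv t) ≟ᶠ s))  ≡⟨ cong (𝟙 (S? (y ⊠ inv t)) *_) (∑-elems-≟ _) ⟩
      𝟙 (S? (y ⊠ inv t)) * 1                                  ≡⟨ *-identityʳ _ ⟩
      𝟙 (S? (y ⊠ inv t))                                      ∎
      where
      open ≡-Reasoning
      solved : ∀ {s} → s ⊠ t ≡ y → y ⊠ inv t ≡ s
      solved {s} refl = trans (⊠-assoc s t (inv t)) (trans (cong (s ⊠_) (inverseʳ p)) (⊠-identityʳ s))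
      unsolved : ∀ {s} → y ⊠ inv t ≡ s → s ⊠ t ≡ y
      unsolved refl = trans (⊠-assoc y (inv t) t) (trans (cong (y ⊠_) (trans (⊠-comm (inv t) t) (inverseʳ p))) (⊠-identityʳ y))
      only : ∀ s → 𝟙 (S? s) * 𝟙 ((s ⊠ t) ≟ᶠ y) ≡ 𝟙 (S? (y ⊠ inv t)) * 𝟙 ((y ⊠ inv t) ≟ᶠ s)
      only s = trans (cong (𝟙 (S? s) *_) (𝟙-⇔ ((s ⊠ t) ≟ᶠ y) ((y ⊠ inv t) ≟ᶠ s) solved unsolved)) (aux ((y ⊠ inv t) ≟ᶠ s))
        where
        aux : (d : Dec (y ⊠ inv t ≡ s)) → 𝟙 (S? s) * 𝟙 d ≡ 𝟙 (S? (y ⊠ inv t)) * 𝟙 d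
        aux (yes refl) = refl
        aux (no _) = trans (*-zeroʳ (𝟙 (S? s))) (sym (*-zeroʳ (𝟙 (S? (y ⊠ inv t)))))

  -- The quotient y / t has colour 1 exactly when t and y have the same colour, and an element of
  -- colour 1 lies in exactly one of S and -S. Both the partition and the difference count of the
  -- design are reduced to this fact.
  ∑-dilates : ∀ {t y} → t ≢ 0ᶠ → y ≢ 0ᶠ →
    (∑[ s ∈ S ] 𝟙 ((s ⊠ t) ≟ᶠ y)) + (∑[ s ∈ S ] 𝟙 ((s ⊠ (⊟ t)) ≟ᶠ y)) ≡ 𝟙 (colour t ≟ᶠ colour y)
  ∑-dilates {t} {y} p r = begin
    dilates t y + dilates (⊟ t) y            ≡⟨ cong₂ _+_ (dilates-S y p) (trans neg (dilates-S (⊟ y) p)) ⟩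
    𝟙 (S? z) + 𝟙 (S? ((⊟ y) ⊠ inv t))        ≡⟨ cong (λ w → 𝟙 (S? z) + 𝟙 (S? w)) (sym (⊟-distribˡ y (inv t))) ⟩
    𝟙 (S? z) + 𝟙 (S? (⊟ z))                  ≡⟨ S±S (⊠-≢0 r (inv-≢0 p)) ⟩
    𝟙 (colour z ≟ᶠ 1ᶠ)                       ≡⟨ 𝟙-⇔ (colour z ≟ᶠ 1ᶠ) (colour t ≟ᶠ colour y) to from ⟩
    𝟙 (colour t ≟ᶠ colour y)                 ∎
    where
    open ≡-Reasoning
    z : A
    z = y ⊠ inv t
    neg : dilates (⊟ t) y ≡ dilates t (⊟ y)
    neg = ∑-cong S (λ s → 𝟙-⇔ ((s ⊠ (⊟ t)) ≟ᶠ y) ((s ⊠ t) ≟ᶠ (⊟ y))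
      (λ e → trans (sym (⊟-involutive _)) (cong ⊟_ (trans (⊟-distribʳ s t) e)))
      (λ e → trans (sym (⊟-distribʳ s t)) (trans (cong ⊟_ e) (⊟-involutive y))))
    zt : z ⊠ t ≡ y
    zt = trans (⊠-assoc y (inv t) t) (trans (cong (y ⊠_) (trans (⊠-comm (inv t) t) (inverseʳ p))) (⊠-identityʳ y))
    to : colour z ≡ 1ᶠ → colour t ≡ colour y
    to e = sym (trans (cong colour (sym zt)) (trans (colour-⊠ z t) (trans (cong (_⊠ colour t) e) (⊠-identityˡ _))))
    from : colour t ≡ colour y → colour z ≡ 1ᶠ
    from e = ⊠-cancelˡ (colour-≢0 p) (trans (⊠-comm _ _) (trans (sym (colour-⊠ z t))
      (trans (cong colour zt) (trans (sym e) (sym (⊠-identityʳ _))))))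

-- Binomial coefficients modulo a prime and the Frobenius map.

module _ {p} (pp : Prime p) where

  private instance
    p≢0 : NonZero p
    p≢0 = prime⇒nonZero pp

  1<p : 1 < p
  1<p = >-nonTrivial {{prime⇒nonTrivial pp}}
    where
    open import Data.Nat using (NonTrivial; nonTrivial⇒n>1)
    >-nonTrivial : ∀ {m} {{_ : NonTrivial m}} → 1 < m
    >-nonTrivial {m} = nonTrivial⇒n>1 m

  prime∤! : ∀ m → m < p → ¬ (p ∣ m !)
  prime∤! zero _ d = <⇒≱ 1<p (∣⇒≤ d)
  prime∤! (suc m) l d with euclidsLemma (suc m) (m !) pp d
  ... | inj₁ d′ = <⇒≱ l (∣⇒≤ d′)
  ... | inj₂ d′ = prime∤! m (<-trans (n<1+n m) l) d′

  prime∣C : ∀ k → 1 ≤ k → k < p → p ∣ (p C′ k)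
  prime∣C k 1≤k k<p with euclidsLemma (p C′ k) (k ! * (p ∸ k) !) pp (subst (p ∣_) (sym eq) p∣p!)
    where
    instance
      nz : NonZero (k ! * (p ∸ k) !)
      nz = k !* (p ∸ k) !≢0
    eq : (p C′ k) * (k ! * (p ∸ k) !) ≡ p !
    eq = trans (cong (_* (k ! * (p ∸ k) !)) (nCk≡n!/k![n-k]! (<⇒≤ k<p))) (m/n*n≡m (k![n∸k]!∣n! (<⇒≤ k<p)))
    p∣p! : p ∣ p !
    p∣p! = self p
      where
      self : ∀ m .{{_ : NonZero m}} → m ∣ m !
      self (suc m) = m∣m*n (m !)
  ... | inj₁ d = d
  ... | inj₂ d with euclidsLemma (k !) ((p ∸ k) !) pp d
  ... | inj₁ d′ = ⊥-elim (prime∤! k k<p d′)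
  ... | inj₂ d′ = ⊥-elim (prime∤! (p ∸ k) (m∸n<m p k 1≤k) d′)
    where
    m∸n<m : ∀ m n .{{_ : NonZero m}} → 1 ≤ n → m ∸ n < m
    m∸n<m (suc m) (suc n) _ = s≤s (m∸n≤m m n)

module Frobenius {A : Set} {_⊞_ _⊠_ : A → A → A} {⊟_ : A → A} {0ᶠ 1ᶠ : A}
  (isCR : IsCommutativeRing _≡_ _⊞_ _⊠_ ⊟_ 0ᶠ 1ᶠ)
  {p} (pp : Prime p) (char : RingTheory._×ᶠ_ isCR p 1ᶠ ≡ 0ᶠ) where

  open RingTheory isCR
  open Algebra.Properties.Semiring.Mult semiring using (×-assocˡ; ×-congʳ; ×-homo-1; ×-assoc-*)
  open Algebra.Properties.Semiring.Sum semiring using (sum-cong-≋; sum-init-last; sum-replicate-zero) renaming (sum to sumᶠ)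
  open Algebra.Properties.CommutativeSemiring.Binomial commutativeSemiring using (theorem; binomialTerm; binomial)

  private
    p×0 : ∀ x → p ×ᶠ x ≡ 0ᶠ
    p×0 x = trans (cong (p ×ᶠ_) (sym (⊠-identityˡ x))) (trans (sym (×-assoc-* p 1ᶠ x)) (trans (cong (_⊠ x) char) (zeroˡ x)))

    ∣×0 : ∀ {m} → p ∣ m → ∀ x → m ×ᶠ x ≡ 0ᶠ
    ∣×0 (divides c refl) x = trans (cong (_×ᶠ x) (*-comm c p)) (trans (sym (×-assocˡ x p c)) (p×0 (c ×ᶠ x)))

    -- Only the two extreme terms of the binomial expansion survive.
    collapse : ∀ m (t : Fin (suc (suc m)) → A) → (∀ i → t (fsuc (inject₁ i)) ≡ 0ᶠ) →
      sumᶠ t ≡ t fzero ⊞ t (fsuc (fromℕ m))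
    collapse m t h = cong (t fzero ⊞_) (trans (sum-init-last (t ∘ fsuc))
      (trans (cong (_⊞ t (fsuc (fromℕ m))) (trans (sum-cong-≋ h) (sum-replicate-zero m))) (⊞-identityˡ _)))

  ^p-⊞ : ∀ x y → (x ⊞ y) ^ᶠ p ≡ (x ^ᶠ p) ⊞ (y ^ᶠ p)
  ^p-⊞ = go p refl
    where
    go : ∀ m → m ≡ p → ∀ x y → (x ⊞ y) ^ᶠ p ≡ (x ^ᶠ p) ⊞ (y ^ᶠ p)
    go zero e = ⊥-elim (<⇒≱ (1<p pp) (subst (_≤ 1) e z≤n))
    go (suc m) refl x y = trans (theorem p x y) (trans (collapse m (binomialTerm x y p) middle)
      (trans (⊞-comm _ _) (cong₂ _⊞_ top bottom)))
      where
      middle : ∀ i → binomialTerm x y p (fsuc (inject₁ i)) ≡ 0ᶠ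
      middle i = ∣×0 (prime∣C pp (suc (toℕ (inject₁ i))) (s≤s z≤n)
        (s≤s (subst (_< m) (sym (Fₚ.toℕ-inject₁ i)) (toℕ<n i)))) _
      bottom : binomialTerm x y p fzero ≡ y ^ᶠ p
      bottom = trans (×-homo-1 _) (⊠-identityˡ _)
      top : binomialTerm x y p (fsuc (fromℕ m)) ≡ x ^ᶠ p
      top = trans (cong (λ a → (p C′ a) ×ᶠ ((x ^ᶠ a) ⊠ (y ^ᶠ (p ∸ a)))) (cong suc (Fₚ.toℕ-fromℕ m)))
        (trans (cong₂ (λ c d → c ×ᶠ ((x ^ᶠ p) ⊠ (y ^ᶠ d))) (nCn≡1 p) (n∸n≡0 p)) (trans (×-homo-1 _) (⊠-identityʳ _)))

  ^pᵏ-⊞ : ∀ k x y → (x ⊞ y) ^ᶠ (p ^ k) ≡ (x ^ᶠ (p ^ k)) ⊞ (y ^ᶠ (p ^ k))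
  ^pᵏ-⊞ zero x y = trans (⊠-identityʳ _) (sym (cong₂ _⊞_ (⊠-identityʳ x) (⊠-identityʳ y)))
  ^pᵏ-⊞ (suc k) x y = trans (sym (^ᶠ-* (x ⊞ y) p (p ^ k))) (trans (cong (_^ᶠ (p ^ k)) (^p-⊞ x y))
    (trans (^pᵏ-⊞ k (x ^ᶠ p) (y ^ᶠ p)) (cong₂ _⊞_ (^ᶠ-* x p (p ^ k)) (^ᶠ-* y p (p ^ k)))))

-- The prime field on `Fin p`.

module PrimeField (p : ℕ) .{{_ : NonZero p}} where

  infixl 5 _+ₚ_
  infixl 6 _*ₚ_
  _+ₚ_ _*ₚ_ : Fin p → Fin p → Fin p
  _+ₚ_ = addMod p
  a *ₚ b = (toℕ a * toℕ b) mod p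

  -ₚ_ : Fin p → Fin p
  -ₚ_ = negMod p

  0ₚ 1ₚ : Fin p
  0ₚ = zeroMod p
  1ₚ = 1 mod p

  toℕ-mod : ∀ a → toℕ (a mod p) ≡ a % p
  toℕ-mod a = toℕ-fromℕ< (m%n<n a p)

  mod-cong : ∀ {a b} → a % p ≡ b % p → a mod p ≡ b mod p
  mod-cong {a} {b} e = toℕ-injective (trans (toℕ-mod a) (trans e (sym (toℕ-mod b))))

  toℕ-% : ∀ (a : Fin p) → toℕ a % p ≡ toℕ a
  toℕ-% a = m<n⇒m%n≡m (toℕ<n a)

  toℕ-mod-id : ∀ (a : Fin p) → toℕ a mod p ≡ a
  toℕ-mod-id a = toℕ-injective (trans (toℕ-mod (toℕ a)) (toℕ-% a))

  mod-+ : ∀ a b → a mod p +ₚ b mod p ≡ (a + b) mod p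
  mod-+ a b = mod-cong (trans (cong₂ (λ c d → (c + d) % p) (toℕ-mod a) (toℕ-mod b)) (sym (%-distribˡ-+ a b p)))

  mod-* : ∀ a b → a mod p *ₚ b mod p ≡ (a * b) mod p
  mod-* a b = mod-cong (trans (cong₂ (λ c d → (c * d) % p) (toℕ-mod a) (toℕ-mod b)) (sym (%-distribˡ-* a b p)))

  private
    rep : ∀ (a : Fin p) → ∃[ m ] a ≡ m mod p
    rep a = toℕ a , sym (toℕ-mod-id a)

    +ₚ-assoc : ∀ a b c → (a +ₚ b) +ₚ c ≡ a +ₚ (b +ₚ c)
    +ₚ-assoc a b c with rep a | rep b | rep c
    ... | x , refl | y , refl | z , refl = trans (cong (_+ₚ z mod p) (mod-+ x y)) (trans (mod-+ (x + y) z)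
      (trans (cong (_mod p) (+-assoc x y z)) (trans (sym (mod-+ x (y + z))) (cong (x mod p +ₚ_) (sym (mod-+ y z))))))

    +ₚ-comm : ∀ a b → a +ₚ b ≡ b +ₚ a
    +ₚ-comm a b = cong (_mod p) (+-comm (toℕ a) (toℕ b))

    +ₚ-identityˡ : ∀ a → 0ₚ +ₚ a ≡ a
    +ₚ-identityˡ a with rep a
    ... | x , refl = mod-+ 0 x

    +ₚ-inverseˡ : ∀ a → (-ₚ a) +ₚ a ≡ 0ₚ
    +ₚ-inverseˡ a = trans (cong ((-ₚ a) +ₚ_) (sym (toℕ-mod-id a))) (trans (mod-+ (p ∸ toℕ a) (toℕ a))
      (mod-cong (trans (cong (_% p) (m∸n+n≡m (<⇒≤ (toℕ<n a)))) (trans (n%n≡0 p) (sym (0%n p))))))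
      where
      0%n : ∀ n .{{_ : NonZero n}} → 0 % n ≡ 0
      0%n (suc n) = refl

    *ₚ-assoc : ∀ a b c → (a *ₚ b) *ₚ c ≡ a *ₚ (b *ₚ c)
    *ₚ-assoc a b c with rep a | rep b | rep c
    ... | x , refl | y , refl | z , refl = trans (cong (_*ₚ z mod p) (mod-* x y)) (trans (mod-* (x * y) z)
      (trans (cong (_mod p) (*-assoc x y z)) (trans (sym (mod-* x (y * z))) (cong (x mod p *ₚ_) (sym (mod-* y z))))))

    *ₚ-comm : ∀ a b → a *ₚ b ≡ b *ₚ a
    *ₚ-comm a b = cong (_mod p) (*-comm (toℕ a) (toℕ b))

    *ₚ-identityˡ : ∀ a → 1ₚ *ₚ a ≡ a
    *ₚ-identityˡ a with rep a
    ... | x , refl = trans (mod-* 1 x) (cong (_mod p) (*-identityˡ x))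

    *ₚ-distribˡ : ∀ a b c → a *ₚ (b +ₚ c) ≡ a *ₚ b +ₚ a *ₚ c
    *ₚ-distribˡ a b c with rep a | rep b | rep c
    ... | x , refl | y , refl | z , refl = trans (cong (x mod p *ₚ_) (mod-+ y z)) (trans (mod-* x (y + z))
      (trans (cong (_mod p) (*-distribˡ-+ x y z)) (trans (sym (mod-+ (x * y) (x * z))) (cong₂ _+ₚ_ (sym (mod-* x y)) (sym (mod-* x z))))))

  ℤₚ-isCommutativeRing : IsCommutativeRing _≡_ _+ₚ_ _*ₚ_ -ₚ_ 0ₚ 1ₚ
  ℤₚ-isCommutativeRing = record
    { isRing = record
      { +-isAbelianGroup = record
        { isGroup = record
          { isMonoid = record
            { isSemigroup = record
              { isMagma = record { isEquivalence = isEquivalence ; ∙-cong = cong₂ _+ₚ_ }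
              ; assoc = +ₚ-assoc }
            ; identity = +ₚ-identityˡ , λ a → trans (+ₚ-comm a 0ₚ) (+ₚ-identityˡ a) }
          ; inverse = +ₚ-inverseˡ , λ a → trans (+ₚ-comm a (-ₚ a)) (+ₚ-inverseˡ a)
          ; ⁻¹-cong = cong -ₚ_ }
        ; comm = +ₚ-comm }
      ; *-cong = cong₂ _*ₚ_
      ; *-assoc = *ₚ-assoc
      ; *-identity = *ₚ-identityˡ , λ a → trans (*ₚ-comm a 1ₚ) (*ₚ-identityˡ a)
      ; distrib = *ₚ-distribˡ , λ a b c → trans (*ₚ-comm (b +ₚ c) a)
          (trans (*ₚ-distribˡ a b c) (cong₂ _+ₚ_ (*ₚ-comm a b) (*ₚ-comm a c))) }
    ; *-comm = *ₚ-comm }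

  ×-mod : ∀ m → RingTheory._×ᶠ_ ℤₚ-isCommutativeRing m 1ₚ ≡ m mod p
  ×-mod zero = refl
  ×-mod (suc m) = trans (cong (1ₚ +ₚ_) (×-mod m)) (mod-+ 1 m)

  ℤₚ-char : RingTheory._×ᶠ_ ℤₚ-isCommutativeRing p 1ₚ ≡ 0ₚ
  ℤₚ-char = trans (×-mod p) (mod-cong (trans (n%n≡0 p) (sym (m<n⇒m%n≡m (>-nonZero⁻¹′ p)))))
    where
    >-nonZero⁻¹′ : ∀ m .{{_ : NonZero m}} → 0 < m
    >-nonZero⁻¹′ (suc m) = s≤s z≤n

  mod≡0⇒∣ : ∀ {m} → m mod p ≡ 0ₚ → p ∣ m
  mod≡0⇒∣ {m} e = m%n≡0⇒n∣m m p (trans (sym (toℕ-mod m)) (trans (cong toℕ e) (trans (toℕ-mod 0) (0%n p))))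
    where
    0%n : ∀ n .{{_ : NonZero n}} → 0 % n ≡ 0
    0%n (suc n) = refl

  module _ (pp : Prime p) where

    ℤₚ-isFiniteDomain : IsFiniteDomain _+ₚ_ _*ₚ_ -ₚ_ 0ₚ 1ₚ p
    ℤₚ-isFiniteDomain = record
      { isCommutativeRing = ℤₚ-isCommutativeRing
      ; _≟ᶠ_ = Fₚ._≟_
      ; integral = integral
      ; 1≢0 = λ e → <⇒≱ (1<p pp) (∣⇒≤ (mod≡0⇒∣ e))
      ; elems = allFin p
      ; elems-unique = Uniqueₚ.allFin⁺ p
      ; elems-complete = ∈-allFin
      ; elems-length = Lₚ.length-tabulate id }
      where
      zero-rep : ∀ a → p ∣ toℕ a → a ≡ 0ₚ
      zero-rep a d = trans (sym (toℕ-mod-id a)) (mod-cong (trans (n∣m⇒m%n≡0 (toℕ a) p d) (sym (n∣m⇒m%n≡0 0 p (divides 0 refl)))))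
      integral : ∀ {a b} → a *ₚ b ≡ 0ₚ → a ≡ 0ₚ ⊎ b ≡ 0ₚ
      integral {a} {b} e with euclidsLemma (toℕ a) (toℕ b) pp (mod≡0⇒∣ e)
      ... | inj₁ d = inj₁ (zero-rep a d)
      ... | inj₂ d = inj₂ (zero-rep b d)

-- The quotient rings K[X]/(X^d - g) in coordinates.

iter : ∀ {a} {A : Set a} → (A → A) → ℕ → A → A
iter T zero v = v
iter T (suc n) v = T (iter T n v)

-- The operations are separated from the ring laws so that they run both on `Fin p`, where the
-- theory applies, and on natural numbers reduced modulo p, where certificates are evaluated.
module RawQuotient {K : Set} (_⊞_ _⊠_ : K → K → K) (⊟_ : K → K) (0ᶠ : K) where

  infixl 6 _⊕_
  infixr 7 _·_

  _⊕_ : ∀ {d} → Vec K d → Vec K d → Vec K d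
  _⊕_ = zipWith _⊞_

  ⊝_ : ∀ {d} → Vec K d → Vec K d
  ⊝_ = V.map ⊟_

  -- `shift c v` and `lastOr c v` cut the vector `c ∷ v` into its first d entries and its last one:
  -- the coefficients of c + X v below X^d, and the one at X^d.
  shift : ∀ {d} → K → Vec K d → Vec K d
  shift c [] = []
  shift c (x ∷ xs) = c ∷ shift x xs

  lastOr : ∀ {d} → K → Vec K d → K
  lastOr c [] = c
  lastOr c (x ∷ xs) = lastOr x xs

  _·_ : ∀ {d} → K → Vec K d → Vec K d
  c · v = V.map (c ⊠_) v

  -- Multiplication by X on K[X]/(X^d − g), in coordinates.
  mulX : ∀ {d} → Vec K d → Vec K d → Vec K d
  mulX g v = shift 0ᶠ v ⊕ lastOr 0ᶠ v · g

  -- Horner's scheme: the polynomial with coefficients `as` is evaluated at the operator `T` and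
  -- applied to `v`. For `T` = multiplication by X and m = d this is the product of the quotient
  -- ring; for other m it expresses linear relations between the powers of X.
  act : ∀ {d m} → (Vec K d → Vec K d) → Vec K m → Vec K d → Vec K d
  act T [] v = replicate _ 0ᶠ
  act T (a ∷ as) v = a · v ⊕ T (act T as v)

  extend : ∀ {m} d → Vec K m → Vec K d
  extend zero as = []
  extend (suc d) [] = 0ᶠ ∷ extend d []
  extend (suc d) (a ∷ as) = a ∷ extend d as

  -- On K[X]/(X^d − g) this is multiplication by the product of X^(pⁱ) − X over 1 ≤ i ≤ j.
  separator : ∀ {d} → ℕ → (Vec K d → Vec K d) → ℕ → Vec K d → Vec K d
  separator p T zero v = v
  separator p T (suc j) v = let u = separator p T j v in iter T (p ^ suc j) u ⊕ (⊝ T u)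

module VecModule {K : Set} {_⊞_ _⊠_ : K → K → K} {⊟_ : K → K} {0ᶠ 1ᶠ : K}
  (isCR : IsCommutativeRing _≡_ _⊞_ _⊠_ ⊟_ 0ᶠ 1ᶠ) where

  open RingTheory isCR public
  open RawQuotient _⊞_ _⊠_ ⊟_ 0ᶠ public

  𝟎 : ∀ {d} → Vec K d
  𝟎 = replicate _ 0ᶠ

  ⊕-assoc : ∀ {d} (u v w : Vec K d) → (u ⊕ v) ⊕ w ≡ u ⊕ (v ⊕ w)
  ⊕-assoc = Vₚ.zipWith-assoc ⊞-assoc

  ⊕-comm : ∀ {d} (u v : Vec K d) → u ⊕ v ≡ v ⊕ u
  ⊕-comm = Vₚ.zipWith-comm ⊞-comm

  ⊕-identityˡ : ∀ {d} (v : Vec K d) → 𝟎 ⊕ v ≡ v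
  ⊕-identityˡ = Vₚ.zipWith-identityˡ ⊞-identityˡ

  ⊕-identityʳ : ∀ {d} (v : Vec K d) → v ⊕ 𝟎 ≡ v
  ⊕-identityʳ = Vₚ.zipWith-identityʳ ⊞-identityʳ

  ⊕-inverseˡ : ∀ {d} (v : Vec K d) → (⊝ v) ⊕ v ≡ 𝟎
  ⊕-inverseˡ = Vₚ.zipWith-inverseˡ ⊞-inverseˡ

  ⊕-inverseʳ : ∀ {d} (v : Vec K d) → v ⊕ (⊝ v) ≡ 𝟎
  ⊕-inverseʳ = Vₚ.zipWith-inverseʳ ⊞-inverseʳ

  ⊕-interchange : ∀ {d} (s t u v : Vec K d) → (s ⊕ t) ⊕ (u ⊕ v) ≡ (s ⊕ u) ⊕ (t ⊕ v)
  ⊕-interchange s t u v = trans (⊕-assoc s t _) (trans (cong (s ⊕_)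
    (trans (sym (⊕-assoc t u v)) (trans (cong (_⊕ v) (⊕-comm t u)) (⊕-assoc u t v)))) (sym (⊕-assoc s u _)))

  ·-⊕ : ∀ {d} c (u v : Vec K d) → c · (u ⊕ v) ≡ c · u ⊕ c · v
  ·-⊕ c [] [] = refl
  ·-⊕ c (x ∷ u) (y ∷ v) = cong₂ _∷_ (distribˡ c x y) (·-⊕ c u v)

  ⊞-· : ∀ {d} a b (v : Vec K d) → (a ⊞ b) · v ≡ a · v ⊕ b · v
  ⊞-· a b [] = refl
  ⊞-· a b (x ∷ v) = cong₂ _∷_ (distribʳ x a b) (⊞-· a b v)

  ⊠-· : ∀ {d} a b (v : Vec K d) → (a ⊠ b) · v ≡ a · b · v
  ⊠-· a b [] = refl
  ⊠-· a b (x ∷ v) = cong₂ _∷_ (⊠-assoc a b x) (⊠-· a b v)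

  ·-comm : ∀ {d} a b (v : Vec K d) → a · b · v ≡ b · a · v
  ·-comm a b v = trans (sym (⊠-· a b v)) (trans (cong (_· v) (⊠-comm a b)) (⊠-· b a v))

  1-· : ∀ {d} (v : Vec K d) → 1ᶠ · v ≡ v
  1-· [] = refl
  1-· (x ∷ v) = cong₂ _∷_ (⊠-identityˡ x) (1-· v)

  0-· : ∀ {d} (v : Vec K d) → 0ᶠ · v ≡ 𝟎
  0-· [] = refl
  0-· (x ∷ v) = cong₂ _∷_ (zeroˡ x) (0-· v)

  ·-𝟎 : ∀ {d} c → c · 𝟎 {d} ≡ 𝟎
  ·-𝟎 {zero} c = refl
  ·-𝟎 {suc d} c = cong₂ _∷_ (zeroʳ c) (·-𝟎 c)

  ⊝-· : ∀ {d} (v : Vec K d) → ⊝ v ≡ (⊟ 1ᶠ) · v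
  ⊝-· [] = refl
  ⊝-· (x ∷ v) = cong₂ _∷_ (trans (cong ⊟_ (sym (⊠-identityˡ x))) (⊟-distribˡ 1ᶠ x)) (⊝-· v)

  shift-⊕ : ∀ {d} a b (u v : Vec K d) → shift (a ⊞ b) (u ⊕ v) ≡ shift a u ⊕ shift b v
  shift-⊕ a b [] [] = refl
  shift-⊕ a b (x ∷ u) (y ∷ v) = cong (a ⊞ b ∷_) (shift-⊕ x y u v)

  shift-· : ∀ {d} c a (v : Vec K d) → shift (c ⊠ a) (c · v) ≡ c · shift a v
  shift-· c a [] = refl
  shift-· c a (x ∷ v) = cong (c ⊠ a ∷_) (shift-· c x v)

  lastOr-⊕ : ∀ {d} a b (u v : Vec K d) → lastOr (a ⊞ b) (u ⊕ v) ≡ lastOr a u ⊞ lastOr b v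
  lastOr-⊕ a b [] [] = refl
  lastOr-⊕ a b (x ∷ u) (y ∷ v) = lastOr-⊕ x y u v

  lastOr-· : ∀ {d} c a (v : Vec K d) → lastOr (c ⊠ a) (c · v) ≡ c ⊠ lastOr a v
  lastOr-· c a [] = refl
  lastOr-· c a (x ∷ v) = lastOr-· c x v

  extend-[] : ∀ d → extend d (0ᶠ ∷ []) ≡ extend d []
  extend-[] zero = refl
  extend-[] (suc d) = refl

  shift-extend : ∀ {m} d c (as : Vec K m) → shift c (extend d as) ≡ extend d (c ∷ as)
  shift-extend zero c as = refl
  shift-extend (suc d) c [] = cong (c ∷_) (trans (shift-extend d 0ᶠ []) (extend-[] d))
  shift-extend (suc d) c (a ∷ as) = cong (c ∷_) (shift-extend d a as)

  lastOr-extend : ∀ {m} d (as : Vec K m) → m < d → ∀ c → lastOr c (extend d as) ≡ 0ᶠ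
  lastOr-extend (suc zero) [] l c = refl
  lastOr-extend (suc (suc d)) [] l c = lastOr-extend (suc d) [] (s≤s z≤n) 0ᶠ
  lastOr-extend (suc d) (a ∷ as) (s≤s l) c = lastOr-extend d as l a

  extend-id : ∀ {d} (as : Vec K d) → extend d as ≡ as
  extend-id [] = refl
  extend-id (a ∷ as) = cong (a ∷_) (extend-id as)

  extend-𝟎 : ∀ d → extend d [] ≡ 𝟎
  extend-𝟎 zero = refl
  extend-𝟎 (suc d) = cong (0ᶠ ∷_) (extend-𝟎 d)

  record Linear {d d′} (F : Vec K d → Vec K d′) : Set where
    field
      F-⊕ : ∀ u v → F (u ⊕ v) ≡ F u ⊕ F v
      F-· : ∀ c v → F (c · v) ≡ c · F v

    F-𝟎 : F 𝟎 ≡ 𝟎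
    F-𝟎 = trans (cong F (sym (0-· 𝟎))) (trans (F-· 0ᶠ 𝟎) (0-· _))

    F-⊝ : ∀ v → F (⊝ v) ≡ ⊝ F v
    F-⊝ v = trans (cong F (⊝-· v)) (trans (F-· _ v) (sym (⊝-· (F v))))

  module Intertwine {d d′} {T : Vec K d → Vec K d} {T′ : Vec K d′ → Vec K d′} {F : Vec K d → Vec K d′}
    (linear : Linear F) (F-T : ∀ v → F (T v) ≡ T′ (F v)) where

    open Linear linear

    F-iter : ∀ n v → F (iter T n v) ≡ iter T′ n (F v)
    F-iter zero v = refl
    F-iter (suc n) v = trans (F-T _) (cong T′ (F-iter n v))

    F-separator : ∀ p j v → F (separator p T j v) ≡ separator p T′ j (F v)
    F-separator p zero v = refl
    F-separator p (suc j) v = trans (F-⊕ _ _) (cong₂ _⊕_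
      (trans (F-iter (p ^ suc j) _) (cong (iter T′ (p ^ suc j)) (F-separator p j v)))
      (trans (F-⊝ _) (cong ⊝_ (trans (F-T _) (cong T′ (F-separator p j v))))))

  module Action {d} {T : Vec K d → Vec K d} (linear : Linear T) where

    open Linear linear renaming (F-⊕ to T-⊕; F-· to T-·; F-𝟎 to T-𝟎)

    act-⊕ : ∀ {m} (as : Vec K m) u v → act T as (u ⊕ v) ≡ act T as u ⊕ act T as v
    act-⊕ [] u v = sym (⊕-identityˡ 𝟎)
    act-⊕ (a ∷ as) u v = trans (cong₂ _⊕_ (·-⊕ a u v) (trans (cong T (act-⊕ as u v)) (T-⊕ _ _))) (⊕-interchange _ _ _ _)

    act-· : ∀ {m} (as : Vec K m) c v → act T as (c · v) ≡ c · act T as v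
    act-· [] c v = sym (·-𝟎 c)
    act-· (a ∷ as) c v = trans (cong₂ _⊕_ (·-comm a c v) (trans (cong T (act-· as c v)) (T-· c _))) (sym (·-⊕ c _ _))

    act-linear : ∀ {m} (as : Vec K m) → Linear (act T as)
    act-linear as = record { F-⊕ = act-⊕ as ; F-· = act-· as }

    ⊕-act : ∀ {m} (as bs : Vec K m) v → act T (as ⊕ bs) v ≡ act T as v ⊕ act T bs v
    ⊕-act [] [] v = sym (⊕-identityˡ 𝟎)
    ⊕-act (a ∷ as) (b ∷ bs) v = trans (cong₂ _⊕_ (⊞-· a b v) (trans (cong T (⊕-act as bs v)) (T-⊕ _ _))) (⊕-interchange _ _ _ _)

    ·-act : ∀ {m} c (as : Vec K m) v → act T (c · as) v ≡ c · act T as v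
    ·-act c [] v = sym (·-𝟎 c)
    ·-act c (a ∷ as) v = trans (cong₂ _⊕_ (⊠-· c a v) (trans (cong T (·-act c as v)) (T-· c _))) (sym (·-⊕ c _ _))

    actˡ-linear : ∀ {m} v → Linear (λ (as : Vec K m) → act T as v)
    actˡ-linear v = record { F-⊕ = λ as bs → ⊕-act as bs v ; F-· = λ c as → ·-act c as v }

    act-T : ∀ {m} (as : Vec K m) v → act T as (T v) ≡ T (act T as v)
    act-T [] v = sym T-𝟎
    act-T (a ∷ as) v = trans (cong₂ _⊕_ (sym (T-· a v)) (cong T (act-T as v))) (sym (T-⊕ _ _))

    act-comm : ∀ {m m′} (as : Vec K m) (bs : Vec K m′) v → act T as (act T bs v) ≡ act T bs (act T as v)
    act-comm [] bs v = sym (Linear.F-𝟎 (act-linear bs))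
    act-comm (a ∷ as) bs v = trans (cong₂ _⊕_ (sym (act-· bs a v)) (trans (cong T (act-comm as bs v)) (sym (act-T bs _))))
      (sym (act-⊕ bs _ _))

    act-extend : ∀ {m} e (as : Vec K m) v → m ≤ e → act T (extend e as) v ≡ act T as v
    act-extend zero [] v l = refl
    act-extend (suc e) [] v l = trans (cong₂ _⊕_ (0-· v) (trans (cong T (act-extend e [] v z≤n)) T-𝟎)) (⊕-identityˡ 𝟎)
    act-extend (suc e) (a ∷ as) v (s≤s l) = cong (λ w → a · v ⊕ T w) (act-extend e as v l)

    -- Both sides apply the polynomial a + X v to w; on the left its top term, the one at T^m, is
    -- split off.
    act-shift : ∀ {m} a (v : Vec K m) w →
      act T (shift a v) w ⊕ lastOr a v · iter T m w ≡ a · w ⊕ T (act T v w)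
    act-shift a [] w = trans (⊕-comm _ _) (cong (a · w ⊕_) (sym T-𝟎))
    act-shift {suc m} a (x ∷ v) w = trans (⊕-assoc _ _ _) (cong (a · w ⊕_)
      (trans (cong (T (act T (shift x v) w) ⊕_) (sym (T-· _ _))) (trans (sym (T-⊕ _ _)) (cong T (act-shift x v w)))))

    act-∷ʳ : ∀ {m} (v : Vec K m) a w → act T (v ∷ʳ a) w ≡ act T v w ⊕ a · iter T m w
    act-∷ʳ [] a w = trans (cong (a · w ⊕_) T-𝟎) (⊕-comm _ _)
    act-∷ʳ (x ∷ v) a w = trans (cong (x · w ⊕_) (trans (cong T (act-∷ʳ v a w)) (trans (T-⊕ _ _) (cong (T (act T v w) ⊕_) (T-· _ _)))))
      (sym (⊕-assoc _ _ _))

  module QuotientRing {d} (g : Vec K d) where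

    X : Vec K d → Vec K d
    X = mulX g

    X-linear : Linear X
    X-linear = record
      { F-⊕ = λ u v → trans (cong₂ _⊕_ (trans (cong (λ z → shift z (u ⊕ v)) (sym (⊞-identityˡ 0ᶠ))) (shift-⊕ 0ᶠ 0ᶠ u v))
            (trans (cong (_· g) (trans (cong (λ z → lastOr z (u ⊕ v)) (sym (⊞-identityˡ 0ᶠ))) (lastOr-⊕ 0ᶠ 0ᶠ u v))) (⊞-· _ _ g)))
          (⊕-interchange _ _ _ _)
      ; F-· = λ c v → trans (cong₂ _⊕_ (trans (cong (λ z → shift z (c · v)) (sym (zeroʳ c))) (shift-· c 0ᶠ v))
            (trans (cong (_· g) (trans (cong (λ z → lastOr z (c · v)) (sym (zeroʳ c))) (lastOr-· c 0ᶠ v))) (⊠-· c _ g)))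
          (sym (·-⊕ c _ _)) }

    open Linear X-linear renaming (F-⊕ to X-⊕; F-· to X-·; F-𝟎 to X-𝟎) public
    open Action X-linear public

    infixl 7 _⊛_
    _⊛_ : Vec K d → Vec K d → Vec K d
    a ⊛ b = act X a b

    𝟏 : Vec K d
    𝟏 = extend d (1ᶠ ∷ [])

    -- Up to degree d - 1 no reduction occurs: the coefficient that `X` would fold back through g is
    -- 0 by `lastOr-extend`.
    act-𝟏 : ∀ {m} (as : Vec K m) → m ≤ d → act X as 𝟏 ≡ extend d as
    act-𝟏 [] l = sym (extend-𝟎 d)
    act-𝟏 (a ∷ as) l = trans (cong₂ _⊕_ (scale d) (trans (cong X (act-𝟏 as (<⇒≤ l)))
      (trans (cong₂ _⊕_ (shift-extend d 0ᶠ as) (trans (cong (_· g) (lastOr-extend d as l 0ᶠ)) (0-· g))) (⊕-identityʳ _)))) (glue d as)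
      where
      scale : ∀ e → a · extend e (1ᶠ ∷ []) ≡ extend e (a ∷ [])
      scale zero = refl
      scale (suc e) = cong₂ _∷_ (⊠-identityʳ a) (trans (cong (a ·_) (extend-𝟎 e)) (trans (·-𝟎 a) (sym (extend-𝟎 e))))
      glue : ∀ {m} e (as : Vec K m) → extend e (a ∷ []) ⊕ extend e (0ᶠ ∷ as) ≡ extend e (a ∷ as)
      glue zero as = refl
      glue (suc e) as = cong₂ _∷_ (⊞-identityʳ a) (trans (cong (_⊕ extend e as) (extend-𝟎 e)) (⊕-identityˡ _))

    ⊛-identityʳ : ∀ a → a ⊛ 𝟏 ≡ a
    ⊛-identityʳ a = trans (act-𝟏 a ≤-refl) (extend-id a)

    -- Polynomials in one operator commute, and every element is the result of its own action on 𝟏.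
    -- This gives commutativity, and then associativity, without a formula for the coefficients of a
    -- product.
    ⊛-comm : ∀ a b → a ⊛ b ≡ b ⊛ a
    ⊛-comm a b = trans (cong (act X a) (sym (⊛-identityʳ b))) (trans (act-comm a b 𝟏) (cong (act X b) (⊛-identityʳ a)))

    ⊛-assoc : ∀ a b c → (a ⊛ b) ⊛ c ≡ a ⊛ (b ⊛ c)
    ⊛-assoc a b c = trans (⊛-comm (a ⊛ b) c) (trans (act-comm c a b) (cong (act X a) (⊛-comm c b)))

    isCommutativeRing′ : IsCommutativeRing _≡_ _⊕_ _⊛_ ⊝_ 𝟎 𝟏
    isCommutativeRing′ = record
      { isRing = record
        { +-isAbelianGroup = record
          { isGroup = record
            { isMonoid = record
              { isSemigroup = record
                { isMagma = record { isEquivalence = isEquivalence ; ∙-cong = cong₂ _⊕_ }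
                ; assoc = ⊕-assoc }
              ; identity = ⊕-identityˡ , ⊕-identityʳ }
            ; inverse = ⊕-inverseˡ , ⊕-inverseʳ
            ; ⁻¹-cong = cong ⊝_ }
          ; comm = ⊕-comm }
        ; *-cong = cong₂ _⊛_
        ; *-assoc = ⊛-assoc
        ; *-identity = (λ a → trans (⊛-comm 𝟏 a) (⊛-identityʳ a)) , ⊛-identityʳ
        ; distrib = (λ a b c → act-⊕ a b c) , λ a b c → ⊕-act b c a }
      ; *-comm = ⊛-comm }

    module Q = RingTheory isCommutativeRing′

    θ : Vec K d
    θ = X 𝟏

    θ-⊛ : ∀ v → θ ⊛ v ≡ X v
    θ-⊛ v = trans (⊛-comm θ v) (trans (act-T v 𝟏) (cong X (⊛-identityʳ v)))

    θ^-⊛ : ∀ m v → (θ Q.^ᶠ m) ⊛ v ≡ iter X m v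
    θ^-⊛ zero v = trans (⊛-comm 𝟏 v) (⊛-identityʳ v)
    θ^-⊛ (suc m) v = trans (⊛-assoc θ _ v) (trans (θ-⊛ _) (cong X (θ^-⊛ m v)))

    ·𝟏-⊛ : ∀ c v → (c · 𝟏) ⊛ v ≡ c · v
    ·𝟏-⊛ c v = trans (⊛-comm _ v) (trans (act-· v c 𝟏) (cong (c ·_) (⊛-identityʳ v)))

    -- For e = X^m with d = m + 1, `act-shift` and the definition of `X` compute X e in two ways: as
    -- `shift 0ᶠ e` plus X^d, and as the same vector plus g. The common vector is cancelled.
    X^d𝟏 : ∀ {m} → suc m ≡ d → iter X d 𝟏 ≡ g
    X^d𝟏 {m} refl = begin
      iter X d 𝟏                                          ≡⟨ ⊕-identityˡ _ ⟨
      𝟎 ⊕ iter X d 𝟏                                      ≡⟨ cong₂ _⊕_ (sym (⊕-inverseˡ (shift 0ᶠ e))) (sym (1-· _)) ⟩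
      (⊝ shift 0ᶠ e) ⊕ shift 0ᶠ e ⊕ 1ᶠ · iter X d 𝟏       ≡⟨ ⊕-assoc _ _ _ ⟩
      (⊝ shift 0ᶠ e) ⊕ (shift 0ᶠ e ⊕ 1ᶠ · iter X d 𝟏)     ≡⟨ cong ((⊝ shift 0ᶠ e) ⊕_) main ⟩
      (⊝ shift 0ᶠ e) ⊕ (shift 0ᶠ e ⊕ 1ᶠ · g)              ≡⟨ ⊕-assoc _ _ _ ⟨
      (⊝ shift 0ᶠ e) ⊕ shift 0ᶠ e ⊕ 1ᶠ · g                ≡⟨ cong₂ _⊕_ (⊕-inverseˡ (shift 0ᶠ e)) (1-· g) ⟩
      𝟎 ⊕ g                                               ≡⟨ ⊕-identityˡ g ⟩
      g                                                   ∎
      where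
      open ≡-Reasoning
      e : Vec K (suc m)
      e = replicate m 0ᶠ ∷ʳ 1ᶠ
      last-e : ∀ m c → lastOr c (replicate m 0ᶠ ∷ʳ 1ᶠ) ≡ 1ᶠ
      last-e zero c = refl
      last-e (suc m) c = last-e m 0ᶠ
      main : shift 0ᶠ e ⊕ 1ᶠ · iter X d 𝟏 ≡ shift 0ᶠ e ⊕ 1ᶠ · g
      main = begin
        shift 0ᶠ e ⊕ 1ᶠ · iter X d 𝟏                         ≡⟨ cong₂ _⊕_ (sym (⊛-identityʳ (shift 0ᶠ e))) (cong (_· iter X d 𝟏) (sym (last-e m 0ᶠ))) ⟩
        act X (shift 0ᶠ e) 𝟏 ⊕ lastOr 0ᶠ e · iter X d 𝟏      ≡⟨ act-shift 0ᶠ e 𝟏 ⟩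
        0ᶠ · 𝟏 ⊕ X (act X e 𝟏)                               ≡⟨ trans (cong₂ _⊕_ (0-· 𝟏) (cong X (⊛-identityʳ e))) (⊕-identityˡ _) ⟩
        shift 0ᶠ e ⊕ lastOr 0ᶠ e · g                         ≡⟨ cong (λ c → shift 0ᶠ e ⊕ c · g) (last-e m 0ᶠ) ⟩
        shift 0ᶠ e ⊕ 1ᶠ · g                                  ∎

-- Fields with p^k elements, by descent through zero divisors.

least : ∀ {ℓ} {P : ℕ → Set ℓ} → (∀ m → Dec (P m)) → ∀ n → P n → ∃[ m ] (P m × ∀ j → j < m → ¬ P j)
least {P = P} P? n p = search n 0 (subst P (sym (+-identityʳ n)) p) (λ _ ())
  where
  search : ∀ f m → P (f + m) → (∀ j → j < m → ¬ P j) → ∃[ m′ ] (P m′ × ∀ j → j < m′ → ¬ P j)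
  search f m p h with P? m
  ... | yes pm = m , pm , h
  search zero m p h | no ¬pm = ⊥-elim (¬pm p)
  search (suc f) m p h | no ¬pm = search f (suc m) (subst P (sym (+-suc f m)) p) below
    where
    below : ∀ j → j < suc m → ¬ P j
    below j l with m≤n⇒m<n∨m≡n (s≤s⁻¹ l)
    ... | inj₁ j<m = h j j<m
    ... | inj₂ refl = ¬pm

length-cartesianProductWith : ∀ {a b c} {A : Set a} {B : Set b} {C : Set c} (f : A → B → C) xs ys →
  length (cartesianProductWith f xs ys) ≡ length xs * length ys
length-cartesianProductWith f [] ys = refl
length-cartesianProductWith f (x ∷ xs) ys = trans (Lₚ.length-++ (map (f x) ys))
  (cong₂ _+_ (Lₚ.length-map (f x) ys) (length-cartesianProductWith f xs ys))

vectors : ∀ {a} {A : Set a} → List A → ∀ d → List (Vec A d)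
vectors xs zero = [] ∷ []
vectors xs (suc d) = cartesianProductWith _∷_ xs (vectors xs d)

module _ {a} {A : Set a} {xs : List A} where

  vectors-length : ∀ d → length (vectors xs d) ≡ length xs ^ d
  vectors-length zero = refl
  vectors-length (suc d) = trans (length-cartesianProductWith _∷_ xs (vectors xs d)) (cong (length xs *_) (vectors-length d))

  vectors-unique : Unique xs → ∀ d → Unique (vectors xs d)
  vectors-unique u zero = [] ∷ []
  vectors-unique u (suc d) = Uniqueₚ.cartesianProductWith⁺ _∷_ (λ { refl → refl , refl }) u (vectors-unique u d)

  vectors-complete : (∀ x → x ∈ xs) → ∀ {d} (v : Vec A d) → v ∈ vectors xs d
  vectors-complete c [] = here refl
  vectors-complete c (x ∷ v) = ∈-cartesianProductWith⁺ _∷_ (c x) (vectors-complete c v)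

module FieldExtensions {K : Set} {_⊞_ _⊠_ : K → K → K} {⊟_ : K → K} {0ᶠ 1ᶠ : K} {p : ℕ}
  (D : IsFiniteDomain _⊞_ _⊠_ ⊟_ 0ᶠ 1ᶠ p) (pp : Prime p)
  (char : RingTheory._×ᶠ_ (IsFiniteDomain.isCommutativeRing D) p 1ᶠ ≡ 0ᶠ)
  (k : ℕ) (1≤k : 1 ≤ k) where

  private module F = FiniteDomain D
  open VecModule F.isCommutativeRing

  private
    q : ℕ
    q = p ^ k

    instance
      p≢0 : NonZero p
      p≢0 = prime⇒nonZero pp

    2≤q : 2 ≤ q
    2≤q = ≤-trans (subst (2 ≤_) (sym (^-identityʳ p)) (1<p pp)) (^-monoʳ-≤ p 1≤k)

    1≤q : 1 ≤ q
    1≤q = <⇒≤ 2≤q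

    a^q≡a : ∀ a → a ^ᶠ q ≡ a
    a^q≡a a = go k
      where
      go : ∀ j → a ^ᶠ (p ^ j) ≡ a
      go zero = ⊠-identityʳ a
      go (suc j) = trans (sym (^ᶠ-* a p (p ^ j))) (trans (cong (_^ᶠ (p ^ j)) (F.x^q≡x a)) (go j))

    vecs : ∀ d → List (Vec K d)
    vecs = vectors F.elems

    vecs-complete : ∀ {d} (v : Vec K d) → v ∈ vecs d
    vecs-complete = vectors-complete F.elems-complete

    vecs-unique : ∀ d → Unique (vecs d)
    vecs-unique = vectors-unique F.elems-unique

    vecs-length : ∀ d → length (vecs d) ≡ p ^ d
    vecs-length d = trans (vectors-length d) (cong (_^ d) F.elems-length)

  _≟ᵛ_ : ∀ {d} → DecidableEquality (Vec K d)
  _≟ᵛ_ = Vₚ.≡-dec F._≟ᶠ_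

  -- g is separated when X^d − g divides X^q − X but not the product of the X^(pⁱ) − X with 1 ≤ i < k.
  Separated : ∀ {d} → Vec K d → Set
  Separated g = iter X q 𝟏 ≡ X 𝟏 × separator p X (pred k) 𝟏 ≢ 𝟎
    where
    open QuotientRing g

  Integral : ∀ {d} → Vec K d → Set
  Integral g = ∀ {x y} → x ⊛ y ≡ 𝟎 → x ≡ 𝟎 ⊎ y ≡ 𝟎
    where
    open QuotientRing g

  private
    isolate : ∀ {d x} → x ≢ 0ᶠ → (u v : Vec K d) → u ⊕ x · v ≡ 𝟎 → v ≡ (⊟ F.inv x) · u
    isolate {x = x} x≢0 [] [] e = refl
    isolate {x = x} x≢0 (a ∷ u) (b ∷ v) e = cong₂ _∷_ head (isolate x≢0 u v (cong V.tail e))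
      where
      open ≡-Reasoning
      head : b ≡ (⊟ F.inv x) ⊠ a
      head = begin
        b                                            ≡⟨ ⊠-identityˡ b ⟨
        1ᶠ ⊠ b                                       ≡⟨ cong (_⊠ b) (F.inverseʳ x≢0) ⟨
        (x ⊠ F.inv x) ⊠ b                            ≡⟨ solve 4 (λ x y a b → (x :* y) :* b := (:- y) :* a :+ y :* (a :+ x :* b)) refl x (F.inv x) a b ⟩
        ((⊟ F.inv x) ⊠ a) ⊞ (F.inv x ⊠ (a ⊞ (x ⊠ b)))  ≡⟨ cong (λ z → ((⊟ F.inv x) ⊠ a) ⊞ (F.inv x ⊠ z)) (cong V.head e) ⟩
        ((⊟ F.inv x) ⊠ a) ⊞ (F.inv x ⊠ 0ᶠ)           ≡⟨ trans (cong (((⊟ F.inv x) ⊠ a) ⊞_) (zeroʳ _)) (⊞-identityʳ _) ⟩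
        (⊟ F.inv x) ⊠ a                              ∎

    module AtSeparated {d} (g : Vec K d) (sep : Separated g) where

      open QuotientRing g

      ⊛-𝟎 : ∀ v → v ⊛ 𝟎 ≡ 𝟎
      ⊛-𝟎 v = trans (⊛-comm v 𝟎) (Linear.F-𝟎 (actˡ-linear {m = d} v))

      separator-act : ∀ {m} (as : Vec K m) j v → act X as (separator p X j v) ≡ separator p X j (act X as v)
      separator-act as = Intertwine.F-separator {T = X} {T′ = X} (act-linear as) (act-T as) p

      separator-𝟎 : ∀ j → separator p X j 𝟎 ≡ 𝟎
      separator-𝟎 j = sym (separator-act [] j 𝟎)

      𝟏≢𝟎 : 𝟏 ≢ 𝟎
      𝟏≢𝟎 e = proj₂ sep (trans (cong (separator p X (pred k)) e) (separator-𝟎 (pred k)))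

      θ^q≡θ : θ Q.^ᶠ q ≡ θ
      θ^q≡θ = trans (sym (⊛-identityʳ _)) (trans (θ^-⊛ q 𝟏) (proj₁ sep))

      X^q≡X : ∀ v → iter X q v ≡ X v
      X^q≡X v = trans (sym (θ^-⊛ q v)) (trans (cong (_⊛ v) θ^q≡θ) (θ-⊛ v))

      private
        ×-𝟏 : ∀ m → m Q.×ᶠ 𝟏 ≡ (m ×ᶠ 1ᶠ) · 𝟏
        ×-𝟏 zero = sym (0-· 𝟏)
        ×-𝟏 (suc m) = trans (cong₂ _⊕_ (sym (1-· 𝟏)) (×-𝟏 m)) (sym (⊞-· _ _ 𝟏))

        char′ : p Q.×ᶠ 𝟏 ≡ 𝟎
        char′ = trans (×-𝟏 p) (trans (cong (_· 𝟏) char) (0-· 𝟏))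

        open Frobenius isCommutativeRing′ pp char′

        scalar-^ : ∀ a m → (a · 𝟏) Q.^ᶠ m ≡ (a ^ᶠ m) · 𝟏
        scalar-^ a zero = sym (1-· 𝟏)
        scalar-^ a (suc m) = trans (cong ((a · 𝟏) ⊛_) (scalar-^ a m)) (trans (·𝟏-⊛ a _) (sym (⊠-· a _ 𝟏)))

        -- The map y ↦ y^q is additive and multiplicative in characteristic p. It fixes the scalars
        -- by Fermat and θ by `Separated`, hence every polynomial in θ.
        act^q : ∀ {m} (as : Vec K m) → (act X as 𝟏) Q.^ᶠ q ≡ act X as 𝟏
        act^q [] = Q.0^ᶠ 1≤q
        act^q (a ∷ as) = trans (^pᵏ-⊞ k _ _) (cong₂ _⊕_
          (trans (scalar-^ a q) (cong (_· 𝟏) (a^q≡a a)))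
          (trans (cong (Q._^ᶠ q) (sym (θ-⊛ _))) (trans (Q.^ᶠ-distrib θ _ q)
            (trans (cong₂ _⊛_ θ^q≡θ (act^q as)) (θ-⊛ _)))))

      y^q≡y : ∀ y → y Q.^ᶠ q ≡ y
      y^q≡y y = trans (cong (Q._^ᶠ q) (sym (⊛-identityʳ y))) (trans (act^q y) (⊛-identityʳ y))

      module _ (w : Vec K d) where

        Dependent : ℕ → Set
        Dependent m = ∃[ c ] iter X m w ≡ act {m = m} X c w

        private
          dependent? : ∀ m → Dec (Dependent m)
          dependent? m with Any.any? (λ c → iter X m w ≟ᵛ act X c w) (vecs m)
          ... | yes a = yes (Any.satisfied a)
          ... | no ¬a = no λ (c , e) → ¬a (lose (vecs-complete c) e)

          dependent-q : Dependent q
          dependent-q = extend q (0ᶠ ∷ 1ᶠ ∷ []) , trans (X^q≡X w) (sym (trans (act-extend q _ w 2≤q)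
            (trans (cong₂ _⊕_ (0-· w) (cong X (trans (cong₂ _⊕_ (1-· w) X-𝟎) (⊕-identityʳ w)))) (⊕-identityˡ _))))

        minimal : ∃[ m ] (Dependent m × ∀ j → j < m → ¬ Dependent j)
        minimal = least dependent? q dependent-q

      -- X^m − c is the minimal polynomial of w; its quotient ring embeds as the multiples of w.
      module Cyclic (w : Vec K d) (w≢𝟎 : w ≢ 𝟎) {m} (c : Vec K m) (X^m≡ : iter X m w ≡ act X c w)
        (least-m : ∀ j → j < m → ¬ Dependent w j) where

        1≤m : 1 ≤ m
        1≤m = go m c X^m≡
          where
          go : ∀ m (c : Vec K m) → iter X m w ≡ act X c w → 1 ≤ m
          go zero [] e = ⊥-elim (w≢𝟎 e)
          go (suc m) c e = s≤s z≤n

        -- A relation with nonzero top coefficient x could be solved for X^j w with j < m, against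
        -- the minimality of m.
        independent : ∀ {j} → j ≤ m → (a : Vec K j) → act X a w ≡ 𝟎 → a ≡ 𝟎
        independent {zero} l [] e = refl
        independent {suc j} l a e with V.initLast a
        ... | b , x , refl with x F.≟ᶠ 0ᶠ
        ... | yes refl = trans (cong (_∷ʳ 0ᶠ) (independent (<⇒≤ l) b
            (trans (sym (⊕-identityʳ _)) (trans (cong (act X b w ⊕_) (sym (0-· _))) (trans (sym (act-∷ʳ b 0ᶠ w)) e))))) (zeros j)
          where
          zeros : ∀ j → replicate j 0ᶠ ∷ʳ 0ᶠ ≡ replicate (suc j) 0ᶠ
          zeros zero = refl
          zeros (suc j) = cong (0ᶠ ∷_) (zeros j)
        ... | no x≢0 = ⊥-elim (least-m j l ((⊟ F.inv x) · b , trans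
            (isolate x≢0 (act X b w) (iter X j w) (trans (sym (act-∷ʳ b x w)) e)) (sym (·-act _ b w))))

        private module Q′ = QuotientRing c

        ψ : Vec K m → Vec K d
        ψ a = act X a w

        ψ-injective : ∀ {a b} → ψ a ≡ ψ b → a ≡ b
        ψ-injective {a} {b} e = Q′.Q.⊟≡0⇒≡ a b (independent ≤-refl (a ⊕ (⊝ b))
          (trans (⊕-act a (⊝ b) w) (trans (cong₂ _⊕_ e (Linear.F-⊝ (actˡ-linear w) b)) (⊕-inverseʳ _))))

        ψ-X : ∀ v → ψ (Q′.X v) ≡ X (ψ v)
        ψ-X v = begin
          act X (shift 0ᶠ v ⊕ lastOr 0ᶠ v · c) w                      ≡⟨ ⊕-act (shift 0ᶠ v) (lastOr 0ᶠ v · c) w ⟩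
          act X (shift 0ᶠ v) w ⊕ act X (lastOr 0ᶠ v · c) w            ≡⟨ cong (act X (shift 0ᶠ v) w ⊕_) (trans (·-act _ c w) (cong (lastOr 0ᶠ v ·_) (sym X^m≡))) ⟩
          act X (shift 0ᶠ v) w ⊕ lastOr 0ᶠ v · iter X m w             ≡⟨ act-shift 0ᶠ v w ⟩
          0ᶠ · w ⊕ X (ψ v)                                            ≡⟨ trans (cong (_⊕ X (ψ v)) (0-· w)) (⊕-identityˡ _) ⟩
          X (ψ v)                                                     ∎
          where
          open ≡-Reasoning

        ψ-𝟏 : ψ Q′.𝟏 ≡ w
        ψ-𝟏 = trans (act-extend m (1ᶠ ∷ []) w 1≤m) (trans (cong₂ _⊕_ (1-· w) X-𝟎) (⊕-identityʳ w))

        open Intertwine {T = Q′.X} {T′ = X} (actˡ-linear w) ψ-X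

        -- `ψ` is linear and injective, sends 𝟏 to w and commutes with X. So X^q w = X w pulls back
        -- to the quotient by X^m - c, and a separator that does not kill w does not kill 𝟏 there.
        c-separated : separator p X (pred k) w ≢ 𝟎 → Separated c
        c-separated h =
          ψ-injective (trans (F-iter q Q′.𝟏) (trans (cong (iter X q) ψ-𝟏) (trans (X^q≡X w)
            (sym (trans (ψ-X Q′.𝟏) (cong X ψ-𝟏)))))) ,
          λ e → h (trans (cong (separator p X (pred k)) (sym ψ-𝟏)) (trans (sym (F-separator p (pred k) Q′.𝟏))
            (trans (cong ψ e) (Linear.F-𝟎 (actˡ-linear {m = m} w)))))

        -- The element z kills every multiple of w but not 𝟏, so the injection `ψ` misses 𝟏 and p^m
        -- < p^d.
        m<d : ∀ {z} → z ≢ 𝟎 → z ⊛ w ≡ 𝟎 → m < d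
        m<d {z} z≢𝟎 zw with m <? d
        ... | yes l = l
        ... | no ¬l = ⊥-elim (<⇒≱ (subst₂ _<_ (trans (Lₚ.length-map ψ (vecs m)) (vecs-length m)) (vecs-length d) count)
          (^-monoʳ-≤ p (≮⇒≥ ¬l)))
          where
          ψ≢𝟏 : ∀ a → ψ a ≢ 𝟏
          ψ≢𝟏 a e = z≢𝟎 (begin
            z                  ≡⟨ ⊛-identityʳ z ⟨
            z ⊛ 𝟏              ≡⟨ cong (z ⊛_) e ⟨
            z ⊛ act X a w      ≡⟨ act-comm z a w ⟩
            act X a (z ⊛ w)    ≡⟨ cong (act X a) zw ⟩
            act X a 𝟎          ≡⟨ Linear.F-𝟎 (act-linear a) ⟩
            𝟎                  ∎)
            where
            open ≡-Reasoning
          count : length (map ψ (vecs m)) < length (vecs d)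
          count = Unique-⊆-length {xs = 𝟏 ∷ map ψ (vecs m)}
            (Allₚ.map⁺ (All.tabulate (λ {a} _ e → ψ≢𝟏 a (sym e))) ∷ map-Unique ψ (λ _ _ → ψ-injective) (vecs-unique m))
            (λ _ → vecs-complete _)

      Smaller : Set
      Smaller = ∃[ m ] (m < d × ∃[ c ] Separated {m} c)

      -- If y z = 0, then y or the idempotent 1 − y^(q−1) is killed by a nonzero element but not by the separator.
      zero-divisor : ∀ {y z} → y ≢ 𝟎 → z ≢ 𝟎 → y ⊛ z ≡ 𝟎 → Smaller
      zero-divisor {y} {z} y≢𝟎 z≢𝟎 yz with separator p X (pred k) y ≟ᵛ 𝟎
      ... | no h = let m , (c , X^m≡) , least-m = minimal y in
                   m , Cyclic.m<d y y≢𝟎 c X^m≡ least-m z≢𝟎 (trans (⊛-comm z y) yz) , c , Cyclic.c-separated y y≢𝟎 c X^m≡ least-m h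
      ... | yes h = let m , (c , X^m≡) , least-m = minimal w in
                    m , Cyclic.m<d w w≢𝟎 c X^m≡ least-m y≢𝟎 yw , c , Cyclic.c-separated w w≢𝟎 c X^m≡ least-m sw≢𝟎
        where
        σ : Vec K d
        σ = separator p X (pred k) 𝟏
        e w : Vec K d
        e = y Q.^ᶠ pred q
        w = 𝟏 ⊕ (⊝ e)
        suc-pred-q : suc (pred q) ≡ q
        suc-pred-q = suc-pred q {{>-nonZero 1≤q}}
        yw : y ⊛ w ≡ 𝟎
        yw = trans (act-⊕ y 𝟏 (⊝ e)) (trans (cong₂ _⊕_ (⊛-identityʳ y) (trans (Linear.F-⊝ (act-linear y) e)
          (cong ⊝_ (trans (cong (y Q.^ᶠ_) suc-pred-q) (y^q≡y y))))) (⊕-inverseʳ y))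
        sep-⊛ : ∀ v → separator p X (pred k) v ≡ v ⊛ σ
        sep-⊛ v = trans (cong (separator p X (pred k)) (sym (⊛-identityʳ v))) (sym (separator-act v (pred k) 𝟏))
        eσ : e ⊛ σ ≡ 𝟎
        eσ = begin
          e ⊛ σ           ≡⟨ cong (λ j → (y Q.^ᶠ j) ⊛ σ) (sym (suc-pred (pred q) {{>-nonZero (s≤s⁻¹ (subst (2 ≤_) (sym suc-pred-q) 2≤q))}})) ⟩
          (y ⊛ e′) ⊛ σ    ≡⟨ cong (_⊛ σ) (⊛-comm y e′) ⟩
          (e′ ⊛ y) ⊛ σ    ≡⟨ ⊛-assoc e′ y σ ⟩
          e′ ⊛ (y ⊛ σ)    ≡⟨ cong (e′ ⊛_) (trans (sym (sep-⊛ y)) h) ⟩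
          e′ ⊛ 𝟎          ≡⟨ ⊛-𝟎 e′ ⟩
          𝟎               ∎
          where
          open ≡-Reasoning
          e′ : Vec K d
          e′ = y Q.^ᶠ pred (pred q)
        sw : separator p X (pred k) w ≡ σ
        sw = begin
          separator p X (pred k) w       ≡⟨ sep-⊛ w ⟩
          w ⊛ σ                          ≡⟨ ⊕-act 𝟏 (⊝ e) σ ⟩
          𝟏 ⊛ σ ⊕ (⊝ e) ⊛ σ              ≡⟨ cong₂ _⊕_ (trans (⊛-comm 𝟏 σ) (⊛-identityʳ σ)) (trans (Linear.F-⊝ (actˡ-linear σ) e) (trans (cong ⊝_ eσ) Q.⊟0)) ⟩
          σ ⊕ 𝟎                          ≡⟨ ⊕-identityʳ σ ⟩
          σ                              ∎
          where
          open ≡-Reasoning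
        sw≢𝟎 : separator p X (pred k) w ≢ 𝟎
        sw≢𝟎 e = proj₂ sep (trans (sym sw) e)
        w≢𝟎 : w ≢ 𝟎
        w≢𝟎 e = sw≢𝟎 (trans (cong (separator p X (pred k)) e) (separator-𝟎 (pred k)))

      integral? : Integral g ⊎ Smaller
      integral? with Any.any? (λ y → Any.any? (λ z → ¬? (y ≟ᵛ 𝟎) ×-dec ¬? (z ≟ᵛ 𝟎) ×-dec ((y ⊛ z) ≟ᵛ 𝟎)) (vecs d)) (vecs d)
      ... | yes a = let y , a′ = Any.satisfied a ; z , y≢ , z≢ , e = Any.satisfied a′ in inj₂ (zero-divisor y≢ z≢ e)
      ... | no ¬a = inj₁ λ {y} {z} e → case y ≟ᵛ 𝟎 of λ
        { (yes y=) → inj₁ y=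
        ; (no y≢) → case z ≟ᵛ 𝟎 of λ
          { (yes z=) → inj₂ z=
          ; (no z≢) → ⊥-elim (¬a (lose (vecs-complete y) (lose (vecs-complete z) (y≢ , z≢ , e)))) } }

      module _ (int : Integral g) where

        isFiniteDomain′ : IsFiniteDomain _⊕_ _⊛_ ⊝_ 𝟎 𝟏 (p ^ d)
        isFiniteDomain′ = record
          { isCommutativeRing = isCommutativeRing′ ; _≟ᶠ_ = _≟ᵛ_ ; integral = int ; 1≢0 = 𝟏≢𝟎
          ; elems = vecs d ; elems-unique = vecs-unique d ; elems-complete = vecs-complete ; elems-length = vecs-length d }

        private
          module F′ = FiniteDomain isFiniteDomain′

          X^pᵈ : ∀ v → iter X (p ^ d) v ≡ X v
          X^pᵈ v = trans (sym (θ^-⊛ (p ^ d) v)) (trans (cong (_⊛ v) (F′.x^q≡x θ)) (θ-⊛ v))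

          -- A domain with p^d elements satisfies X^(p^d) = X, so the separator is annihilated as
          -- soon as it contains the factor with i = d.
          vanish : 1 ≤ d → ∀ j → d ≤ j → separator p X j 𝟏 ≡ 𝟎
          vanish 1≤d zero l = ⊥-elim (<⇒≱ 1≤d l)
          vanish 1≤d (suc j) l with m≤n⇒m<n∨m≡n l
          ... | inj₂ refl = trans (cong (_⊕ (⊝ X (separator p X j 𝟏))) (X^pᵈ _)) (⊕-inverseʳ _)
          ... | inj₁ l′ = trans (cong (λ u → iter X (p ^ suc j) u ⊕ (⊝ X u)) (vanish 1≤d j (s≤s⁻¹ l′)))
            (trans (cong₂ _⊕_ (sym (Intertwine.F-iter {T = X} {T′ = X} (act-linear []) (act-T []) (p ^ suc j) 𝟎)) (trans (cong ⊝_ X-𝟎) Q.⊟0)) (⊕-identityʳ 𝟎))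

          1≤d : 1 ≤ d
          1≤d = go refl
            where
            go : ∀ {e} → e ≡ d → 1 ≤ d
            go {zero} refl = ⊥-elim (𝟏≢𝟎 refl)
            go {suc e} refl = s≤s z≤n

        -- All p^d elements are roots of Y^q - Y, whence d ≤ k. If d < k, the separator would
        -- contain the vanishing factor with i = d.
        degree : d ≡ k
        degree = ≤-antisym
          (≮⇒≥ λ k<d → <⇒≱ (^-monoʳ-< p (1<p pp) k<d) (F′.x^m≡x⇒size≤ 2≤q y^q≡y))
          (≮⇒≥ λ d<k → proj₂ sep (vanish 1≤d (pred k) (s≤s⁻¹ (subst (d <_) (sym (suc-pred k {{>-nonZero 1≤k}})) d<k))))

    descend : ∀ {d} → Acc _<_ d → (g : Vec K d) → Separated g → ∃[ d′ ] (d′ ≤ d × ∃[ g′ ] (Separated {d′} g′ × Integral g′))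
    descend {d} (acc rs) g sep with AtSeparated.integral? g sep
    ... | inj₁ int = d , ≤-refl , g , sep , int
    ... | inj₂ (m , m<d , c , csep) = let d′ , d′≤m , g′ , h = descend (rs m<d) c csep in d′ , ≤-trans d′≤m (<⇒≤ m<d) , g′ , h

    -- The descent never raises the degree and ends in a domain, where the degree is k.
    separated⇒k≤ : ∀ {d} (g : Vec K d) → Separated g → k ≤ d
    separated⇒k≤ {d} g sep = let d′ , d′≤d , g′ , sep′ , int′ = descend (<-wellFounded d) g sep in
      subst (_≤ d) (AtSeparated.degree g′ sep′ int′) d′≤d

  -- A zero divisor in degree k would produce a separated polynomial of smaller degree, against
  -- `separated⇒k≤`. So irreducibility of an explicit modulus of degree k follows from the two
  -- conditions of `Separated`, which can be evaluated; the certificates for proper prime powers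
  -- rely on this.
  separated⇒integral : (g : Vec K k) → Separated g → Integral g
  separated⇒integral g sep with AtSeparated.integral? g sep
  ... | inj₁ int = int
  ... | inj₂ (m , m<k , c , csep) = ⊥-elim (<⇒≱ m<k (separated⇒k≤ c csep))

  quotient-isFiniteDomain : (g : Vec K k) → Separated g →
    IsFiniteDomain _⊕_ (QuotientRing._⊛_ g) ⊝_ 𝟎 (QuotientRing.𝟏 g) (p ^ k)
  quotient-isFiniteDomain g sep = AtSeparated.isFiniteDomain′ g sep (separated⇒integral g sep)

  private
    coef : ∀ {d} → Vec K d → ℕ → K
    coef [] i = 0ᶠ
    coef (x ∷ v) zero = x
    coef (x ∷ v) (suc i) = coef v i

    coef-− : ∀ {d} (u v : Vec K d) i → coef (u ⊕ (⊝ v)) i ≡ coef u i − coef v i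
    coef-− [] [] i = sym (⊞-inverseʳ 0ᶠ)
    coef-− (x ∷ u) (y ∷ v) zero = refl
    coef-− (x ∷ u) (y ∷ v) (suc i) = coef-− u v i

    coef-𝟎 : ∀ d i → coef (replicate d 0ᶠ) i ≡ 0ᶠ
    coef-𝟎 zero i = refl
    coef-𝟎 (suc d) zero = refl
    coef-𝟎 (suc d) (suc i) = coef-𝟎 d i

    coef-shift : ∀ {d} c (v : Vec K d) → lastOr c v ≡ 0ᶠ → ∀ i → coef (shift c v) i ≡ coef (c ∷ v) i
    coef-shift c [] e zero = sym e
    coef-shift c [] e (suc i) = refl
    coef-shift c (x ∷ v) e zero = refl
    coef-shift c (x ∷ v) e (suc i) = coef-shift x v e i

    lastOr-coef : ∀ {d} c (v : Vec K (suc d)) → lastOr c v ≡ coef v d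
    lastOr-coef c (x ∷ []) = refl
    lastOr-coef c (x ∷ y ∷ v) = lastOr-coef x (y ∷ v)

    MonicOfDegree : ∀ {d} → ℕ → Vec K d → Set
    MonicOfDegree e v = coef v e ≡ 1ᶠ × (∀ i → e < i → coef v i ≡ 0ᶠ)

    monic-− : ∀ {d e e′} {u v : Vec K d} → MonicOfDegree e u → MonicOfDegree e′ v → e′ < e → MonicOfDegree e (u ⊕ (⊝ v))
    monic-− {e = e} {u = u} {v} (u₁ , u₀) (v₁ , v₀) l =
      trans (coef-− u v e) (trans (cong₂ _−_ u₁ (v₀ e l)) (trans (cong (1ᶠ ⊞_) ⊟0) (⊞-identityʳ 1ᶠ))) ,
      λ i e<i → trans (coef-− u v i) (trans (cong₂ _−_ (u₀ i e<i) (v₀ i (<-trans l e<i))) (⊞-inverseʳ 0ᶠ))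

    degreeSum : ℕ → ℕ
    degreeSum zero = 0
    degreeSum (suc j) = p ^ suc j + degreeSum j

    degreeSum< : ∀ j → degreeSum j < p ^ suc j
    degreeSum< zero = m^n>0 p 1
    degreeSum< (suc j) = ≤-trans (+-monoʳ-< (p ^ suc j) (degreeSum< j))
      (subst (_≤ p ^ suc (suc j)) (cong (p ^ suc j +_) (+-identityʳ _)) (*-monoˡ-≤ (p ^ suc j) (1<p pp)))

    -- The start of the descent: g = X, so the modulus is X^q - X. The separator has degree p + p² +
    -- ... + p^(k-1) < q, so no reduction ever touches it; being monic it is nonzero.
    module Splitting (d : ℕ) (eq : suc d ≡ q) where

      g : Vec K (suc d)
      g = extend (suc d) (0ᶠ ∷ 1ᶠ ∷ [])
      open QuotientRing g

      monic-X : ∀ {e v} → MonicOfDegree e v → e < d → MonicOfDegree (suc e) (X v)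
      monic-X {e} {v} (v₁ , v₀) l = trans (coef-X e) v₁ , λ { (suc i) (s≤s e<i) → trans (coef-X i) (v₀ i e<i) }
        where
        last≡0 : lastOr 0ᶠ v ≡ 0ᶠ
        last≡0 = trans (lastOr-coef 0ᶠ v) (v₀ d l)
        coef-X : ∀ i → coef (X v) (suc i) ≡ coef v i
        coef-X i = trans (cong (λ u → coef u (suc i)) (trans (cong (λ c → shift 0ᶠ v ⊕ c · g) last≡0)
          (trans (cong (shift 0ᶠ v ⊕_) (0-· g)) (⊕-identityʳ _)))) (coef-shift 0ᶠ v last≡0 (suc i))

      monic-iter : ∀ n {e v} → MonicOfDegree e v → n + e < suc d → MonicOfDegree (n + e) (iter X n v)
      monic-iter zero h l = h
      monic-iter (suc n) {e} {v} h l = monic-X {v = iter X n v} (monic-iter n {v = v} h (<⇒≤ l)) (s≤s⁻¹ l)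

      monic-separator : ∀ j → degreeSum j < suc d → MonicOfDegree (degreeSum j) (separator p X j 𝟏)
      monic-separator zero l = refl , λ { (suc i) _ → trans (cong (λ u → coef u i) (extend-𝟎 d)) (coef-𝟎 d i) }
      monic-separator (suc j) l = monic-− {u = iter X (p ^ suc j) σ} {v = X σ} (monic-iter (p ^ suc j) {v = σ} IH l)
          (monic-X {v = σ} IH (s≤s⁻¹ (<-trans (+-monoˡ-< (degreeSum j) 1<p^) l))) (+-monoˡ-< (degreeSum j) 1<p^)
        where
        σ : Vec K (suc d)
        σ = separator p X j 𝟏
        1<p^ : 1 < p ^ suc j
        1<p^ = ≤-trans (subst (1 <_) (sym (^-identityʳ p)) (1<p pp)) (^-monoʳ-≤ p (s≤s (z≤n {j})))
        IH : MonicOfDegree (degreeSum j) (separator p X j 𝟏)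
        IH = monic-separator j (≤-trans (s≤s (m≤n+m (degreeSum j) (p ^ suc j))) l)

      separated : Separated g
      separated =
        trans (cong (λ m → iter X m 𝟏) (sym eq)) (trans (X^d𝟏 refl) (sym (trans (sym actX) (act-𝟏 (0ᶠ ∷ 1ᶠ ∷ []) (subst (2 ≤_) (sym eq) 2≤q))))) ,
        λ e → F.1≢0 (trans (sym (proj₁ monic)) (trans (cong (λ u → coef u (degreeSum (pred k))) e) (coef-𝟎 (suc d) (degreeSum (pred k)))))
        where
        actX : act X (0ᶠ ∷ 1ᶠ ∷ []) 𝟏 ≡ X 𝟏
        actX = trans (cong₂ _⊕_ (0-· 𝟏) (cong X (trans (cong₂ _⊕_ (1-· 𝟏) X-𝟎) (⊕-identityʳ 𝟏)))) (⊕-identityˡ _)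
        monic : MonicOfDegree (degreeSum (pred k)) (separator p X (pred k) 𝟏)
        monic = monic-separator (pred k) (subst (degreeSum (pred k) <_)
          (trans (cong (p ^_) (suc-pred k {{>-nonZero 1≤k}})) (sym eq)) (degreeSum< (pred k)))

  ∃-separated : ∃[ g ] Separated {k} g
  ∃-separated =
    let d , _ , g , sep , int = descend (<-wellFounded _) _ (Splitting.separated (pred q) (suc-pred q {{>-nonZero 1≤q}}))
    in subst (λ d → ∃[ g ] Separated {d} g) (AtSeparated.degree g sep int) (g , sep)

-- From three base blocks with distinct keys to the PDF and the resolved linear space.

pairs : ∀ {a} {A : Set a} → List A → List (A × A)
pairs [] = []
pairs (x ∷ xs) = map (x ,_) xs ++ pairs xs

module _ {a} {A : Set a} where

  ∈-pairs : ∀ {xs : List A} {x y} → x ∈ xs → y ∈ xs → x ≢ y → (x , y) ∈ pairs xs ⊎ (y , x) ∈ pairs xs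
  ∈-pairs (here refl) (here refl) ne = ⊥-elim (ne refl)
  ∈-pairs {z ∷ zs} (here refl) (there j) ne = inj₁ (∈-++⁺ˡ (∈-map⁺ (z ,_) j))
  ∈-pairs {z ∷ zs} (there i) (here refl) ne = inj₂ (∈-++⁺ˡ (∈-map⁺ (z ,_) i))
  ∈-pairs {z ∷ zs} (there i) (there j) ne with ∈-pairs i j ne
  ... | inj₁ k = inj₁ (∈-++⁺ʳ (map (z ,_) zs) k)
  ... | inj₂ k = inj₂ (∈-++⁺ʳ (map (z ,_) zs) k)

  ∈-pairs⁻ : ∀ {xs : List A} {x y} → (x , y) ∈ pairs xs → x ∈ xs × y ∈ xs
  ∈-pairs⁻ {z ∷ zs} i with ∈-++⁻ (map (z ,_) zs) i
  ... | inj₁ j with ∈-map⁻ (z ,_) j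
  ...   | _ , k , refl = here refl , there k
  ∈-pairs⁻ {z ∷ zs} i | inj₂ j = let k , l = ∈-pairs⁻ j in there k , there l

  ∑∑-pairs : ∀ (xs : List A) (f : A → A → ℕ) →
    ∑ xs (λ x → ∑ xs (f x)) ≡ ∑ xs (λ x → f x x) + ∑ (pairs xs) (λ (x , y) → f x y + f y x)
  ∑∑-pairs [] f = refl
  ∑∑-pairs (x ∷ xs) f = begin
    f x x + ∑ xs (f x) + ∑ xs (λ y → f y x + ∑ xs (f y))
      ≡⟨ cong (f x x + ∑ xs (f x) +_) (trans (∑-+ xs _ _) (cong (∑ xs (λ y → f y x) +_) (∑∑-pairs xs f))) ⟩
    f x x + ∑ xs (f x) + (∑ xs (λ y → f y x) + (d + e))
      ≡⟨ solve 5 (λ a b c d e → a :+ b :+ (c :+ (d :+ e)) := a :+ d :+ (b :+ c :+ e)) refl (f x x) (∑ xs (f x)) _ d e ⟩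
    f x x + d + (∑ xs (f x) + ∑ xs (λ y → f y x) + e)
      ≡⟨ cong (λ z → f x x + d + (z + e)) (sym (trans (∑-map (x ,_) xs _) (∑-+ xs _ _))) ⟩
    f x x + d + (∑ (map (x ,_) xs) g + ∑ (pairs xs) g)
      ≡⟨ cong (f x x + d +_) (sym (∑-++ (map (x ,_) xs) (pairs xs) g)) ⟩
    f x x + d + ∑ (pairs (x ∷ xs)) g ∎
    where
    open ≡-Reasoning
    open +-*-Solver
    g : A × A → ℕ
    g (x , y) = f x y + f y x
    d e : ℕ
    d = ∑ xs (λ x → f x x)
    e = ∑ (pairs xs) g

Label : Set
Label = Fin 2 × Fin 2

private
  pattern 0₂ = fzero
  pattern 1₂ = fsuc fzero

_+ₗ_ : Label → Label → Label
(a , b) +ₗ (c , d) = addMod 2 a c , addMod 2 b d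

-ₗ_ : Label → Label
-ₗ (a , b) = negMod 2 a , negMod 2 b

_≟ₗ_ : DecidableEquality Label
_≟ₗ_ = ×-≡-dec Fₚ._≟_ Fₚ._≟_

labels : List Label
labels = (0₂ , 0₂) ∷ (0₂ , 1₂) ∷ (1₂ , 0₂) ∷ (1₂ , 1₂) ∷ []

labels-unique : Unique labels
labels-unique = toWitness {a? = unique? _≟ₗ_ labels} tt
  where
  open import Data.List.Relation.Unary.Unique.DecPropositional using (unique?)

labels-complete : ∀ l → l ∈ labels
labels-complete (0₂ , 0₂) = here refl
labels-complete (0₂ , 1₂) = there (here refl)
labels-complete (1₂ , 0₂) = there (there (here refl))
labels-complete (1₂ , 1₂) = there (there (there (here refl)))

private
  every₂ : ∀ {P : Fin 2 → Set} → P 0₂ → P 1₂ → ∀ a → P a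
  every₂ p r 0₂ = p
  every₂ p r 1₂ = r

  +₂-comm : ∀ a b → addMod 2 a b ≡ addMod 2 b a
  +₂-comm = every₂ (every₂ refl refl) (every₂ refl refl)

  +₂-assoc : ∀ a b c → addMod 2 (addMod 2 a b) c ≡ addMod 2 a (addMod 2 b c)
  +₂-assoc = every₂ (every₂ (every₂ refl refl) (every₂ refl refl)) (every₂ (every₂ refl refl) (every₂ refl refl))

  +₂-identityˡ : ∀ a → addMod 2 (zeroMod 2) a ≡ a
  +₂-identityˡ = every₂ refl refl

  +₂-inverseʳ : ∀ a → addMod 2 a (negMod 2 a) ≡ zeroMod 2
  +₂-inverseʳ = every₂ refl refl

  −₂-comm : ∀ a b → addMod 2 a (negMod 2 b) ≡ addMod 2 b (negMod 2 a)
  −₂-comm = every₂ (every₂ refl refl) (every₂ refl refl)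

  −₂-translate : ∀ a b w → addMod 2 (addMod 2 a w) (negMod 2 (addMod 2 b w)) ≡ addMod 2 a (negMod 2 b)
  −₂-translate = every₂ (every₂ (every₂ refl refl) (every₂ refl refl)) (every₂ (every₂ refl refl) (every₂ refl refl))

  +₂-move : ∀ a w x y → addMod 2 (addMod 2 a w) x ≡ addMod 2 (addMod 2 a (addMod 2 w (addMod 2 x y))) y
  +₂-move = every₂ (every₂ (every₂ (every₂ refl refl) (every₂ refl refl)) (every₂ (every₂ refl refl) (every₂ refl refl)))
                   (every₂ (every₂ (every₂ refl refl) (every₂ refl refl)) (every₂ (every₂ refl refl) (every₂ refl refl)))

  +₂-move⁻ : ∀ a w w′ x y → addMod 2 (addMod 2 a w) x ≡ addMod 2 (addMod 2 a w′) y → w′ ≡ addMod 2 w (addMod 2 x y)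
  +₂-move⁻ a w w′ x y e = trans (cancel a w′ y) (trans (cong (λ z → addMod 2 a (addMod 2 z y)) (sym e)) (regroup a w x y))
    where
    cancel : ∀ a w′ y → w′ ≡ addMod 2 a (addMod 2 (addMod 2 (addMod 2 a w′) y) y)
    cancel = every₂ (every₂ (every₂ refl refl) (every₂ refl refl)) (every₂ (every₂ refl refl) (every₂ refl refl))
    regroup : ∀ a w x y → addMod 2 a (addMod 2 (addMod 2 (addMod 2 a w) x) y) ≡ addMod 2 w (addMod 2 x y)
    regroup = every₂ (every₂ (every₂ (every₂ refl refl) (every₂ refl refl)) (every₂ (every₂ refl refl) (every₂ refl refl)))
                     (every₂ (every₂ (every₂ refl refl) (every₂ refl refl)) (every₂ (every₂ refl refl) (every₂ refl refl)))

∑-labels-+ : ∀ v l → (∑[ w ∈ labels ] 𝟙 (v ≟ₗ (l +ₗ w))) ≡ 1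
∑-labels-+ (a , b) (c , d) = every₂ {λ a → ∀ b c d → goal a b c d}
    (every₂ (every₂ (every₂ refl refl) (every₂ refl refl)) (every₂ (every₂ refl refl) (every₂ refl refl)))
    (every₂ (every₂ (every₂ refl refl) (every₂ refl refl)) (every₂ (every₂ refl refl) (every₂ refl refl))) a b c d
  where
  goal : Fin 2 → Fin 2 → Fin 2 → Fin 2 → Set
  goal a b c d = (∑[ w ∈ labels ] 𝟙 ((a , b) ≟ₗ ((c , d) +ₗ w))) ≡ 1

∑-labels-− : ∀ v → (∑[ l ∈ labels ] ∑[ l′ ∈ labels ] 𝟙 (v ≟ₗ (l +ₗ (-ₗ l′)))) ≡ 4
∑-labels-− (0₂ , 0₂) = refl
∑-labels-− (0₂ , 1₂) = refl
∑-labels-− (1₂ , 0₂) = refl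
∑-labels-− (1₂ , 1₂) = refl

private
  factor-4 : ∀ z a b c → 4 * z + (4 * a + (4 * b + 4 * c)) ≡ 4 * (z + (a + (b + (c + 0))))
  factor-4 = solve 4 (λ z a b c → con 4 :* z :+ (con 4 :* a :+ (con 4 :* b :+ con 4 :* c)) := con 4 :* (z :+ (a :+ (b :+ (c :+ con 0))))) refl
    where
    open +-*-Solver

module Development (p k : ℕ) .{{_ : NonZero p}} {_⊠_ : Vec (Fin p) k → Vec (Fin p) k → Vec (Fin p) k} {1ᶠ : Vec (Fin p) k} {q : ℕ}
  (D : IsFiniteDomain (zipWith (addMod p)) _⊠_ (V.map (negMod p)) (replicate k (zeroMod p)) 1ᶠ q)
  (n : ℕ) (1≤n : 1 ≤ n) (q≡ : q ≡ 14 * n + 1) where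

  open Colours D n 1≤n q≡ public
  module G = Group p k
  open G using (_⊕_; ⊖_; _⊖_; 𝟘; IsPDF; IsHSBase; translate; SameClass; _≈ₛ_)

  F : Set
  F = Vec (Fin p) k

  _⊞_ : F → F → F
  _⊞_ = zipWith (addMod p)

  0ᶠ : F
  0ᶠ = replicate k (zeroMod p)

  label : Γ p k → Label
  label (a , b , x) = a , b

  point : Γ p k → F
  point (a , b , x) = x

  point-≡ : ∀ {g h : Γ p k} → label g ≡ label h → point g ≡ point h → g ≡ h
  point-≡ refl refl = refl

  𝟙-Γ : ∀ (g h : Γ p k) → 𝟙 (g G.≟ h) ≡ 𝟙 (label g ≟ₗ label h) * 𝟙 (point g ≟ᶠ point h)
  𝟙-Γ g h = trans (𝟙-⇔ (g G.≟ h) ((label g ≟ₗ label h) ×-dec (point g ≟ᶠ point h))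
    (λ { refl → refl , refl }) (λ (e , f) → point-≡ e f)) (𝟙-× (label g ≟ₗ label h) (point g ≟ᶠ point h))

  -- s T + w in the notation of the paper.
  place : F → Label → Γ p k → Γ p k
  place s (w , w′) (a , b , x) = addMod 2 a w , addMod 2 b w′ , s ⊠ x

  block : List (Γ p k) → F → Label → List (Γ p k)
  block T s w = map (place s w) T

  atZero : Label → Γ p k
  atZero (a , b) = a , b , 0ᶠ

  coset : List (Γ p k)
  coset = map atZero labels

  orbit : List (Γ p k) → List (List (Γ p k))
  orbit T = concatMap (λ s → map (block T s) labels) S

  _−ₗ_ : Γ p k → Γ p k → Label
  g −ₗ h = label g +ₗ (-ₗ label h)

  _−ₚ_ : Γ p k → Γ p k → F
  g −ₚ h = point g − point h

  key : Γ p k × Γ p k → Label × F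
  key (g , h) = g −ₗ h , colour (g −ₚ h)

  -ₗ-comm : ∀ g h → g −ₗ h ≡ h −ₗ g
  -ₗ-comm (a , b , _) (c , d , _) = cong₂ _,_ (−₂-comm a c) (−₂-comm b d)

  -- Labels have exponent 2 and -1 is a seventh power, so a key belongs to an unordered pair.
  key-comm : ∀ g h → key (g , h) ≡ key (h , g)
  key-comm g h = cong₂ _,_ (-ₗ-comm g h) (trans (sym (colour-⊟ _)) (cong colour (⊟−⊟ (point g) (point h))))

  place-⊖ : ∀ s w g h → place s w g ⊖ place s w h ≡ (proj₁ (g −ₗ h) , proj₂ (g −ₗ h) , s ⊠ (g −ₚ h))
  place-⊖ s (w , w′) (a , b , x) (c , d , y) = cong₂ _,_ (−₂-translate a c w) (cong₂ _,_ (−₂-translate b d w′)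
    (solve 3 (λ s x y → s :* x :- s :* y := s :* (x :- y)) refl s x y))

  module _ (A B C : List (Γ p k)) where

    base : Fin 3 → List (Γ p k)
    base fzero = A
    base (fsuc fzero) = B
    base (fsuc (fsuc fzero)) = C

    -- The tag remembers the base block, so that an equality of keys also identifies the block from
    -- which a difference comes.
    tagged : Fin 3 → List (Fin 3 × Γ p k × Γ p k)
    tagged t = map (t ,_) (pairs (base t))

    basePairs : List (Fin 3 × Γ p k × Γ p k)
    basePairs = concatMap tagged (allFin 3)

    parallelClass : List (List (Γ p k))
    parallelClass = coset ∷ (orbit A ++ orbit B ++ orbit C)

  record Starter (A B C : List (Γ p k)) : Set where
    field
      |A| : length A ≡ 3
      |B| : length B ≡ 5
      |C| : length C ≡ 6
      halves : List F
      |halves| : length halves ≡ 7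
      halves-± : map point (A ++ B ++ C) ↭ halves ++ map (V.map (negMod p)) halves
      halves-colours : Unique (map colour halves)
      halves-≢0 : All (_≢ 0ᶠ) halves
      keys-unique : Unique (map (key ∘ proj₂) (basePairs A B C))
      keys-≢0 : All (λ (_ , g , h) → g −ₚ h ≢ 0ᶠ) (basePairs A B C)

  Γ-assoc : ∀ g h i → (g ⊕ h) ⊕ i ≡ g ⊕ (h ⊕ i)
  Γ-assoc (a , b , x) (c , d , y) (e , f , z) = cong₂ _,_ (+₂-assoc a c e) (cong₂ _,_ (+₂-assoc b d f) (⊞-assoc x y z))

  Γ-comm : ∀ g h → g ⊕ h ≡ h ⊕ g
  Γ-comm (a , b , x) (c , d , y) = cong₂ _,_ (+₂-comm a c) (cong₂ _,_ (+₂-comm b d) (⊞-comm x y))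

  Γ-identityˡ : ∀ g → 𝟘 ⊕ g ≡ g
  Γ-identityˡ (a , b , x) = cong₂ _,_ (+₂-identityˡ a) (cong₂ _,_ (+₂-identityˡ b) (⊞-identityˡ x))

  Γ-inverseʳ : ∀ g → g ⊖ g ≡ 𝟘
  Γ-inverseʳ (a , b , x) = cong₂ _,_ (+₂-inverseʳ a) (cong₂ _,_ (+₂-inverseʳ b) (⊞-inverseʳ x))

  Γ-identityʳ : ∀ g → g ⊕ 𝟘 ≡ g
  Γ-identityʳ g = trans (Γ-comm g 𝟘) (Γ-identityˡ g)

  ⊕-⊖-cancel : ∀ g h → g ⊕ (h ⊖ g) ≡ h
  ⊕-⊖-cancel g h = begin
    g ⊕ (h ⊖ g)   ≡⟨ cong (g ⊕_) (Γ-comm h (⊖ g)) ⟩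
    g ⊕ (⊖ g ⊕ h) ≡⟨ Γ-assoc g (⊖ g) h ⟨
    (g ⊖ g) ⊕ h   ≡⟨ cong (_⊕ h) (Γ-inverseʳ g) ⟩
    𝟘 ⊕ h         ≡⟨ Γ-identityˡ h ⟩
    h             ∎
    where
    open ≡-Reasoning

  ⊖≡𝟘⇒≡ : ∀ g h → g ⊖ h ≡ 𝟘 → g ≡ h
  ⊖≡𝟘⇒≡ g h e = trans (sym (⊕-⊖-cancel h g)) (trans (cong (h ⊕_) e) (Γ-identityʳ h))

  ⊖-shift : ∀ b b′ u w → u ⊖ w ≡ b ⊖ b′ → b ⊕ (w ⊖ b′) ≡ u
  ⊖-shift b b′ u w e = begin
    b ⊕ (w ⊖ b′)       ≡⟨ Γ-assoc b w (⊖ b′) ⟨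
    (b ⊕ w) ⊖ b′       ≡⟨ cong (_⊖ b′) (Γ-comm b w) ⟩
    (w ⊕ b) ⊖ b′       ≡⟨ Γ-assoc w b (⊖ b′) ⟩
    w ⊕ (b ⊖ b′)       ≡⟨ cong (w ⊕_) e ⟨
    w ⊕ (u ⊖ w)        ≡⟨ ⊕-⊖-cancel w u ⟩
    u                  ∎
    where
    open ≡-Reasoning

  ⊕-⊖-⊕ : ∀ c c′ x → (c ⊕ x) ⊖ (c′ ⊕ x) ≡ c ⊖ c′
  ⊕-⊖-⊕ (a , b , x) (c , d , y) (e , f , z) = cong₂ _,_ (−₂-translate a c e) (cong₂ _,_ (−₂-translate b d f)
    (solve 3 (λ x y z → (x :+ z) :- (y :+ z) := x :- y) refl x y z))

  count-∑ : ∀ g xs → G.count g xs ≡ (∑[ y ∈ xs ] 𝟙 (g G.≟ y))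
  count-∑ g xs = length-filter-∑ (g G.≟_) xs

  private
    tri : ℕ → ℕ
    tri zero = 0
    tri (suc m) = m + tri m

    length-pairs : ∀ {a} {A : Set a} (xs : List A) → length (pairs xs) ≡ tri (length xs)
    length-pairs [] = refl
    length-pairs (x ∷ xs) = trans (Lₚ.length-++ (map (x ,_) xs)) (cong₂ _+_ (Lₚ.length-map (x ,_) xs) (length-pairs xs))

    dilates : F → F → ℕ
    dilates t y = ∑[ s ∈ S ] 𝟙 (y ≟ᶠ (s ⊠ t))

    dilates-± : ∀ {t y} → t ≢ 0ᶠ → y ≢ 0ᶠ → dilates t y + dilates (V.map (negMod p) t) y ≡ 𝟙 (colour t ≟ᶠ colour y)
    dilates-± {t} {y} t≢0 y≢0 = trans (cong₂ _+_ (flip t) (flip (V.map (negMod p) t))) (∑-dilates t≢0 y≢0)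
      where
      flip : ∀ t → dilates t y ≡ (∑[ s ∈ S ] 𝟙 ((s ⊠ t) ≟ᶠ y))
      flip t = ∑-cong S (λ s → 𝟙-⇔ (y ≟ᶠ (s ⊠ t)) ((s ⊠ t) ≟ᶠ y) sym sym)

    dilates-0 : ∀ {t} → t ≢ 0ᶠ → dilates t 0ᶠ ≡ 0
    dilates-0 {t} t≢0 = trans (∑-cong-∈ S (λ {s} i → 𝟙-no (0ᶠ ≟ᶠ (s ⊠ t)) (λ e → ⊠-≢0 (∈S⇒≢0 i) t≢0 (sym e)))) (∑-0 S)

    ∑-orbit : ∀ T (f : List (Γ p k) → ℕ) → ∑ (orbit T) f ≡ (∑[ s ∈ S ] ∑[ w ∈ labels ] f (block T s w))
    ∑-orbit T f = trans (∑-concatMap (λ s → map (block T s) labels) S f) (∑-cong S (λ s → ∑-map (block T s) labels f))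

    -- For fixed s and b the labels of b + w run through V once, so the labels drop out of the
    -- partition count.
    count-orbit : ∀ T g → (∑[ B ∈ orbit T ] G.count g B) ≡ (∑[ b ∈ T ] dilates (point b) (point g))
    count-orbit T g = begin
      (∑[ B ∈ orbit T ] G.count g B)
        ≡⟨ ∑-orbit T (G.count g) ⟩
      (∑[ s ∈ S ] ∑[ w ∈ labels ] G.count g (block T s w))
        ≡⟨ ∑-cong S inner ⟩
      (∑[ s ∈ S ] ∑[ b ∈ T ] 𝟙 (point g ≟ᶠ (s ⊠ point b)))
        ≡⟨ ∑-swap S T _ ⟩
      (∑[ b ∈ T ] dilates (point b) (point g)) ∎
      where
      open ≡-Reasoning
      inner : ∀ s → (∑[ w ∈ labels ] G.count g (block T s w)) ≡ (∑[ b ∈ T ] 𝟙 (point g ≟ᶠ (s ⊠ point b)))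
      inner s = begin
        (∑[ w ∈ labels ] G.count g (block T s w))
          ≡⟨ ∑-cong labels (λ w → trans (count-∑ g (block T s w)) (∑-map (place s w) T _)) ⟩
        (∑[ w ∈ labels ] ∑[ b ∈ T ] 𝟙 (g G.≟ place s w b))
          ≡⟨ ∑-swap labels T (λ w b → 𝟙 (g G.≟ place s w b)) ⟩
        (∑[ b ∈ T ] ∑[ w ∈ labels ] 𝟙 (g G.≟ place s w b))
          ≡⟨ ∑-cong T (λ b → trans (∑-cong labels (λ w → 𝟙-Γ g (place s w b)))
               (trans (∑-*ʳ labels _ (λ w → 𝟙 (label g ≟ₗ (label b +ₗ w))))
               (trans (cong (_* 𝟙 (point g ≟ᶠ (s ⊠ point b))) (∑-labels-+ (label g) (label b))) (*-identityˡ _)))) ⟩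
        (∑[ b ∈ T ] 𝟙 (point g ≟ᶠ (s ⊠ point b))) ∎

    differences : Γ p k → List (Γ p k) → ℕ
    differences g B = ∑[ b ∈ B ] ∑[ b′ ∈ B ] 𝟙 (g G.≟ (b ⊖ b′))

    count-Δ : ∀ {g} → g ≢ 𝟘 → ∀ B → G.count g (G.Δ B) ≡ differences g B
    count-Δ {g} g≢𝟘 B = trans (count-∑ g (G.Δ B)) (trans (∑-concatMap _ B _) (∑-cong B λ b →
      trans (∑-map (λ b′ → b ⊖ b′) (filter (λ b′ → ¬? (b G.≟ b′)) B) (λ y → 𝟙 (g G.≟ y)))
      (trans (∑-filter (λ b′ → ¬? (b G.≟ b′)) B (λ b′ → 𝟙 (g G.≟ (b ⊖ b′)))) (∑-cong B (drop b)))))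
      where
      drop : ∀ b b′ → 𝟙 (¬? (b G.≟ b′)) * 𝟙 (g G.≟ (b ⊖ b′)) ≡ 𝟙 (g G.≟ (b ⊖ b′))
      drop b b′ = case b G.≟ b′ of λ
        { (no ne) → trans (cong (_* 𝟙 (g G.≟ (b ⊖ b′))) (𝟙-yes (¬? (b G.≟ b′)) ne)) (*-identityˡ _)
        ; (yes refl) → trans (cong (𝟙 (¬? (b G.≟ b)) *_) (𝟙-no (g G.≟ (b ⊖ b)) (λ e → g≢𝟘 (trans e (Γ-inverseʳ b)))))
            (trans (*-zeroʳ (𝟙 (¬? (b G.≟ b)))) (sym (𝟙-no (g G.≟ (b ⊖ b)) (λ e → g≢𝟘 (trans e (Γ-inverseʳ b)))))) }

    -- The differences of s T + w do not depend on w. The four choices of w are the source of λ = 4.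
    differences-orbit : ∀ T g → (∑[ B ∈ orbit T ] differences g B) ≡
      4 * (∑[ b ∈ T ] ∑[ b′ ∈ T ] 𝟙 (label g ≟ₗ (b −ₗ b′)) * dilates (b −ₚ b′) (point g))
    differences-orbit T g = begin
      (∑[ B ∈ orbit T ] differences g B)
        ≡⟨ ∑-orbit T (differences g) ⟩
      (∑[ s ∈ S ] ∑[ w ∈ labels ] differences g (block T s w))
        ≡⟨ ∑-cong S (λ s → trans (∑-cong labels (translated s)) (∑-const labels (scaled s))) ⟩
      (∑[ s ∈ S ] 4 * scaled s)
        ≡⟨ ∑-*ˡ S 4 scaled ⟩
      4 * (∑[ s ∈ S ] scaled s)
        ≡⟨ cong (4 *_) (trans (∑-swap S T _) (∑-cong T (λ b → trans (∑-swap S T _) (∑-cong T (λ b′ → ∑-*ˡ S (𝟙 (label g ≟ₗ (b −ₗ b′))) (λ s → 𝟙 (point g ≟ᶠ (s ⊠ (b −ₚ b′))))) )))) ⟩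
      4 * (∑[ b ∈ T ] ∑[ b′ ∈ T ] 𝟙 (label g ≟ₗ (b −ₗ b′)) * dilates (b −ₚ b′) (point g)) ∎
      where
      open ≡-Reasoning
      scaled : F → ℕ
      scaled s = ∑[ b ∈ T ] ∑[ b′ ∈ T ] 𝟙 (label g ≟ₗ (b −ₗ b′)) * 𝟙 (point g ≟ᶠ (s ⊠ (b −ₚ b′)))
      translated : ∀ s w → differences g (block T s w) ≡ scaled s
      translated s w = trans (∑-map (place s w) T _) (∑-cong T λ b → trans (∑-map (place s w) T _) (∑-cong T λ b′ →
        trans (cong (λ h → 𝟙 (g G.≟ h)) (place-⊖ s w b b′)) (𝟙-Γ g (proj₁ (b −ₗ b′) , proj₂ (b −ₗ b′) , s ⊠ (b −ₚ b′)))))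

  module StarterProperties {A B C : List (Γ p k)} (starter : Starter A B C) where

    open Starter starter

    private
      bases : List (Γ p k)
      bases = A ++ B ++ C

      E : List (Fin 3 × Γ p k × Γ p k)
      E = basePairs A B C

      P : List (List (Γ p k))
      P = parallelClass A B C

      ∑-P : ∀ (f : List (Γ p k) → ℕ) → ∑ P f ≡ f coset + (∑ (orbit A) f + (∑ (orbit B) f + ∑ (orbit C) f))
      ∑-P f = cong (f coset +_) (trans (∑-++ (orbit A) _ f) (cong (∑ (orbit A) f +_) (∑-++ (orbit B) (orbit C) f)))

      ∑-bases : ∀ (f : Γ p k → ℕ) → ∑ A f + (∑ B f + ∑ C f) ≡ ∑ bases f
      ∑-bases f = sym (trans (∑-++ A _ f) (cong (∑ A f +_) (∑-++ B C f)))

      colours-once : ∀ {y} → y ≢ 0ᶠ → (∑[ l ∈ halves ] 𝟙 (colour l ≟ᶠ colour y)) ≡ 1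
      colours-once {y} y≢0 = trans (∑-cong halves (λ l → 𝟙-⇔ (colour l ≟ᶠ colour y) (colour y ≟ᶠ colour l) sym sym))
        (trans (sym (∑-map colour halves (λ c → 𝟙 (colour y ≟ᶠ c)))) (∑-≟ _≟ᶠ_ halves-colours
          (⊆∧length⇒⊇ _≟ᶠ_ halves-colours sub (≤-reflexive (trans |μ₇|≡7 (sym (trans (Lₚ.length-map colour halves) |halves|))))
            (colour-∈μ₇ y≢0))))
        where
        sub : ∀ {c} → c ∈ map colour halves → c ∈ μ₇
        sub i with ∈-map⁻ colour i
        ... | l , j , refl = colour-∈μ₇ (All.lookup halves-≢0 j)

      -- The fourteen points fall into pairs ±t, and a nonzero y is reached only from the one pair
      -- that has its colour.
      ∑-dilates-bases : ∀ y → (∑[ b ∈ bases ] dilates (point b) y) ≡ 𝟙 (nonzero? y)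
      ∑-dilates-bases y = begin
        (∑[ b ∈ bases ] dilates (point b) y)
          ≡⟨ ∑-map point bases (λ t → dilates t y) ⟨
        (∑[ t ∈ map point bases ] dilates t y)
          ≡⟨ ∑-↭ (λ t → dilates t y) halves-± ⟩
        (∑[ t ∈ halves ++ map (V.map (negMod p)) halves ] dilates t y)
          ≡⟨ trans (∑-++ halves _ _) (trans (cong (∑ halves (λ t → dilates t y) +_) (∑-map (V.map (negMod p)) halves (λ t → dilates t y)))
               (sym (∑-+ halves (λ t → dilates t y) (λ t → dilates (V.map (negMod p) t) y)))) ⟩
        (∑[ t ∈ halves ] dilates t y + dilates (V.map (negMod p) t) y)
          ≡⟨ finish (nonzero? y) ⟩
        𝟙 (nonzero? y) ∎
        where
        open ≡-Reasoning
        finish : (d : Dec (y ≢ 0ᶠ)) → (∑[ t ∈ halves ] dilates t y + dilates (V.map (negMod p) t) y) ≡ 𝟙 d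
        finish (yes y≢0) = trans (∑-cong-∈ halves (λ i → dilates-± (All.lookup halves-≢0 i) y≢0)) (colours-once y≢0)
        finish (no ¬y≢0) with y ≟ᶠ 0ᶠ
        ... | no y≢0 = ⊥-elim (¬y≢0 y≢0)
        ... | yes refl = trans (∑-cong-∈ halves (λ i → cong₂ _+_ (dilates-0 (All.lookup halves-≢0 i))
                (dilates-0 (⊟-≢0 (All.lookup halves-≢0 i))))) (∑-0 halves)

      ∑-coset : ∀ (f : Γ p k → ℕ) → ∑ coset f ≡ (∑[ l ∈ labels ] f (proj₁ l , proj₂ l , 0ᶠ))
      ∑-coset f = ∑-map atZero labels f

      𝟙-zero : ∀ y → 𝟙 (y ≟ᶠ 0ᶠ) + 𝟙 (nonzero? y) ≡ 1
      𝟙-zero y with y ≟ᶠ 0ᶠ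
      ... | yes _ = refl
      ... | no _ = refl

    partition : ∀ g → sum (map (G.count g) P) ≡ 1
    partition g = begin
      ∑ P (G.count g)
        ≡⟨ ∑-P (G.count g) ⟩
      G.count g coset + (∑ (orbit A) (G.count g) + (∑ (orbit B) (G.count g) + ∑ (orbit C) (G.count g)))
        ≡⟨ cong₂ _+_ cosetCount (trans (cong₂ _+_ (count-orbit A g) (cong₂ _+_ (count-orbit B g) (count-orbit C g)))
             (trans (∑-bases (λ b → dilates (point b) (point g))) (∑-dilates-bases (point g)))) ⟩
      𝟙 (point g ≟ᶠ 0ᶠ) + 𝟙 (nonzero? (point g))
        ≡⟨ 𝟙-zero (point g) ⟩
      1 ∎
      where
      open ≡-Reasoning
      cosetCount : G.count g coset ≡ 𝟙 (point g ≟ᶠ 0ᶠ)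
      cosetCount = trans (count-∑ g coset) (trans (∑-coset (λ y → 𝟙 (g G.≟ y)))
        (trans (∑-cong labels (λ l → 𝟙-Γ g (proj₁ l , proj₂ l , 0ᶠ)))
        (trans (∑-*ʳ labels (𝟙 (point g ≟ᶠ 0ᶠ)) (λ l → 𝟙 (label g ≟ₗ l)))
        (trans (cong (_* 𝟙 (point g ≟ᶠ 0ᶠ)) (∑-≟ _≟ₗ_ labels-unique (labels-complete (label g)))) (*-identityˡ _)))))

    private
      length-∑ : ∀ {a} {A : Set a} (xs : List A) → length xs ≡ (∑[ x ∈ xs ] 1)
      length-∑ xs = sym (trans (∑-const xs 1) (*-identityʳ (length xs)))

      ∈-orbit⁻ : ∀ T {X} → X ∈ orbit T → ∃[ s ] ∃[ w ] (s ∈ S × X ≡ block T s w)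
      ∈-orbit⁻ T i with ∈-concatMap⁻ (λ s → map (block T s) labels) {xs = S} i
      ... | j with find j
      ... | s , s∈S , k with ∈-map⁻ (block T s) k
      ... | w , _ , e = s , w , s∈S , e

      ∈-orbit⁺ : ∀ T {s} w → s ∈ S → block T s w ∈ orbit T
      ∈-orbit⁺ T {s} w i = ∈-concatMap⁺ (λ s → map (block T s) labels) (lose i (∈-map⁺ (block T s) (labels-complete w)))

      map-constant : ∀ {xs : List (List (Γ p k))} {m} → All (λ X → length X ≡ m) xs → map length xs ≡ L.replicate (length xs) m
      map-constant [] = refl
      map-constant (e ∷ es) = cong₂ _∷_ e (map-constant es)

      sizes-orbit : ∀ T → map length (orbit T) ≡ L.replicate (4 * n) (length T)
      sizes-orbit T = trans (map-constant (All.tabulate λ i → let s , w , _ , e = ∈-orbit⁻ T i in trans (cong length e) (Lₚ.length-map (place s w) T)))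
        (cong (λ m → L.replicate m (length T)) (trans (length-∑ (orbit T)) (trans (∑-orbit T (λ _ → 1))
          (trans (∑-const S 4) (trans (*-comm (length S) 4) (cong (4 *_) length-S))))))

    block-sizes : map length P ↭ Ktype n
    block-sizes = ↭-reflexive (cong (4 ∷_) (trans (Lₚ.map-++ length (orbit A) (orbit B ++ orbit C))
      (cong₂ _++_ (trans (sizes-orbit A) (cong (L.replicate (4 * n)) |A|)) (trans (Lₚ.map-++ length (orbit B) (orbit C))
        (cong₂ _++_ (trans (sizes-orbit B) (cong (L.replicate (4 * n)) |B|)) (trans (sizes-orbit C) (cong (L.replicate (4 * n)) |C|)))))))

    private
      -- The keys of the 28 pairs are distinct, so they exhaust the 4 · 7 possible values.
      keys : List (Label × F)
      keys = map (key ∘ proj₂) E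

      allKeys : List (Label × F)
      allKeys = cartesianProductWith _,_ labels μ₇

      |E| : length E ≡ 28
      |E| = begin
        length E                                        ≡⟨ length-∑ E ⟩
        ∑ E (λ _ → 1)                                   ≡⟨ ∑-concatMap (tagged A B C) (allFin 3) (λ _ → 1) ⟩
        (∑[ t ∈ allFin 3 ] ∑ (tagged A B C t) (λ _ → 1))  ≡⟨ ∑-cong (allFin 3) (λ t → trans (sym (length-∑ (tagged A B C t)))
                                                             (trans (Lₚ.length-map (t ,_) (pairs (base A B C t))) (length-pairs (base A B C t)))) ⟩
        tri (length A) + (tri (length B) + (tri (length C) + 0))  ≡⟨ cong₂ (λ a r → tri a + r) |A| (cong₂ (λ b c → tri b + (tri c + 0)) |B| |C|) ⟩
        28                                              ∎
        where
        open ≡-Reasoning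

      _≟ₖ_ : DecidableEquality (Label × F)
      _≟ₖ_ = ×-≡-dec _≟ₗ_ _≟ᶠ_

      keys-once : ∀ v {y} → y ≢ 0ᶠ → (∑[ e ∈ E ] 𝟙 ((v , colour y) ≟ₖ key (proj₂ e))) ≡ 1
      keys-once v {y} y≢0 = trans (sym (∑-map (key ∘ proj₂) E (λ κ → 𝟙 ((v , colour y) ≟ₖ κ)))) (∑-≟ _≟ₖ_ keys-unique
        (⊆∧length⇒⊇ _≟ₖ_ keys-unique sub
          (≤-reflexive (trans (length-cartesianProductWith _,_ labels μ₇) (trans (cong (4 *_) |μ₇|≡7) (sym (trans (Lₚ.length-map _ E) |E|)))))
          (∈-cartesianProductWith⁺ _,_ (labels-complete v) (colour-∈μ₇ y≢0))))
        where
        sub : ∀ {κ} → κ ∈ keys → κ ∈ allKeys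
        sub i with ∈-map⁻ (key ∘ proj₂) i
        ... | _ , j , refl = ∈-cartesianProductWith⁺ _,_ (labels-complete _) (colour-∈μ₇ (All.lookup keys-≢0 j))

      module _ (g : Γ p k) (g≢𝟘 : g ≢ 𝟘) where

        weight : Γ p k → Γ p k → ℕ
        weight b b′ = 𝟙 (label g ≟ₗ (b −ₗ b′)) * dilates (b −ₚ b′) (point g)

        weight-diagonal : ∀ b → weight b b ≡ 0
        weight-diagonal b with point g ≟ᶠ 0ᶠ
        ... | yes e = cong (_* dilates (b −ₚ b) (point g)) (𝟙-no (label g ≟ₗ (b −ₗ b)) λ e′ →
                g≢𝟘 (point-≡ (trans e′ (cong₂ _,_ (+₂-inverseʳ (proj₁ b)) (+₂-inverseʳ (proj₁ (proj₂ b))))) e))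
        ... | no ne = trans (cong (𝟙 (label g ≟ₗ (b −ₗ b)) *_) (trans (∑-cong S (λ s → 𝟙-no (point g ≟ᶠ (s ⊠ (b −ₚ b)))
                (λ e → ne (trans e (trans (cong (s ⊠_) (⊞-inverseʳ (point b))) (zeroʳ s)))))) (∑-0 S))) (*-zeroʳ (𝟙 (label g ≟ₗ (b −ₗ b))))

        -- The differences b - b′ and b′ - b have the same label and opposite points, so `∑-dilates`
        -- applies to them jointly: together they reach a g with nonzero point once if the key of
        -- the pair fits, and never otherwise.
        weight-pair : ∀ {t b b′} → (t , b , b′) ∈ E → weight b b′ + weight b′ b ≡ 𝟙 (nonzero? (point g)) * 𝟙 ((label g , colour (point g)) ≟ₖ key (b , b′))
        weight-pair {t} {b} {b′} i = begin
          weight b b′ + weight b′ b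
            ≡⟨ cong (weight b b′ +_) (cong₂ (λ l d → 𝟙 (label g ≟ₗ l) * dilates d (point g)) (-ₗ-comm b′ b) (sym (⊟−⊟ (point b) (point b′)))) ⟩
          𝟙 (label g ≟ₗ (b −ₗ b′)) * dilates d (point g) + 𝟙 (label g ≟ₗ (b −ₗ b′)) * dilates (V.map (negMod p) d) (point g)
            ≡⟨ *-distribˡ-+ (𝟙 (label g ≟ₗ (b −ₗ b′))) _ _ ⟨
          𝟙 (label g ≟ₗ (b −ₗ b′)) * (dilates d (point g) + dilates (V.map (negMod p) d) (point g))
            ≡⟨ finish (nonzero? (point g)) ⟩
          𝟙 (nonzero? (point g)) * 𝟙 ((label g , colour (point g)) ≟ₖ key (b , b′)) ∎
          where
          open ≡-Reasoning
          d : F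
          d = b −ₚ b′
          d≢0 : d ≢ 0ᶠ
          d≢0 = All.lookup keys-≢0 i
          finish : (dec : Dec (point g ≢ 0ᶠ)) →
            𝟙 (label g ≟ₗ (b −ₗ b′)) * (dilates d (point g) + dilates (V.map (negMod p) d) (point g))
              ≡ 𝟙 dec * 𝟙 ((label g , colour (point g)) ≟ₖ key (b , b′))
          finish (yes ne) = trans (cong (𝟙 (label g ≟ₗ (b −ₗ b′)) *_) (dilates-± d≢0 ne)) (trans (sym (𝟙-× (label g ≟ₗ (b −ₗ b′)) (colour d ≟ᶠ colour (point g))))
            (trans (𝟙-⇔ ((label g ≟ₗ (b −ₗ b′)) ×-dec (colour d ≟ᶠ colour (point g))) ((label g , colour (point g)) ≟ₖ key (b , b′))
              (λ (e , f) → cong₂ _,_ e (sym f)) (λ e → cong proj₁ e , sym (cong proj₂ e))) (sym (*-identityˡ _))))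
          finish (no ¬ne) with point g ≟ᶠ 0ᶠ
          ... | no ne = ⊥-elim (¬ne ne)
          ... | yes e rewrite e = trans (cong (𝟙 (label g ≟ₗ (b −ₗ b′)) *_) (cong₂ _+_ (dilates-0 d≢0) (dilates-0 (⊟-≢0 d≢0))))
                (*-zeroʳ (𝟙 (label g ≟ₗ (b −ₗ b′))))

        ∑∑-weight : (∑[ t ∈ allFin 3 ] ∑[ b ∈ base A B C t ] ∑[ b′ ∈ base A B C t ] weight b b′) ≡ 𝟙 (nonzero? (point g))
        ∑∑-weight = begin
          (∑[ t ∈ allFin 3 ] ∑[ b ∈ base A B C t ] ∑[ b′ ∈ base A B C t ] weight b b′)
            ≡⟨ ∑-cong (allFin 3) (λ t → trans (∑∑-pairs (base A B C t) weight)
                 (cong₂ _+_ (trans (∑-cong (base A B C t) weight-diagonal) (∑-0 (base A B C t))) (sym (∑-map (t ,_) (pairs (base A B C t)) f)))) ⟩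
          (∑[ t ∈ allFin 3 ] ∑ (tagged A B C t) f)
            ≡⟨ ∑-concatMap (tagged A B C) (allFin 3) f ⟨
          ∑ E f
            ≡⟨ ∑-cong-∈ E weight-pair ⟩
          (∑[ e ∈ E ] 𝟙 (nonzero? (point g)) * 𝟙 ((label g , colour (point g)) ≟ₖ key (proj₂ e)))
            ≡⟨ ∑-*ˡ E (𝟙 (nonzero? (point g))) _ ⟩
          𝟙 (nonzero? (point g)) * (∑[ e ∈ E ] 𝟙 ((label g , colour (point g)) ≟ₖ key (proj₂ e)))
            ≡⟨ finish (nonzero? (point g)) ⟩
          𝟙 (nonzero? (point g)) ∎
          where
          open ≡-Reasoning
          f : Fin 3 × Γ p k × Γ p k → ℕ
          f (_ , b , b′) = weight b b′ + weight b′ b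
          finish : (d : Dec (point g ≢ 0ᶠ)) → 𝟙 d * (∑[ e ∈ E ] 𝟙 ((label g , colour (point g)) ≟ₖ key (proj₂ e))) ≡ 𝟙 d
          finish (yes ne) = trans (*-identityˡ _) (keys-once (label g) ne)
          finish (no _) = refl

        differences-coset : differences g coset ≡ 4 * 𝟙 (point g ≟ᶠ 0ᶠ)
        differences-coset = begin
          differences g coset
            ≡⟨ trans (∑-coset (λ b → ∑[ b′ ∈ coset ] 𝟙 (g G.≟ (b ⊖ b′)))) (∑-cong labels row) ⟩
          (∑[ l ∈ labels ] (∑[ l′ ∈ labels ] 𝟙 (label g ≟ₗ (l +ₗ (-ₗ l′)))) * 𝟙 (point g ≟ᶠ 0ᶠ))
            ≡⟨ trans (∑-*ʳ labels (𝟙 (point g ≟ᶠ 0ᶠ)) (λ l → ∑[ l′ ∈ labels ] 𝟙 (label g ≟ₗ (l +ₗ (-ₗ l′)))))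
                 (cong (_* 𝟙 (point g ≟ᶠ 0ᶠ)) (∑-labels-− (label g))) ⟩
          4 * 𝟙 (point g ≟ᶠ 0ᶠ) ∎
          where
          open ≡-Reasoning
          entry : ∀ l l′ → 𝟙 (g G.≟ (atZero l ⊖ atZero l′)) ≡ 𝟙 (label g ≟ₗ (l +ₗ (-ₗ l′))) * 𝟙 (point g ≟ᶠ 0ᶠ)
          entry l l′ = trans (𝟙-Γ g (atZero l ⊖ atZero l′))
            (cong (λ z → 𝟙 (label g ≟ₗ (l +ₗ (-ₗ l′))) * 𝟙 (point g ≟ᶠ z)) (⊞-inverseʳ 0ᶠ))
          row : ∀ l → (∑[ b′ ∈ coset ] 𝟙 (g G.≟ (atZero l ⊖ b′))) ≡ (∑[ l′ ∈ labels ] 𝟙 (label g ≟ₗ (l +ₗ (-ₗ l′)))) * 𝟙 (point g ≟ᶠ 0ᶠ)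
          row l = trans (∑-coset (λ b′ → 𝟙 (g G.≟ (atZero l ⊖ b′)))) (trans (∑-cong labels (entry l))
            (∑-*ʳ labels (𝟙 (point g ≟ᶠ 0ᶠ)) (λ l′ → 𝟙 (label g ≟ₗ (l +ₗ (-ₗ l′))))))

    difference-count : ∀ g → g ≢ 𝟘 → G.count g (concatMap G.Δ P) ≡ 4
    difference-count g g≢𝟘 = begin
      G.count g (concatMap G.Δ P)
        ≡⟨ trans (count-∑ g (concatMap G.Δ P)) (∑-concatMap G.Δ P (λ y → 𝟙 (g G.≟ y))) ⟩
      (∑[ X ∈ P ] ∑[ y ∈ G.Δ X ] 𝟙 (g G.≟ y))
        ≡⟨ ∑-cong P (λ X → trans (sym (count-∑ g (G.Δ X))) (count-Δ g≢𝟘 X)) ⟩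
      ∑ P (differences g)
        ≡⟨ ∑-P (differences g) ⟩
      differences g coset + (∑ (orbit A) (differences g) + (∑ (orbit B) (differences g) + ∑ (orbit C) (differences g)))
        ≡⟨ cong₂ _+_ (differences-coset g g≢𝟘) (cong₂ _+_ (differences-orbit A g) (cong₂ _+_ (differences-orbit B g) (differences-orbit C g))) ⟩
      4 * 𝟙 (point g ≟ᶠ 0ᶠ) + (4 * W A + (4 * W B + 4 * W C))
        ≡⟨ factor-4 (𝟙 (point g ≟ᶠ 0ᶠ)) (W A) (W B) (W C) ⟩
      4 * (𝟙 (point g ≟ᶠ 0ᶠ) + (W A + (W B + (W C + 0))))
        ≡⟨ cong (λ z → 4 * (𝟙 (point g ≟ᶠ 0ᶠ) + z)) (∑∑-weight g g≢𝟘) ⟩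
      4 * (𝟙 (point g ≟ᶠ 0ᶠ) + 𝟙 (nonzero? (point g)))
        ≡⟨ cong (4 *_) (𝟙-zero (point g)) ⟩
      4 ∎
      where
      open ≡-Reasoning
      W : List (Γ p k) → ℕ
      W T = ∑[ b ∈ T ] ∑[ b′ ∈ T ] weight g g≢𝟘 b b′

    isPDF : IsPDF P (Ktype n) 4
    isPDF = partition , block-sizes , difference-count

    private
      data View : List (Γ p k) → Set where
        is-coset : View coset
        is-block : ∀ t {s} w → s ∈ S → View (block (base A B C t) s w)

      view : ∀ {X} → X ∈ P → View X
      view (here refl) = is-coset
      view (there i) with ∈-++⁻ (orbit A) i
      ... | inj₁ j with ∈-orbit⁻ A j
      ...   | s , w , s∈S , refl = is-block fzero w s∈S
      view (there i) | inj₂ j with ∈-++⁻ (orbit B) j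
      ... | inj₁ j′ with ∈-orbit⁻ B j′
      ...   | s , w , s∈S , refl = is-block (fsuc fzero) w s∈S
      view (there i) | inj₂ j | inj₂ j′ with ∈-orbit⁻ C j′
      ...   | s , w , s∈S , refl = is-block (fsuc (fsuc fzero)) w s∈S

      unview : ∀ {X} → View X → X ∈ P
      unview is-coset = here refl
      unview (is-block fzero w i) = there (∈-++⁺ˡ (∈-orbit⁺ A w i))
      unview (is-block (fsuc fzero) w i) = there (∈-++⁺ʳ (orbit A) (∈-++⁺ˡ (∈-orbit⁺ B w i)))
      unview (is-block (fsuc (fsuc fzero)) w i) = there (∈-++⁺ʳ (orbit A) (∈-++⁺ʳ (orbit B) (∈-orbit⁺ C w i)))

      ∈-E : ∀ t {b b′} → (b , b′) ∈ pairs (base A B C t) → (t , b , b′) ∈ E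
      ∈-E t i = ∈-concatMap⁺ (tagged A B C) (lose (∈-allFin t) (∈-map⁺ (t ,_) i))

      E-injective : ∀ {e e′} → e ∈ E → e′ ∈ E → key (proj₂ e) ≡ key (proj₂ e′) → e ≡ e′
      E-injective = Unique-map-inj (key ∘ proj₂) keys-unique

      -- Elements of S and their negatives are disjoint, so an unordered difference occurs only once up to translation.
      difference-determines : ∀ {t t′ s s′ b b′ c c′} → s ∈ S → s′ ∈ S → b ≢ b′ → c ≢ c′ →
        b ∈ base A B C t → b′ ∈ base A B C t → c ∈ base A B C t′ → c′ ∈ base A B C t′ →
        b −ₗ b′ ≡ c −ₗ c′ → s ⊠ (b −ₚ b′) ≡ s′ ⊠ (c −ₚ c′) → t ≡ t′ × s ≡ s′ × b ≡ c
      difference-determines {t} {t′} {s} {s′} {b} {b′} {c} {c′} s∈ s′∈ ne ne′ i i′ j j′ el ep =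
        go (∈-pairs i i′ ne) (∈-pairs j j′ ne′)
        where
        colour≡ : colour (b −ₚ b′) ≡ colour (c −ₚ c′)
        colour≡ = trans (sym (trans (colour-⊠ s _) (trans (cong (_⊠ colour (b −ₚ b′)) (∈S⇒colour s∈)) (⊠-identityˡ _))))
          (trans (cong colour ep) (trans (colour-⊠ s′ _) (trans (cong (_⊠ colour (c −ₚ c′)) (∈S⇒colour s′∈)) (⊠-identityˡ _))))
        key≡ : key (b , b′) ≡ key (c , c′)
        key≡ = cong₂ _,_ el colour≡
        same : ∀ {d} → d ≢ 0ᶠ → s ⊠ d ≡ s′ ⊠ d → s ≡ s′
        same d≢0 e = ⊠-cancelˡ d≢0 (trans (⊠-comm _ s) (trans e (⊠-comm s′ _)))
        opposite : ∀ {d} → d ≢ 0ᶠ → s ⊠ d ≡ s′ ⊠ (V.map (negMod p) d) → ⊥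
        opposite {d} d≢0 e = ∈S⇒⊟∉S s′∈ (subst (_∈ S) (same′ (trans e (sym (⊟-distribʳ s′ d)))) s∈)
          where
          same′ : s ⊠ d ≡ V.map (negMod p) (s′ ⊠ d) → s ≡ V.map (negMod p) s′
          same′ e = ⊠-cancelˡ d≢0 (trans (⊠-comm d s) (trans e (trans (⊟-distribˡ s′ d) (⊠-comm _ d))))
        ⊟-≢0′ : ∀ {g h} → h −ₚ g ≢ 0ᶠ → g −ₚ h ≢ 0ᶠ
        ⊟-≢0′ {g} {h} ne e = ne (trans (sym (⊟−⊟ (point g) (point h))) (trans (cong (V.map (negMod p)) e) ⊟0))
        go : (b , b′) ∈ pairs (base A B C t) ⊎ (b′ , b) ∈ pairs (base A B C t) →
             (c , c′) ∈ pairs (base A B C t′) ⊎ (c′ , c) ∈ pairs (base A B C t′) → t ≡ t′ × s ≡ s′ × b ≡ c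
        go (inj₁ x) (inj₁ y) = cong proj₁ e , same (All.lookup keys-≢0 (∈-E t x)) (trans ep (cong (s′ ⊠_) (sym d≡))) , cong (proj₁ ∘ proj₂) e
          where
          e : (t , b , b′) ≡ (t′ , c , c′)
          e = E-injective (∈-E t x) (∈-E t′ y) key≡
          d≡ : b −ₚ b′ ≡ c −ₚ c′
          d≡ = cong (λ (_ , g , h) → g −ₚ h) e
        go (inj₂ x) (inj₂ y) = cong proj₁ e , same (⊟-≢0′ {b} {b′} (All.lookup keys-≢0 (∈-E t x))) (trans ep (cong (s′ ⊠_) (sym d≡))) , cong (proj₂ ∘ proj₂) e
          where
          e : (t , b′ , b) ≡ (t′ , c′ , c)
          e = E-injective (∈-E t x) (∈-E t′ y) (trans (key-comm b′ b) (trans key≡ (key-comm c c′)))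
          d≡ : b −ₚ b′ ≡ c −ₚ c′
          d≡ = cong (λ (_ , g , h) → h −ₚ g) e
        go (inj₁ x) (inj₂ y) = ⊥-elim (opposite (All.lookup keys-≢0 (∈-E t x)) (trans ep (cong (s′ ⊠_) d≡)))
          where
          e : (t , b , b′) ≡ (t′ , c′ , c)
          e = E-injective (∈-E t x) (∈-E t′ y) (trans key≡ (key-comm c c′))
          d≡ : c −ₚ c′ ≡ V.map (negMod p) (b −ₚ b′)
          d≡ = trans (sym (cong (λ (_ , g , h) → h −ₚ g) e)) (sym (⊟−⊟ (point b) (point b′)))
        go (inj₂ x) (inj₁ y) = ⊥-elim (opposite (⊟-≢0′ {b} {b′} (All.lookup keys-≢0 (∈-E t x))) (trans ep (cong (s′ ⊠_) d≡)))
          where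
          e : (t , b′ , b) ≡ (t′ , c , c′)
          e = E-injective (∈-E t x) (∈-E t′ y) (trans (key-comm b′ b) key≡)
          d≡ : c −ₚ c′ ≡ V.map (negMod p) (b −ₚ b′)
          d≡ = trans (sym (cong (λ (_ , g , h) → g −ₚ h) e)) (sym (⊟−⊟ (point b) (point b′)))

      -- The coincidences X + x = Y + y that do occur: the same base block and the same s, with x
      -- and y differing by a label that w absorbs. The label of x - y can be written as a sum
      -- because V has exponent 2.
      data Aligned (x y : Γ p k) : List (Γ p k) → List (Γ p k) → Set where
        cosets : point x ≡ point y → Aligned x y coset coset
        blocks : ∀ T s w → point x ≡ point y → Aligned x y (block T s w) (block T s (w +ₗ (label x +ₗ label y)))

      aligned-point : ∀ {x y X Y} → Aligned x y X Y → point x ≡ point y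
      aligned-point (cosets e) = e
      aligned-point (blocks _ _ _ e) = e

      ∈-coset : ∀ {g} → g ∈ coset → point g ≡ 0ᶠ
      ∈-coset i with ∈-map⁻ atZero {xs = labels} i
      ... | _ , _ , refl = refl

      translate-block : ∀ T s w {x y} → point x ≡ point y → translate (block T s w) x ≡ translate (block T s (w +ₗ (label x +ₗ label y))) y
      translate-block T s w {x} {y} e = trans (sym (Lₚ.map-∘ T)) (trans (Lₚ.map-cong pointwise T) (Lₚ.map-∘ T))
        where
        pointwise : ∀ b → place s w b ⊕ x ≡ place s (w +ₗ (label x +ₗ label y)) b ⊕ y
        pointwise (a , b , z) = cong₂ _,_ (+₂-move a _ _ _) (cong₂ _,_ (+₂-move b _ _ _) (cong ((s ⊠ z) ⊞_) e))

      coset-⊆ : ∀ {x y} → point x ≡ point y → ∀ {z} → z ∈ translate coset x → z ∈ translate coset y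
      coset-⊆ {x} {y} e i with ∈-map⁻ (_⊕ x) {xs = coset} i
      ... | c , j , refl with ∈-map⁻ atZero {xs = labels} j
      ... | l , _ , refl = subst (_∈ translate coset y) (sym moved) (∈-map⁺ (_⊕ y) (∈-map⁺ atZero (labels-complete l′)))
        where
        l′ : Label
        l′ = l +ₗ (label x +ₗ label y)
        moved : atZero l ⊕ x ≡ atZero l′ ⊕ y
        moved = cong₂ _,_ (shift₂ (proj₁ l) _ _) (cong₂ _,_ (shift₂ (proj₂ l) _ _) (cong (0ᶠ ⊞_) e))
          where
          shift₂ : ∀ a x y → addMod 2 a x ≡ addMod 2 (addMod 2 a (addMod 2 x y)) y
          shift₂ = every₂ (every₂ (every₂ refl refl) (every₂ refl refl)) (every₂ (every₂ refl refl) (every₂ refl refl))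

      aligned-≈ : ∀ {x y X Y} → Aligned x y X Y → translate X x ≈ₛ translate Y y
      aligned-≈ {x} {y} (cosets e) z = mk⇔ (coset-⊆ {x} {y} e) (coset-⊆ {y} {x} (sym e))
      aligned-≈ (blocks T s w e) z = mk⇔ (subst (z ∈_) (translate-block T s w e)) (subst (z ∈_) (sym (translate-block T s w e)))

      module _ {x y b b′ c c′ : Γ p k} (b≢b′ : b ≢ b′) (c≢c′ : c ≢ c′) (b⊖b′ : b ⊖ b′ ≡ c ⊖ c′) (bx≡cy : b ⊕ x ≡ c ⊕ y) where

        private
          coset-diff : ∀ {z z′} → z ∈ coset → z′ ∈ coset → point (z ⊖ z′) ≡ 0ᶠ
          coset-diff m m′ = trans (cong₂ _−_ (∈-coset m) (∈-coset m′)) (⊞-inverseʳ 0ᶠ)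

          place-≢ : ∀ {s w a a′ z z′} → z ≡ place s w a → z′ ≡ place s w a′ → z ≢ z′ → a ≢ a′
          place-≢ e e′ ne refl = ne (trans e (sym e′))

          point-diff : ∀ {t s w z z′} → s ∈ S → z ∈ block (base A B C t) s w → z′ ∈ block (base A B C t) s w → z ≢ z′ → point (z ⊖ z′) ≢ 0ᶠ
          point-diff {t} {s} {w} {z} {z′} s∈ m m′ ne =
            let a , a∈ , e = ∈-map⁻ (place s w) m ; a′ , a′∈ , e′ = ∈-map⁻ (place s w) m′ in
            λ z≡0 → ⊠-≢0 (∈S⇒≢0 s∈) (d≢0 a a′ (∈-pairs a∈ a′∈ (place-≢ {s} {w} e e′ ne)))
              (trans (sym (cong point (trans (cong₂ _⊖_ e e′) (place-⊖ s w a a′)))) z≡0)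
            where
            d≢0 : ∀ a a′ → (a , a′) ∈ pairs (base A B C t) ⊎ (a′ , a) ∈ pairs (base A B C t) → a −ₚ a′ ≢ 0ᶠ
            d≢0 a a′ (inj₁ o) = All.lookup keys-≢0 (∈-E t o)
            d≢0 a a′ (inj₂ o) e = All.lookup keys-≢0 (∈-E t o) (trans (sym (⊟−⊟ (point a) (point a′))) (trans (cong (V.map (negMod p)) e) ⊟0))

          strip : ∀ a {x y} → a ⊞ x ≡ a ⊞ y → x ≡ y
          strip a {x} {y} e = trans (sym (remove a x)) (trans (cong (_− a) e) (remove a y))
            where
            remove : ∀ a b → (a ⊞ b) − a ≡ b
            remove = solve 2 (λ a b → (a :+ b) :- a := b) refl

          blocks′ : ∀ t s w w′ β → place s w β ⊕ x ≡ place s w′ β ⊕ y → Aligned x y (block (base A B C t) s w) (block (base A B C t) s w′)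
          blocks′ t s w w′ β moved = subst (λ z → Aligned x y (block (base A B C t) s w) (block (base A B C t) s z)) (sym w′≡)
              (blocks (base A B C t) s w (strip (s ⊠ point β) (cong point moved)))
            where
            w′≡ : w′ ≡ w +ₗ (label x +ₗ label y)
            w′≡ = cong₂ _,_ (+₂-move⁻ (proj₁ β) (proj₁ w) (proj₁ w′) (proj₁ x) (proj₁ y) (cong proj₁ moved))
                            (+₂-move⁻ (proj₁ (proj₂ β)) (proj₂ w) (proj₂ w′) (proj₁ (proj₂ x)) (proj₁ (proj₂ y)) (cong (proj₁ ∘ proj₂) moved))

          same-blocks : ∀ {t t′ s s′ w w′} → s ∈ S → s′ ∈ S → b ∈ block (base A B C t) s w → b′ ∈ block (base A B C t) s w →
            c ∈ block (base A B C t′) s′ w′ → c′ ∈ block (base A B C t′) s′ w′ → Aligned x y (block (base A B C t) s w) (block (base A B C t′) s′ w′)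
          same-blocks {t} {t′} {s} {s′} {w} {w′} s∈ s′∈ m m′ l l′ =
            let β , β∈ , eβ = ∈-map⁻ (place s w) m
                β′ , β′∈ , eβ′ = ∈-map⁻ (place s w) m′
                γ , γ∈ , eγ = ∈-map⁻ (place s′ w′) l
                γ′ , γ′∈ , eγ′ = ∈-map⁻ (place s′ w′) l′
                diff≡ = trans (sym (place-⊖ s w β β′)) (trans (cong₂ _⊖_ (sym eβ) (sym eβ′)) (trans b⊖b′ (trans (cong₂ _⊖_ eγ eγ′) (place-⊖ s′ w′ γ γ′))))
                t≡ , s≡ , β≡ = difference-determines s∈ s′∈ (place-≢ {s} {w} eβ eβ′ b≢b′) (place-≢ {s′} {w′} eγ eγ′ c≢c′) β∈ β′∈ γ∈ γ′∈
                  (cong label diff≡) (cong point diff≡)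
            in finish t≡ s≡ β≡ (trans (cong (_⊕ x) (sym eβ)) (trans bx≡cy (cong (_⊕ y) eγ)))
            where
            finish : ∀ {t′ s′ β γ} → t ≡ t′ → s ≡ s′ → β ≡ γ → place s w β ⊕ x ≡ place s′ w′ γ ⊕ y →
              Aligned x y (block (base A B C t) s w) (block (base A B C t′) s′ w′)
            finish {β = β} refl refl refl moved = blocks′ t s w w′ β moved

        -- Differences inside `coset` have point 0 and those inside the other blocks do not, which
        -- excludes the mixed cases. Between two orbit blocks the common difference determines T, s
        -- and the point b, and then `b ⊕ x ≡ c ⊕ y` fixes the labels.
        aligned-views : ∀ {X Y} → View X → View Y → b ∈ X → b′ ∈ X → c ∈ Y → c′ ∈ Y → Aligned x y X Y
        aligned-views is-coset is-coset m m′ l l′ =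
          cosets (strip 0ᶠ (trans (cong (_⊞ point x) (sym (∈-coset m))) (trans (cong point bx≡cy) (cong (_⊞ point y) (∈-coset l)))))
        aligned-views is-coset (is-block t w s∈) m m′ l l′ = ⊥-elim (point-diff {t} s∈ l l′ c≢c′ (trans (cong point (sym b⊖b′)) (coset-diff m m′)))
        aligned-views (is-block t w s∈) is-coset m m′ l l′ = ⊥-elim (point-diff {t} s∈ m m′ b≢b′ (trans (cong point b⊖b′) (coset-diff l l′)))
        aligned-views (is-block t w s∈) (is-block t′ w′ s′∈) m m′ l l′ = same-blocks {t} {t′} s∈ s′∈ m m′ l l′

      aligned : ∀ {u v X x Y y} → u ≢ v → View X → View Y →
        u ∈ translate X x → v ∈ translate X x → u ∈ translate Y y → v ∈ translate Y y → Aligned x y X Y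
      aligned {u} {v} {X} {x} {Y} {y} u≢v vX vY i i′ j j′ =
        let b , b∈ , eb = ∈-map⁻ (_⊕ x) {xs = X} i
            b′ , b′∈ , eb′ = ∈-map⁻ (_⊕ x) {xs = X} i′
            c , c∈ , ec = ∈-map⁻ (_⊕ y) {xs = Y} j
            c′ , c′∈ , ec′ = ∈-map⁻ (_⊕ y) {xs = Y} j′
        in aligned-views {x} {y} (differ eb eb′) (differ ec ec′)
             (trans (sym (⊕-⊖-⊕ b b′ x)) (trans (cong₂ _⊖_ (trans (sym eb) ec) (trans (sym eb′) ec′)) (⊕-⊖-⊕ c c′ y)))
             (trans (sym eb) ec) vX vY b∈ b′∈ c∈ c′∈
        where
        differ : ∀ {b b′ x} → u ≡ b ⊕ x → v ≡ b′ ⊕ x → b ≢ b′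
        differ e e′ refl = u≢v (trans e (sym e′))

      -- Translation by an element of V × {0} permutes the four blocks belonging to given T and s
      -- and preserves `coset`, so the class P + x depends on x only through its point.
      sameClass : ∀ {x y} → point x ≡ point y → SameClass P x y
      sameClass {x} {y} e =
        (λ X X∈ → let Y , vY , al = forward (view X∈) e in Y , unview vY , aligned-≈ al) ,
        (λ Y Y∈ → let X , vX , al = forward (view Y∈) (sym e) in X , unview vX , λ z → flip⇔ (aligned-≈ al z))
        where
        flip⇔ : ∀ {A B : Set} → A ⇔ B → B ⇔ A
        flip⇔ f = mk⇔ (Equivalence.from f) (Equivalence.to f)
        forward : ∀ {x y X} → View X → point x ≡ point y → ∃[ Y ] (View Y × Aligned x y X Y)
        forward is-coset e = coset , is-coset , cosets e
        forward {x} {y} (is-block t {s} w s∈) e = _ , is-block t (w +ₗ (label x +ₗ label y)) s∈ , blocks (base A B C t) s w e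

      two-points : ∀ {X} → View X → ∃[ b ] ∃[ b′ ] (b ∈ X × b′ ∈ X × b ≢ b′)
      two-points is-coset = _ , _ , here refl , there (here refl) , λ e → case cong (λ (_ , b , _) → b) e of λ ()
      two-points (is-block t {s} w s∈) = let b , b′ , i = pair t in place s w b , place s w b′ ,
          ∈-map⁺ (place s w) (proj₁ (∈-pairs⁻ i)) , ∈-map⁺ (place s w) (proj₂ (∈-pairs⁻ i)) ,
          λ e → ⊠-≢0 (∈S⇒≢0 s∈) (All.lookup keys-≢0 (∈-E t i))
            (trans (sym (cong point (place-⊖ s w b b′))) (trans (cong (λ z → point (z ⊖ place s w b′)) e) (cong point (Γ-inverseʳ (place s w b′)))))
        where
        first-pair : ∀ {a} {A : Set a} (xs : List A) → 2 ≤ length xs → ∃[ x ] ∃[ y ] (x , y) ∈ pairs xs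
        first-pair (x ∷ y ∷ xs) _ = x , y , here refl
        first-pair (x ∷ []) (s≤s ())
        pair : ∀ t → ∃[ b ] ∃[ b′ ] (b , b′) ∈ pairs (base A B C t)
        pair fzero = first-pair A (subst (2 ≤_) (sym |A|) (s≤s (s≤s z≤n)))
        pair (fsuc fzero) = first-pair B (subst (2 ≤_) (sym |B|) (s≤s (s≤s z≤n)))
        pair (fsuc (fsuc fzero)) = first-pair C (subst (2 ≤_) (sym |C|) (s≤s (s≤s z≤n)))

    private
      ∈-Δ⁻ : ∀ X {d} → d ∈ G.Δ X → ∃[ b ] ∃[ b′ ] (b ∈ X × b′ ∈ X × d ≡ b ⊖ b′)
      ∈-Δ⁻ X d∈ =
        let b , b∈ , m = find (∈-concatMap⁻ (λ b → map (λ b′ → b ⊖ b′) (filter (λ b′ → ¬? (b G.≟ b′)) X)) {xs = X} d∈)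
            b′ , b′∈ , e = ∈-map⁻ (λ b′ → b ⊖ b′) {xs = filter (λ b′ → ¬? (b G.≟ b′)) X} m
        in b , b′ , b∈ , proj₁ (∈-filter⁻ (λ b′ → ¬? (b G.≟ b′)) {xs = X} b′∈) , e

      occurs : ∀ g → g ≢ 𝟘 → g ∈ concatMap G.Δ P
      occurs g g≢𝟘 =
        let d , d∈ , e = ∑-positive (concatMap G.Δ P) (λ y → 𝟙 (g G.≟ y))
              (subst (1 ≤_) (sym (trans (sym (count-∑ g (concatMap G.Δ P))) (difference-count g g≢𝟘))) (s≤s z≤n))
        in subst (_∈ concatMap G.Δ P) (sym (𝟙-sound (g G.≟ d) e)) d∈

      joined : ∀ u w → u ≢ w → ∃[ X ] ∃[ x ] (X ∈ P × u ∈ translate X x × w ∈ translate X x)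
      joined u w u≢w =
        let X , X∈ , d∈ = find (∈-concatMap⁻ G.Δ {xs = P} (occurs (u ⊖ w) (λ e → u≢w (⊖≡𝟘⇒≡ u w e))))
            b , b′ , b∈ , b′∈ , e = ∈-Δ⁻ X d∈
        in X , w ⊖ b′ , X∈ ,
           subst (_∈ translate X (w ⊖ b′)) (⊖-shift b b′ u w e) (∈-map⁺ (_⊕ (w ⊖ b′)) b∈) ,
           subst (_∈ translate X (w ⊖ b′)) (⊕-⊖-cancel b′ w) (∈-map⁺ (_⊕ (w ⊖ b′)) b′∈)

      unique : ∀ u w → u ≢ w → ∀ X x Y y → X ∈ P → Y ∈ P → u ∈ translate X x → w ∈ translate X x →
        u ∈ translate Y y → w ∈ translate Y y → translate X x ≈ₛ translate Y y
      unique u w u≢w X x Y y X∈ Y∈ i i′ j j′ = aligned-≈ {x} {y} (aligned {u} {w} {X} {x} {Y} {y} u≢w (view X∈) (view Y∈) i i′ j j′)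

      ⊕-injective : ∀ {b b′} x → b ⊕ x ≡ b′ ⊕ x → b ≡ b′
      ⊕-injective {b} {b′} x e = ⊖≡𝟘⇒≡ b b′ (trans (sym (⊕-⊖-⊕ b b′ x)) (trans (cong (_⊖ (b′ ⊕ x)) e) (Γ-inverseʳ (b′ ⊕ x))))

      -- A shared block contains two distinct points, and `aligned` applied to these forces x and y
      -- to have the same point.
      resolved : ∀ X x Y y → X ∈ P → Y ∈ P → translate X x ≈ₛ translate Y y → SameClass P x y
      resolved X x Y y X∈ Y∈ X≈Y =
        let b , b′ , b∈ , b′∈ , ne = two-points (view X∈)
            i = ∈-map⁺ (_⊕ x) b∈
            i′ = ∈-map⁺ (_⊕ x) b′∈
        in sameClass (aligned-point {x} {y} (aligned {b ⊕ x} {b′ ⊕ x} {X} {x} {Y} {y} (λ e → ne (⊕-injective x e))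
             (view X∈) (view Y∈) i i′ (Equivalence.to (X≈Y (b ⊕ x)) i) (Equivalence.to (X≈Y (b′ ⊕ x)) i′)))

    isHSBase : IsHSBase P
    isHSBase = joined , unique , resolved

-- Second moments of coloured neighbourhoods.

private
  module S = +-*-Solver

  ∣-∣²-identity : ∀ a b → ∣ a - b ∣ * ∣ a - b ∣ + 2 * a * b ≡ a * a + b * b
  ∣-∣²-identity a b with ≤-total a b
  ... | inj₁ a≤b rewrite m≤n⇒∣m-n∣≡n∸m a≤b =
    subst (λ c → (b ∸ a) * (b ∸ a) + 2 * a * c ≡ a * a + c * c) (m∸n+n≡m a≤b) (identity (b ∸ a) a)
    where
    identity : ∀ d a → d * d + 2 * a * (d + a) ≡ a * a + (d + a) * (d + a)
    identity = S.solve 2 (λ d a → d S.:* d S.:+ S.con 2 S.:* a S.:* (d S.:+ a) S.:= a S.:* a S.:+ (d S.:+ a) S.:* (d S.:+ a)) refl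
  ... | inj₂ b≤a rewrite m≤n⇒∣n-m∣≡n∸m b≤a =
    subst (λ c → (a ∸ b) * (a ∸ b) + 2 * c * b ≡ c * c + b * b) (m∸n+n≡m b≤a) (identity (a ∸ b) b)
    where
    identity : ∀ d b → d * d + 2 * (d + b) * b ≡ (d + b) * (d + b) + b * b
    identity = S.solve 2 (λ d b → d S.:* d S.:+ S.con 2 S.:* (d S.:+ b) S.:* b S.:= (d S.:+ b) S.:* (d S.:+ b) S.:+ b S.:* b) refl

module Pseudorandom {A : Set} {_⊞_ _⊠_ : A → A → A} {⊟_ : A → A} {0ᶠ 1ᶠ : A} {q : ℕ}
  (D : IsFiniteDomain _⊞_ _⊠_ ⊟_ 0ᶠ 1ᶠ q) (n : ℕ) (1≤n : 1 ≤ n) (q≡ : q ≡ 14 * n + 1) (49≤n : 49 ≤ n) where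

  open Colours D n 1≤n q≡

  neighbours : A → List A → A → ℕ
  neighbours c B z = ∑[ b ∈ B ] 𝟙 (colour (z − b) ≟ᶠ c)

  private
    module Moments (B : List A) (B-unique : Unique B) where

      m : ℕ
      m = length B

      -- The number of z with z − b and z − b′ of the same colour: (z − b) / (z − b′) runs through the seventh powers other than 1.
      agreements : A → A → ℕ
      agreements b b′ = ∑[ z ∈ elems ] ∑[ ζ ∈ μ₇ ] 𝟙 (colour (z − b) ≟ᶠ ζ) * 𝟙 (colour (z − b′) ≟ᶠ ζ)

      agree? : ∀ b b′ z → Dec (z ≢ b × colour (z − b) ≡ colour (z − b′))
      agree? b b′ z = ¬? (z ≟ᶠ b) ×-dec (colour (z − b) ≟ᶠ colour (z − b′))

      agreement : ∀ b b′ z → (∑[ ζ ∈ μ₇ ] 𝟙 (colour (z − b) ≟ᶠ ζ) * 𝟙 (colour (z − b′) ≟ᶠ ζ)) ≡ 𝟙 (agree? b b′ z)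
      agreement b b′ z = begin
        (∑[ ζ ∈ μ₇ ] 𝟙 (colour (z − b) ≟ᶠ ζ) * 𝟙 (colour (z − b′) ≟ᶠ ζ))
          ≡⟨ ∑-cong μ₇ same ⟩
        (∑[ ζ ∈ μ₇ ] 𝟙 (colour (z − b) ≟ᶠ ζ) * 𝟙 (colour (z − b) ≟ᶠ colour (z − b′)))
          ≡⟨ ∑-*ʳ μ₇ (𝟙 (colour (z − b) ≟ᶠ colour (z − b′))) (λ ζ → 𝟙 (colour (z − b) ≟ᶠ ζ)) ⟩
        (∑[ ζ ∈ μ₇ ] 𝟙 (colour (z − b) ≟ᶠ ζ)) * 𝟙 (colour (z − b) ≟ᶠ colour (z − b′))
          ≡⟨ cong (_* 𝟙 (colour (z − b) ≟ᶠ colour (z − b′))) (trans (∑-colours (z − b)) (𝟙-⇔ (nonzero? (z − b)) (¬? (z ≟ᶠ b)) (λ ne e → ne (≡⇒−≡0 e)) −-≢0)) ⟩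
        𝟙 (¬? (z ≟ᶠ b)) * 𝟙 (colour (z − b) ≟ᶠ colour (z − b′))
          ≡⟨ 𝟙-× (¬? (z ≟ᶠ b)) (colour (z − b) ≟ᶠ colour (z − b′)) ⟨
        𝟙 (agree? b b′ z) ∎
        where
        open ≡-Reasoning
        same : ∀ ζ → 𝟙 (colour (z − b) ≟ᶠ ζ) * 𝟙 (colour (z − b′) ≟ᶠ ζ) ≡ 𝟙 (colour (z − b) ≟ᶠ ζ) * 𝟙 (colour (z − b) ≟ᶠ colour (z − b′))
        same ζ with colour (z − b) ≟ᶠ ζ
        ... | no _ = refl
        ... | yes refl = cong (1 *_) (𝟙-⇔ (colour (z − b′) ≟ᶠ colour (z − b)) (colour (z − b) ≟ᶠ colour (z − b′)) sym sym)

      ∑-≢ : ∀ b → (∑[ z ∈ elems ] 𝟙 (¬? (z ≟ᶠ b))) ≡ 14 * n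
      ∑-≢ b = trans (∑-cong elems (λ z → 𝟙-⇔ (¬? (z ≟ᶠ b)) (nonzero? (z − b)) −-≢0 (λ ne e → ne (≡⇒−≡0 e))))
        (trans (∑-elems-map (_− b) (_⊞ b) (λ z → solve 2 (λ z b → (z :- b) :+ b := z) refl z b) (λ z → solve 2 (λ z b → (z :+ b) :- b := z) refl z b) (𝟙 ∘ nonzero?))
          ∑-nonzero)

      agreements-same : ∀ b → agreements b b ≡ 14 * n
      agreements-same b = trans (∑-cong elems (λ z → trans (agreement b b z)
        (𝟙-⇔ (agree? b b z) (¬? (z ≟ᶠ b)) proj₁ (λ ne → ne , refl)))) (∑-≢ b)

      other? : ∀ t → Dec (t ≢ 1ᶠ × colour t ≡ 1ᶠ)
      other? t = ¬? (t ≟ᶠ 1ᶠ) ×-dec (colour t ≟ᶠ 1ᶠ)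

      ∑-other : suc (∑ elems (𝟙 ∘ other?)) ≡ 2 * n
      ∑-other = begin
        1 + ∑ elems (𝟙 ∘ other?)                                          ≡⟨ cong (_+ ∑ elems (𝟙 ∘ other?)) (∑-elems-≟ 1ᶠ) ⟨
        (∑[ t ∈ elems ] 𝟙 (1ᶠ ≟ᶠ t)) + ∑ elems (𝟙 ∘ other?)               ≡⟨ ∑-+ elems _ _ ⟨
        (∑[ t ∈ elems ] 𝟙 (1ᶠ ≟ᶠ t) + 𝟙 (other? t))                       ≡⟨ ∑-cong elems split ⟩
        classSize 1ᶠ                                                      ≡⟨ classSize≡2n (∈-filter⁺ μ₇? (elems-complete 1ᶠ) (^ᶠ-1 7)) ⟩
        2 * n                                                             ∎
        where
        open ≡-Reasoning
        split : ∀ t → 𝟙 (1ᶠ ≟ᶠ t) + 𝟙 (other? t) ≡ 𝟙 (colour t ≟ᶠ 1ᶠ)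
        split t with t ≟ᶠ 1ᶠ
        ... | yes refl = trans (cong (_+ 0) (𝟙-yes (1ᶠ ≟ᶠ 1ᶠ) refl)) (sym (𝟙-yes (colour 1ᶠ ≟ᶠ 1ᶠ) (^ᶠ-1 (2 * n))))
        ... | no ne = cong (_+ 𝟙 (colour t ≟ᶠ 1ᶠ)) (𝟙-no (1ᶠ ≟ᶠ t) (ne ∘ sym))

      agreements-different : ∀ {b b′} → b ≢ b′ → suc (agreements b b′) ≤ 2 * n
      agreements-different {b} {b′} b≢b′ = subst (suc (agreements b b′) ≤_) ∑-other (s≤s
        (subst (_≤ ∑ elems (𝟙 ∘ other?)) (sym (∑-cong elems (agreement b b′)))
          (∑𝟙-injection (agree? b b′) other? elems-unique ratio (λ {z} _ h → elems-complete _ , ratio-other z h) (λ {z} {w} _ _ h h′ → ratio-injective z w h h′))))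
        where
        ratio : A → A
        ratio z = (z − b) ⊠ inv (z − b′)
        denominator : ∀ z → z ≢ b × colour (z − b) ≡ colour (z − b′) → z − b′ ≢ 0ᶠ
        denominator z (ne , e) = colour≢0⇒≢0 (subst (_≢ 0ᶠ) e (colour-≢0 (−-≢0 ne)))
        cleared : ∀ z → z − b′ ≢ 0ᶠ → ratio z ⊠ (z − b′) ≡ z − b
        cleared z ne = trans (⊠-assoc _ _ _) (trans (cong ((z − b) ⊠_) (trans (⊠-comm _ _) (inverseʳ ne))) (⊠-identityʳ _))
        ratio≢1 : ∀ z → z − b′ ≢ 0ᶠ → ratio z ≢ 1ᶠ
        ratio≢1 z ne e = b≢b′ (trans (sym (solve 2 (λ z b → z :- (z :- b) := b) refl z b)) (trans (cong (z −_)
          (trans (sym (cleared z ne)) (trans (cong (_⊠ (z − b′)) e) (⊠-identityˡ _)))) (solve 2 (λ z b → z :- (z :- b) := b) refl z b′)))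
        ratio-other : ∀ z → z ≢ b × colour (z − b) ≡ colour (z − b′) → ratio z ≢ 1ᶠ × colour (ratio z) ≡ 1ᶠ
        ratio-other z h = ratio≢1 z (denominator z h) , ⊠-cancelˡ (colour-≢0 (denominator z h)) (begin
          colour (z − b′) ⊠ colour (ratio z)   ≡⟨ ⊠-comm _ _ ⟩
          colour (ratio z) ⊠ colour (z − b′)   ≡⟨ colour-⊠ _ _ ⟨
          colour (ratio z ⊠ (z − b′))          ≡⟨ cong colour (cleared z (denominator z h)) ⟩
          colour (z − b)                       ≡⟨ proj₂ h ⟩
          colour (z − b′)                      ≡⟨ ⊠-identityʳ _ ⟨
          colour (z − b′) ⊠ 1ᶠ                 ∎)
          where
          open ≡-Reasoning
        -- From t = (z − b)/(z − b′) one recovers z by (t − 1)(z − b′) = b′ − b.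
        ratio-injective : ∀ z w → z ≢ b × colour (z − b) ≡ colour (z − b′) → w ≢ b × colour (w − b) ≡ colour (w − b′) → ratio z ≡ ratio w → z ≡ w
        ratio-injective z w h h′ e = trans (sym (solve 2 (λ z b → (z :- b) :+ b := z) refl z b′)) (trans (cong (_⊞ b′)
            (⊠-cancelˡ (−-≢0 (ratio≢1 z (denominator z h))) (trans (recover z h) (sym (trans (cong (λ t → (t − 1ᶠ) ⊠ (w − b′)) e) (recover w h′))))))
            (solve 2 (λ z b → (z :- b) :+ b := z) refl w b′))
          where
          recover : ∀ z → z ≢ b × colour (z − b) ≡ colour (z − b′) → (ratio z − 1ᶠ) ⊠ (z − b′) ≡ b′ − b
          recover z h = trans (solve 3 (λ t o d → (t :- o) :* d := t :* d :- o :* d) refl (ratio z) 1ᶠ (z − b′))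
            (trans (cong₂ _−_ (cleared z (denominator z h)) (⊠-identityˡ _)) (solve 3 (λ z b b′ → (z :- b) :- (z :- b′) := b′ :- b) refl z b b′))

      ∑∑-neighbours : (∑[ z ∈ elems ] ∑[ ζ ∈ μ₇ ] neighbours ζ B z) ≡ m * (14 * n)
      ∑∑-neighbours = begin
        (∑[ z ∈ elems ] ∑[ ζ ∈ μ₇ ] ∑[ b ∈ B ] 𝟙 (colour (z − b) ≟ᶠ ζ))
          ≡⟨ ∑-cong elems (λ z → trans (∑-swap μ₇ B _) (∑-cong B (λ b → trans (∑-colours (z − b))
               (𝟙-⇔ (nonzero? (z − b)) (¬? (z ≟ᶠ b)) (λ ne e → ne (≡⇒−≡0 e)) −-≢0)))) ⟩
        (∑[ z ∈ elems ] ∑[ b ∈ B ] 𝟙 (¬? (z ≟ᶠ b)))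
          ≡⟨ ∑-swap elems B _ ⟩
        (∑[ b ∈ B ] ∑[ z ∈ elems ] 𝟙 (¬? (z ≟ᶠ b)))
          ≡⟨ trans (∑-cong B ∑-≢) (∑-const B (14 * n)) ⟩
        m * (14 * n) ∎
        where
        open ≡-Reasoning

      secondMoment : ℕ
      secondMoment = ∑[ z ∈ elems ] ∑[ ζ ∈ μ₇ ] neighbours ζ B z * neighbours ζ B z

      secondMoment-agreements : secondMoment ≡ (∑[ b ∈ B ] ∑[ b′ ∈ B ] agreements b b′)
      secondMoment-agreements = begin
        secondMoment
          ≡⟨ ∑-cong elems (λ z → ∑-cong μ₇ (λ ζ → trans (sym (∑-*ʳ B (neighbours ζ B z) _))
               (∑-cong B (λ b → sym (∑-*ˡ B (𝟙 (colour (z − b) ≟ᶠ ζ)) _))))) ⟩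
        (∑[ z ∈ elems ] ∑[ ζ ∈ μ₇ ] ∑[ b ∈ B ] ∑[ b′ ∈ B ] 𝟙 (colour (z − b) ≟ᶠ ζ) * 𝟙 (colour (z − b′) ≟ᶠ ζ))
          ≡⟨ ∑-cong elems (λ z → trans (∑-swap μ₇ B _) (∑-cong B (λ b → ∑-swap μ₇ B _))) ⟩
        (∑[ z ∈ elems ] ∑[ b ∈ B ] ∑[ b′ ∈ B ] ∑[ ζ ∈ μ₇ ] 𝟙 (colour (z − b) ≟ᶠ ζ) * 𝟙 (colour (z − b′) ≟ᶠ ζ))
          ≡⟨ trans (∑-swap elems B _) (∑-cong B (λ b → ∑-swap elems B _)) ⟩
        (∑[ b ∈ B ] ∑[ b′ ∈ B ] agreements b b′) ∎
        where
        open ≡-Reasoning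

      -- Distinct b, b′ agree at most 2n - 1 times, equal ones 14n = (2n - 1) + (12n + 1) times. The
      -- term m · m on the left carries the -1 of all m² ordered pairs.
      secondMoment-bound : secondMoment + m * m ≤ m * (m * (2 * n)) + m * (12 * n + 1)
      secondMoment-bound = begin
        secondMoment + m * m
          ≡⟨ cong₂ _+_ secondMoment-agreements (sym (trans (∑-cong B (λ _ → trans (∑-const B 1) (*-identityʳ m))) (∑-const B m))) ⟩
        (∑[ b ∈ B ] ∑[ b′ ∈ B ] agreements b b′) + (∑[ b ∈ B ] ∑[ b′ ∈ B ] 1)
          ≡⟨ trans (∑-cong B (λ b → ∑-+ B (agreements b) (λ _ → 1))) (∑-+ B _ _) ⟨
        (∑[ b ∈ B ] ∑[ b′ ∈ B ] agreements b b′ + 1)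
          ≤⟨ ∑-mono B (λ b → ∑-mono B (bound b)) ⟩
        (∑[ b ∈ B ] ∑[ b′ ∈ B ] 2 * n + 𝟙 (b ≟ᶠ b′) * (12 * n + 1))
          ≡⟨ trans (∑-cong B (λ b → ∑-+ B (λ _ → 2 * n) (λ b′ → 𝟙 (b ≟ᶠ b′) * (12 * n + 1)))) (∑-+ B _ _) ⟩
        (∑[ b ∈ B ] ∑[ b′ ∈ B ] 2 * n) + (∑[ b ∈ B ] ∑[ b′ ∈ B ] 𝟙 (b ≟ᶠ b′) * (12 * n + 1))
          ≡⟨ cong₂ _+_ (trans (∑-cong B (λ _ → ∑-const B (2 * n))) (∑-const B _))
               (trans (∑-cong-∈ B (λ {b} i → trans (∑-*ʳ B (12 * n + 1) (λ b′ → 𝟙 (b ≟ᶠ b′))) (trans (cong (_* (12 * n + 1)) (∑-≟ _≟ᶠ_ B-unique i)) (*-identityˡ _))))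
                 (∑-const B (12 * n + 1))) ⟩
        m * (m * (2 * n)) + m * (12 * n + 1) ∎
        where
        open ≤-Reasoning
        fourteen : 14 * n + 1 ≡ 2 * n + 1 * (12 * n + 1)
        fourteen = S.solve 1 (λ n → S.con 14 S.:* n S.:+ S.con 1 S.:= S.con 2 S.:* n S.:+ S.con 1 S.:* (S.con 12 S.:* n S.:+ S.con 1)) refl n
        bound : ∀ b b′ → agreements b b′ + 1 ≤ 2 * n + 𝟙 (b ≟ᶠ b′) * (12 * n + 1)
        bound b b′ with b ≟ᶠ b′
        ... | yes refl = ≤-reflexive (trans (cong (_+ 1) (agreements-same b)) fourteen)
        ... | no ne = subst₂ _≤_ (+-comm 1 _) (sym (+-identityʳ (2 * n))) (agreements-different ne)

      deviation : A → A → ℕ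
      deviation ζ z = ∣ 7 * neighbours ζ B z - m ∣ * ∣ 7 * neighbours ζ B z - m ∣

      totalDeviation : ℕ
      totalDeviation = ∑[ z ∈ elems ] ∑[ ζ ∈ μ₇ ] deviation ζ z

      -- Expansion of the squares (7N - m)² with the mixed term -14 m N moved to the left. The last
      -- product counts m² for each of the 7 (14n + 1) pairs of a point and a colour.
      deviation-identity : totalDeviation + 14 * m * (m * (14 * n)) ≡ 49 * secondMoment + (14 * n + 1) * (7 * (m * m))
      deviation-identity = begin
        totalDeviation + 14 * m * (m * (14 * n))
          ≡⟨ cong (totalDeviation +_) (trans (cong (14 * m *_) (sym ∑∑-neighbours)) (sym (trans (∑-cong elems (λ z → ∑-*ˡ μ₇ (14 * m) _)) (∑-*ˡ elems (14 * m) _)))) ⟩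
        totalDeviation + (∑[ z ∈ elems ] ∑[ ζ ∈ μ₇ ] 14 * m * neighbours ζ B z)
          ≡⟨ trans (∑-cong elems (λ z → ∑-+ μ₇ (λ ζ → deviation ζ z) _)) (∑-+ elems _ _) ⟨
        (∑[ z ∈ elems ] ∑[ ζ ∈ μ₇ ] deviation ζ z + 14 * m * neighbours ζ B z)
          ≡⟨ ∑-cong elems (λ z → ∑-cong μ₇ (λ ζ → pointwise (neighbours ζ B z) m)) ⟩
        (∑[ z ∈ elems ] ∑[ ζ ∈ μ₇ ] 49 * (neighbours ζ B z * neighbours ζ B z) + m * m)
          ≡⟨ trans (∑-cong elems (λ z → ∑-+ μ₇ (λ ζ → 49 * (neighbours ζ B z * neighbours ζ B z)) (λ _ → m * m))) (∑-+ elems _ _) ⟩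
        (∑[ z ∈ elems ] ∑[ ζ ∈ μ₇ ] 49 * (neighbours ζ B z * neighbours ζ B z)) + (∑[ z ∈ elems ] ∑[ ζ ∈ μ₇ ] m * m)
          ≡⟨ cong₂ _+_ (trans (∑-cong elems (λ z → ∑-*ˡ μ₇ 49 _)) (∑-*ˡ elems 49 _))
               (trans (∑-cong elems (λ _ → trans (∑-const μ₇ (m * m)) (cong (_* (m * m)) |μ₇|≡7)))
                 (trans (∑-const elems _) (cong (_* (7 * (m * m))) (trans elems-length q≡)))) ⟩
        49 * secondMoment + (14 * n + 1) * (7 * (m * m)) ∎
        where
        open ≡-Reasoning
        pointwise : ∀ N m → ∣ 7 * N - m ∣ * ∣ 7 * N - m ∣ + 14 * m * N ≡ 49 * (N * N) + m * m
        pointwise N m = trans (cong (∣ 7 * N - m ∣ * ∣ 7 * N - m ∣ +_) (rearrange N m)) (trans (∣-∣²-identity (7 * N) m) (cong (_+ m * m) (square N)))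
          where
          rearrange : ∀ N m → 14 * m * N ≡ 2 * (7 * N) * m
          rearrange = S.solve 2 (λ N m → S.con 14 S.:* m S.:* N S.:= S.con 2 S.:* (S.con 7 S.:* N) S.:* m) refl
          square : ∀ N → 7 * N * (7 * N) ≡ 49 * (N * N)
          square = S.solve 1 (λ N → S.con 7 S.:* N S.:* (S.con 7 S.:* N) S.:= S.con 49 S.:* (N S.:* N)) refl

      -- The terms in n m² cancel, since 49 · 2 + 7 · 14 = 14 · 14. What remains in m² has
      -- coefficient -49 + 7 = -42 and is dropped, and 49 m is absorbed into n m.
      totalDeviation-bound : totalDeviation ≤ 589 * n * m
      totalDeviation-bound = ≤-trans (+-cancelʳ-≤ rest totalDeviation (49 * (m * (12 * n + 1))) (begin
          totalDeviation + rest
            ≡⟨ regroup₁ totalDeviation m n ⟩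
          (totalDeviation + 14 * m * (m * (14 * n))) + 49 * (m * m)
            ≡⟨ cong (_+ 49 * (m * m)) deviation-identity ⟩
          (49 * secondMoment + (14 * n + 1) * (7 * (m * m))) + 49 * (m * m)
            ≡⟨ regroup₂ secondMoment m n ⟩
          49 * (secondMoment + m * m) + (14 * n + 1) * (7 * (m * m))
            ≤⟨ +-monoˡ-≤ _ (*-monoʳ-≤ 49 secondMoment-bound) ⟩
          49 * (m * (m * (2 * n)) + m * (12 * n + 1)) + (14 * n + 1) * (7 * (m * m))
            ≤⟨ m≤m+n _ (42 * (m * m)) ⟩
          49 * (m * (m * (2 * n)) + m * (12 * n + 1)) + (14 * n + 1) * (7 * (m * m)) + 42 * (m * m)
            ≡⟨ regroup₃ m n ⟩
          49 * (m * (12 * n + 1)) + rest ∎))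
        (begin
          49 * (m * (12 * n + 1))   ≡⟨ regroup₄ m n ⟩
          588 * n * m + 49 * m      ≤⟨ +-monoʳ-≤ (588 * n * m) (*-monoˡ-≤ m 49≤n) ⟩
          588 * n * m + n * m       ≡⟨ regroup₅ m n ⟩
          589 * n * m               ∎)
        where
        open ≤-Reasoning
        rest : ℕ
        rest = 14 * m * (m * (14 * n)) + 49 * (m * m)
        regroup₁ : ∀ t m n → t + (14 * m * (m * (14 * n)) + 49 * (m * m)) ≡ t + 14 * m * (m * (14 * n)) + 49 * (m * m)
        regroup₁ t m n = sym (+-assoc t _ _)
        regroup₂ : ∀ s m n → 49 * s + (14 * n + 1) * (7 * (m * m)) + 49 * (m * m) ≡ 49 * (s + m * m) + (14 * n + 1) * (7 * (m * m))
        regroup₂ = S.solve 3 (λ s m n → S.con 49 S.:* s S.:+ (S.con 14 S.:* n S.:+ S.con 1) S.:* (S.con 7 S.:* (m S.:* m)) S.:+ S.con 49 S.:* (m S.:* m)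
          S.:= S.con 49 S.:* (s S.:+ m S.:* m) S.:+ (S.con 14 S.:* n S.:+ S.con 1) S.:* (S.con 7 S.:* (m S.:* m))) refl
        regroup₃ : ∀ m n → 49 * (m * (m * (2 * n)) + m * (12 * n + 1)) + (14 * n + 1) * (7 * (m * m)) + 42 * (m * m)
          ≡ 49 * (m * (12 * n + 1)) + (14 * m * (m * (14 * n)) + 49 * (m * m))
        regroup₃ = S.solve 2 (λ m n → S.con 49 S.:* (m S.:* (m S.:* (S.con 2 S.:* n)) S.:+ m S.:* (S.con 12 S.:* n S.:+ S.con 1)) S.:+ (S.con 14 S.:* n S.:+ S.con 1) S.:* (S.con 7 S.:* (m S.:* m)) S.:+ S.con 42 S.:* (m S.:* m)
          S.:= S.con 49 S.:* (m S.:* (S.con 12 S.:* n S.:+ S.con 1)) S.:+ (S.con 14 S.:* m S.:* (m S.:* (S.con 14 S.:* n)) S.:+ S.con 49 S.:* (m S.:* m))) refl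
        regroup₄ : ∀ m n → 49 * (m * (12 * n + 1)) ≡ 588 * n * m + 49 * m
        regroup₄ = S.solve 2 (λ m n → S.con 49 S.:* (m S.:* (S.con 12 S.:* n S.:+ S.con 1)) S.:= S.con 588 S.:* n S.:* m S.:+ S.con 49 S.:* m) refl
        regroup₅ : ∀ m n → 588 * n * m + n * m ≡ 589 * n * m
        regroup₅ = S.solve 2 (λ m n → S.con 588 S.:* n S.:* m S.:+ n S.:* m S.:= S.con 589 S.:* n S.:* m) refl

  -- z is bad for (B , c) when it has less than (1 − r/s)|B|/7 neighbours of colour c in B.
  Bad : ℕ → ℕ → List A × A → A → Set
  Bad r s (B , c) z = s * (7 * neighbours c B z) + r * length B < s * length B

  bad? : ∀ r s B z → Dec (Bad r s B z)
  bad? r s (B , c) z = _ <? _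

  -- Chebyshev's inequality: a bad z has deviation at least (r m / s)² in the colour c alone. Since
  -- the total deviation is linear in m, one factor m survives, and large sets have few bad points.
  badCount : ∀ r s {B c} → Unique B → c ∈ μ₇ → (∑[ z ∈ elems ] 𝟙 (bad? r s (B , c) z)) * (r * r * length B) ≤ s * s * (589 * n)
  badCount r s {[]} {c} u c∈ = ≤-trans (≤-reflexive (trans (cong (count *_) (*-zeroʳ (r * r))) (*-zeroʳ count))) z≤n
    where
    count : ℕ
    count = ∑[ z ∈ elems ] 𝟙 (bad? r s ([] , c) z)
  badCount r s {B@(_ ∷ _)} {c} u c∈ = *-cancelʳ-≤ _ _ m (begin
    (∑[ z ∈ elems ] 𝟙 (bad? r s (B , c) z)) * (r * r * m) * m
      ≡⟨ trans (*-assoc (∑[ z ∈ elems ] 𝟙 (bad? r s (B , c) z)) _ m) (sym (∑-*ʳ elems (r * r * m * m) (λ z → 𝟙 (bad? r s (B , c) z)))) ⟩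
    (∑[ z ∈ elems ] 𝟙 (bad? r s (B , c) z) * (r * r * m * m))
      ≤⟨ ∑-mono elems pointwise ⟩
    (∑[ z ∈ elems ] s * s * deviation c z)
      ≤⟨ ∑-mono elems (λ z → *-monoʳ-≤ (s * s) (∑-∈ (λ ζ → deviation ζ z) c∈)) ⟩
    (∑[ z ∈ elems ] s * s * (∑[ ζ ∈ μ₇ ] deviation ζ z))
      ≡⟨ ∑-*ˡ elems (s * s) _ ⟩
    s * s * totalDeviation
      ≤⟨ *-monoʳ-≤ (s * s) totalDeviation-bound ⟩
    s * s * (589 * n * m)
      ≡⟨ *-assoc (s * s) (589 * n) m ⟨
    s * s * (589 * n) * m ∎)
    where
    open ≤-Reasoning
    open Moments B u
    pointwise : ∀ z → 𝟙 (bad? r s (B , c) z) * (r * r * m * m) ≤ s * s * deviation c z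
    pointwise z = aux (bad? r s (B , c) z)
      where
      aux : (d : Dec (Bad r s (B , c) z)) → 𝟙 d * (r * r * m * m) ≤ s * s * deviation c z
      aux (no _) = z≤n
      aux (yes bad) = subst₂ _≤_ (square r m) (square′ s ∣ 7 * N - m ∣) (*-mono-≤ far far)
        where
        N : ℕ
        N = neighbours c B z
        far : r * m ≤ s * ∣ 7 * N - m ∣
        far = begin
          r * m                          ≡⟨ m+n∸m≡n (s * (7 * N)) (r * m) ⟨
          s * (7 * N) + r * m ∸ s * (7 * N)  ≤⟨ ∸-monoˡ-≤ (s * (7 * N)) (<⇒≤ bad) ⟩
          s * m ∸ s * (7 * N)            ≡⟨ *-distribˡ-∸ s m (7 * N) ⟨
          s * (m ∸ 7 * N)                ≤⟨ *-monoʳ-≤ s (m∸n≤∣m-n∣ m (7 * N)) ⟩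
          s * ∣ m - 7 * N ∣              ≡⟨ cong (s *_) (∣-∣-comm m (7 * N)) ⟩
          s * ∣ 7 * N - m ∣              ∎
        square : ∀ r m → r * m * (r * m) ≡ 1 * (r * r * m * m)
        square = S.solve 2 (λ r m → r S.:* m S.:* (r S.:* m) S.:= S.con 1 S.:* (r S.:* r S.:* m S.:* m)) refl
        square′ : ∀ s d → s * d * (s * d) ≡ s * s * (d * d)
        square′ = S.solve 2 (λ s d → s S.:* d S.:* (s S.:* d) S.:= s S.:* s S.:* (d S.:* d)) refl

  -- Sizes are measured against n as |B| ≥ n L / K, so that each choice reduces to a comparison of
  -- numerals with `threshold`.
  Target : ℕ → ℕ → List A × A → Set
  Target K L (B , c) = Unique B × c ∈ μ₇ × n * L ≤ length B * K

  -- Union bound: by `badCount` a target with |B| ≥ n L / K has at most 589 s² K / (r² L) bad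
  -- points, and the hypothesis says that those of all targets together are fewer than n L′ / K.
  select : ∀ r s K L L′ {C} → Unique C → n * L′ ≤ length C * K →
    ∀ {ts} → All (Target K L) ts → length ts * (s * s * 589) * (K * K) < n * (r * r * (L * L′)) →
    ∃[ z ] (z ∈ C × All (λ t → ¬ Bad r s t z) ts)
  select r s K L L′ {C} C-unique nL′≤ {ts} targets small with Any.any? (λ z → All.all? (λ t → ¬? (bad? r s t z)) ts) C
  ... | yes found = find found
  ... | no none = ⊥-elim (<⇒≱ small (*-cancelʳ-≤ _ _ n {{>-nonZero 1≤n}} (begin
      n * (r * r * (L * L′)) * n
        ≡⟨ regroup₁ r L L′ n ⟩
      r * r * (L * n) * (L′ * n)
        ≤⟨ *-monoʳ-≤ (r * r * (L * n)) (≤-trans (commuted {L′} {K} {length C} nL′≤) (*-monoʳ-≤ K coverage)) ⟩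
      r * r * (L * n) * (K * (∑[ t ∈ ts ] bads t))
        ≡⟨ regroup₂ (r * r * (L * n)) K _ ⟩
      K * ((∑[ t ∈ ts ] bads t) * (r * r * (L * n)))
        ≡⟨ cong (K *_) (sym (∑-*ʳ ts (r * r * (L * n)) bads)) ⟩
      K * (∑[ t ∈ ts ] bads t * (r * r * (L * n)))
        ≤⟨ *-monoʳ-≤ K (∑-mono-∈ ts each) ⟩
      K * (∑[ t ∈ ts ] K * (s * s * (589 * n)))
        ≡⟨ cong (K *_) (∑-const ts (K * (s * s * (589 * n)))) ⟩
      K * (length ts * (K * (s * s * (589 * n))))
        ≡⟨ regroup₃ K (length ts) s n ⟩
      length ts * (s * s * 589) * (K * K) * n ∎)))
    where
    open ≤-Reasoning
    commuted : ∀ {L K m} → n * L ≤ m * K → L * n ≤ K * m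
    commuted {L} {K} {m} = subst₂ _≤_ (*-comm n L) (*-comm m K)
    bads : List A × A → ℕ
    bads t = ∑[ z ∈ elems ] 𝟙 (bad? r s t z)
    each : ∀ {t} → t ∈ ts → bads t * (r * r * (L * n)) ≤ K * (s * s * (589 * n))
    each {t@(B , c)} i = let u , c∈ , L≤ = All.lookup targets i in begin
      bads t * (r * r * (L * n))             ≤⟨ *-monoʳ-≤ (bads t) (*-monoʳ-≤ (r * r) (commuted {L} {K} {length B} L≤)) ⟩
      bads t * (r * r * (K * length B))      ≡⟨ regroup₄ (bads t) r K (length B) ⟩
      K * (bads t * (r * r * length B))      ≤⟨ *-monoʳ-≤ K (badCount r s u c∈) ⟩
      K * (s * s * (589 * n))                ∎
      where
      regroup₄ : ∀ b r K m → b * (r * r * (K * m)) ≡ K * (b * (r * r * m))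
      regroup₄ = S.solve 4 (λ b r K m → b S.:* (r S.:* r S.:* (K S.:* m)) S.:= K S.:* (b S.:* (r S.:* r S.:* m))) refl
    coverage : length C ≤ (∑[ t ∈ ts ] bads t)
    coverage = begin
      length C                                            ≡⟨ trans (∑-const C 1) (*-identityʳ _) ⟨
      (∑[ z ∈ C ] 1)                                      ≤⟨ ∑-mono-∈ C hit ⟩
      (∑[ z ∈ C ] ∑[ t ∈ ts ] 𝟙 (bad? r s t z))           ≡⟨ ∑-swap C ts _ ⟩
      (∑[ t ∈ ts ] ∑[ z ∈ C ] 𝟙 (bad? r s t z))           ≤⟨ ∑-mono ts (λ t → ∑𝟙-injection (bad? r s t) (bad? r s t) C-unique id (λ _ b → elems-complete _ , b) (λ _ _ _ _ e → e)) ⟩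
      (∑[ t ∈ ts ] bads t)                                ∎
      where
      hit : ∀ {z} → z ∈ C → 1 ≤ (∑[ t ∈ ts ] 𝟙 (bad? r s t z))
      hit {z} i with All.all? (λ t → ¬? (bad? r s t z)) ts
      ... | yes all = ⊥-elim (none (lose i all))
      ... | no ¬all = let t , j , ¬¬b = find (Allₚ.¬All⇒Any¬ (λ t → ¬? (bad? r s t z)) ts ¬all) in
        ≤-trans (≤-reflexive (sym (𝟙-yes (bad? r s t z) (decidable-stable (bad? r s t z) ¬¬b)))) (∑-∈ (λ t → 𝟙 (bad? r s t z)) j)
    regroup₁ : ∀ r L L′ n → n * (r * r * (L * L′)) * n ≡ r * r * (L * n) * (L′ * n)
    regroup₁ = S.solve 4 (λ r L L′ n → n S.:* (r S.:* r S.:* (L S.:* L′)) S.:* n S.:= r S.:* r S.:* (L S.:* n) S.:* (L′ S.:* n)) refl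
    regroup₂ : ∀ a K b → a * (K * b) ≡ K * (b * a)
    regroup₂ = S.solve 3 (λ a K b → a S.:* (K S.:* b) S.:= K S.:* (b S.:* a)) refl
    regroup₃ : ∀ K l s n → K * (l * (K * (s * s * (589 * n)))) ≡ l * (s * s * 589) * (K * K) * n
    regroup₃ = S.solve 4 (λ K l s n → K S.:* (l S.:* (K S.:* (s S.:* s S.:* (S.con 589 S.:* n)))) S.:= l S.:* (s S.:* s S.:* S.con 589) S.:* (K S.:* K) S.:* n) refl

  refine : A → A → List A → List A
  refine z c B = filter (λ b → colour (z − b) ≟ᶠ c) B

  refine-unique : ∀ z c {B} → Unique B → Unique (refine z c B)
  refine-unique z c = Uniqueₚ.filter⁺ (λ b → colour (z − b) ≟ᶠ c)

  ∈-refine⁻ : ∀ z c {B b} → b ∈ refine z c B → b ∈ B × colour (z − b) ≡ c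
  ∈-refine⁻ z c {B} i = ∈-filter⁻ (λ b → colour (z − b) ≟ᶠ c) {xs = B} i

  -- With s = t + r, a point that is not bad keeps at least the share t / (t + r) of the expected
  -- |B| / 7 neighbours, so L / K becomes t L / (7 (t + r) K).
  refine-length : ∀ t r K L {B c z} → n * L ≤ length B * K → ¬ Bad r (t + r) (B , c) z →
    n * (t * L) ≤ length (refine z c B) * (7 * (t + r) * K)
  refine-length t r K L {B} {c} {z} L≤ ¬bad = begin
    n * (t * L)                             ≡⟨ S.solve 3 (λ n t L → n S.:* (t S.:* L) S.:= t S.:* (n S.:* L)) refl n t L ⟩
    t * (n * L)                             ≤⟨ *-monoʳ-≤ t L≤ ⟩
    t * (length B * K)                      ≡⟨ *-assoc t (length B) K ⟨
    t * length B * K                        ≤⟨ *-monoˡ-≤ K (+-cancelʳ-≤ (r * length B) _ _ (begin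
      t * length B + r * length B           ≡⟨ *-distribʳ-+ (length B) t r ⟨
      (t + r) * length B                    ≤⟨ ≮⇒≥ ¬bad ⟩
      (t + r) * (7 * neighbours c B z) + r * length B ∎)) ⟩
    (t + r) * (7 * neighbours c B z) * K    ≡⟨ S.solve 3 (λ K s N → s S.:* (S.con 7 S.:* N) S.:* K S.:= N S.:* (S.con 7 S.:* s S.:* K)) refl K (t + r) (neighbours c B z) ⟩
    neighbours c B z * (7 * (t + r) * K)    ≡⟨ cong (_* (7 * (t + r) * K)) (length-filter-∑ (λ b → colour (z − b) ≟ᶠ c) B) ⟨
    length (refine z c B) * (7 * (t + r) * K) ∎
    where
    open ≤-Reasoning

  abstract

    -- The numbering of the colours is arbitrary, because the patterns only have to translate
    -- distinct numbers into distinct colours.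
    ζ : Fin 7 → A
    ζ i = L.lookup μ₇ (subst Fin (sym |μ₇|≡7) i)

    ζ-∈μ₇ : ∀ i → ζ i ∈ μ₇
    ζ-∈μ₇ i = ∈-lookup (subst Fin (sym |μ₇|≡7) i)

    ζ-injective : ∀ {i j} → ζ i ≡ ζ j → i ≡ j
    ζ-injective e = subst-injective (sym |μ₇|≡7) (Unique-lookup-injective μ₇-unique _ _ e)

-- The colours required from a vertex towards 0, z₁, z₂, z₃, z₄.
Profile : Set
Profile = Vec (Fin 7) 5

pattern κ₀ = fzero
pattern κ₁ = fsuc κ₀
pattern κ₂ = fsuc κ₁
pattern κ₃ = fsuc κ₂
pattern κ₄ = fsuc κ₃
pattern κ₅ = fsuc κ₄
pattern κ₆ = fsuc κ₅

0ᵢ 1ᵢ 2ᵢ 3ᵢ 4ᵢ : Fin 5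
0ᵢ = fzero
1ᵢ = fsuc fzero
2ᵢ = fsuc (fsuc fzero)
3ᵢ = fsuc (fsuc (fsuc fzero))
4ᵢ = fsuc (fsuc (fsuc (fsuc fzero)))

-- The colours of the differences −x − z₁, −x − z₂, −x − z₃, which carry the same label, may be permuted, and so may those of y₁ − z₁, y₁ − z₄.
xProfiles yProfiles : List Profile
xProfiles = (κ₀ ∷ κ₅ ∷ κ₆ ∷ κ₁ ∷ κ₂ ∷ []) ∷ (κ₀ ∷ κ₅ ∷ κ₁ ∷ κ₆ ∷ κ₂ ∷ []) ∷ (κ₀ ∷ κ₆ ∷ κ₅ ∷ κ₁ ∷ κ₂ ∷ []) ∷ (κ₀ ∷ κ₆ ∷ κ₁ ∷ κ₅ ∷ κ₂ ∷ []) ∷ (κ₀ ∷ κ₁ ∷ κ₅ ∷ κ₆ ∷ κ₂ ∷ []) ∷ (κ₀ ∷ κ₁ ∷ κ₆ ∷ κ₅ ∷ κ₂ ∷ []) ∷ []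
yProfiles = (κ₁ ∷ κ₄ ∷ κ₆ ∷ κ₆ ∷ κ₃ ∷ []) ∷ (κ₁ ∷ κ₃ ∷ κ₆ ∷ κ₆ ∷ κ₄ ∷ []) ∷ []

-- The zᵢ are chosen in order, so their profiles prescribe colours towards 0 and the earlier z; the
-- remaining entries are padded with κ₀.
z₁Profile z₂Profile z₃Profile z₄Profile y₂Profile : Profile
z₁Profile = κ₃ ∷ κ₀ ∷ κ₀ ∷ κ₀ ∷ κ₀ ∷ []
z₂Profile = κ₄ ∷ κ₀ ∷ κ₀ ∷ κ₀ ∷ κ₀ ∷ []
z₃Profile = κ₅ ∷ κ₅ ∷ κ₃ ∷ κ₀ ∷ κ₀ ∷ []
z₄Profile = κ₆ ∷ κ₁ ∷ κ₂ ∷ κ₀ ∷ κ₀ ∷ []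
y₂Profile = κ₂ ∷ κ₁ ∷ κ₅ ∷ κ₂ ∷ κ₄ ∷ []

-- The bound Q(7,6) enters only through n ≥ threshold.
threshold : ℕ
threshold = 16968761372

-- The vertex order is x, y₁, y₂, z₁, …, z₄; the list of edges follows the pairs in the blocks {x, y₁, y₂}, {−x, z₁, …, z₄} and {−y₁, −y₂, −z₁, …, −z₄}.
vertexPattern : Profile → Profile → List (Fin 7)
vertexPattern (a ∷ _) (b ∷ _) = a ∷ b ∷ κ₂ ∷ κ₃ ∷ κ₄ ∷ κ₅ ∷ κ₆ ∷ []

edgePattern : Profile → Profile → List (Fin 7)
edgePattern (_ ∷ a₁ ∷ a₂ ∷ a₃ ∷ a₄ ∷ []) (_ ∷ b₁ ∷ b₂ ∷ b₃ ∷ b₄ ∷ []) =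
  κ₃ ∷ κ₆ ∷ κ₄ ∷ a₁ ∷ a₂ ∷ a₃ ∷ a₄ ∷ κ₀ ∷ κ₅ ∷ κ₁ ∷ κ₃ ∷ κ₂ ∷ κ₀ ∷
  κ₄ ∷ b₁ ∷ b₂ ∷ b₃ ∷ b₄ ∷ κ₁ ∷ κ₅ ∷ κ₂ ∷ κ₄ ∷ κ₀ ∷ κ₅ ∷ κ₁ ∷ κ₃ ∷ κ₂ ∷ κ₀ ∷ []

edges : ∀ {A : Set} → (A → A → A) → (A → A) → (x y₁ y₂ z₁ z₂ z₃ z₄ : A) → List A
edges _⊞_ ⊟_ x y₁ y₂ z₁ z₂ z₃ z₄ =
  (y₁ − x) ∷ (y₂ − x) ∷ (y₂ − y₁) ∷
  (x ⊞ z₁) ∷ (x ⊞ z₂) ∷ (x ⊞ z₃) ∷ (x ⊞ z₄) ∷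
  (z₁ − z₂) ∷ (z₁ − z₃) ∷ (z₁ − z₄) ∷ (z₂ − z₃) ∷ (z₂ − z₄) ∷ (z₃ − z₄) ∷
  (y₂ − y₁) ∷ (z₁ − y₁) ∷ (z₂ − y₁) ∷ (z₃ − y₁) ∷ (z₄ − y₁) ∷
  (z₁ − y₂) ∷ (z₂ − y₂) ∷ (z₃ − y₂) ∷ (z₄ − y₂) ∷
  (z₁ − z₂) ∷ (z₁ − z₃) ∷ (z₁ − z₄) ∷ (z₂ − z₃) ∷ (z₂ − z₄) ∷ (z₃ − z₄) ∷ []
  where
  _−_ : _ → _ → _
  u − v = u ⊞ (⊟ v)

-- Greedy choice of the seven points for large n.

module LargeField {A : Set} {_⊞_ _⊠_ : A → A → A} {⊟_ : A → A} {0ᶠ 1ᶠ : A} {q : ℕ}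
  (D : IsFiniteDomain _⊞_ _⊠_ ⊟_ 0ᶠ 1ᶠ q) (n : ℕ) (1≤n : 1 ≤ n) (q≡ : q ≡ 14 * n + 1) (big : threshold ≤ n) where

  private
    49≤n : 49 ≤ n
    49≤n = ≤-trans (<ᵇ⇒< 48 threshold tt) big

    below : ∀ a b → T (a <ᵇ threshold * b) → a < n * b
    below a b h = <-≤-trans (<ᵇ⇒< a (threshold * b) h) (*-monoˡ-≤ b big)

  open Colours D n 1≤n q≡
  open Pseudorandom D n 1≤n q≡ 49≤n public

  private
    candidates₀ : Profile → List A
    candidates₀ π = filter (λ b → colour b ≟ᶠ ζ (V.lookup π 0ᵢ)) elems

    candidates₀-unique : ∀ π → Unique (candidates₀ π)
    candidates₀-unique π = Uniqueₚ.filter⁺ (λ b → colour b ≟ᶠ ζ (V.lookup π 0ᵢ)) elems-unique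

    candidates₀-length : ∀ π → n * 2 ≤ length (candidates₀ π) * 1
    candidates₀-length π = ≤-reflexive (trans (*-comm n 2) (trans (sym (classSize≡2n (ζ-∈μ₇ (V.lookup π 0ᵢ))))
      (trans (sym (length-filter-∑ (λ b → colour b ≟ᶠ ζ (V.lookup π 0ᵢ)) elems)) (sym (*-identityʳ _)))))

    extend : Fin 5 → A → (Profile → List A) → Profile → List A
    extend i z f π = refine z (ζ (V.lookup π i)) (f π)

    extend-unique : ∀ i z f → (∀ π → Unique (f π)) → ∀ π → Unique (extend i z f π)
    extend-unique i z f u π = refine-unique z (ζ (V.lookup π i)) (u π)

    Ample : ℕ → ℕ → (Profile → List A) → Profile → Set
    Ample K L f π = n * L ≤ length (f π) * K

    -- One greedy step: z is taken from the candidates of its own profile π₀ and has to be good for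
    -- all later profiles Π, whose size bounds drop by the factor 7 (t + r) / t.
    choose : ∀ f i t r K L → (∀ π → Unique (f π)) → ∀ π₀ Π → Ample K L f π₀ → All (Ample K L f) Π →
      length Π * ((t + r) * (t + r) * 589) * (K * K) < n * (r * r * (L * L)) →
      ∃[ z ] (z ∈ f π₀ × All (Ample (7 * (t + r) * K) (t * L) (extend i z f)) Π)
    choose f i t r K L u π₀ Π a₀ as small =
      let z , z∈ , good = select r (t + r) K L L (u π₀) a₀ {map target Π}
            (Allₚ.map⁺ (All.map (λ {π} a → u π , ζ-∈μ₇ (V.lookup π i) , a) as))
            (subst (λ l → l * ((t + r) * (t + r) * 589) * (K * K) < n * (r * r * (L * L))) (sym (Lₚ.length-map target Π)) small)
      in z , z∈ , All.zipWith (λ {π} (a , g) → refine-length t r K L {f π} {ζ (V.lookup π i)} {z} a g) (as , Allₚ.map⁻ good)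
      where
      target : Profile → List A × A
      target π = f π , ζ (V.lookup π i)

    Π₄ Π₃ Π₂ Π₁ : List Profile
    Π₄ = y₂Profile ∷ xProfiles ++ yProfiles
    Π₃ = z₄Profile ∷ Π₄
    Π₂ = z₃Profile ∷ Π₃
    Π₁ = z₂Profile ∷ Π₂

    ∑-ample : ∀ {K L f} Π → All (Ample K L f) Π → n * (length Π * L) ≤ length (concatMap f Π) * K
    ∑-ample {K} {L} [] [] = ≤-reflexive (*-zeroʳ n)
    ∑-ample {K} {L} {f} (π ∷ Π) (a ∷ as) = begin
      n * (L + length Π * L)                    ≡⟨ *-distribˡ-+ n L _ ⟩
      n * L + n * (length Π * L)                ≤⟨ +-mono-≤ a (∑-ample {K} {L} {f} Π as) ⟩
      length (f π) * K + length (concatMap f Π) * K  ≡⟨ *-distribʳ-+ K (length (f π)) _ ⟨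
      (length (f π) + length (concatMap f Π)) * K    ≡⟨ cong (_* K) (Lₚ.length-++ (f π)) ⟨
      length (concatMap f (π ∷ Π)) * K          ∎
      where
      open ≤-Reasoning

  record Configuration : Set where
    field
      x y₁ y₂ z₁ z₂ z₃ z₄ : A
      πˣ πʸ : Profile
      πˣ∈ : πˣ ∈ xProfiles
      πʸ∈ : πʸ ∈ yProfiles
      vertexColours : map colour (x ∷ y₁ ∷ y₂ ∷ z₁ ∷ z₂ ∷ z₃ ∷ z₄ ∷ []) ≡ map ζ (vertexPattern πˣ πʸ)
      edgeColours : map colour (edges _⊞_ ⊟_ x y₁ y₂ z₁ z₂ z₃ z₄) ≡ map ζ (edgePattern πˣ πʸ)

  private
    sees : (z₁ z₂ z₃ z₄ b : A) → Vec A 5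
    sees z₁ z₂ z₃ z₄ b = colour b ∷ colour (z₁ − b) ∷ colour (z₂ − b) ∷ colour (z₃ − b) ∷ colour (z₄ − b) ∷ []

    candidates₄ : (z₁ z₂ z₃ z₄ : A) → Profile → List A
    candidates₄ z₁ z₂ z₃ z₄ = extend 4ᵢ z₄ (extend 3ᵢ z₃ (extend 2ᵢ z₂ (extend 1ᵢ z₁ candidates₀)))

    ∈-candidates₀ : ∀ {π b} → b ∈ candidates₀ π → colour b ≡ ζ (V.lookup π 0ᵢ)
    ∈-candidates₀ {π} i = proj₂ (∈-filter⁻ (λ b → colour b ≟ᶠ ζ (V.lookup π 0ᵢ)) {xs = elems} i)

    ∈-extend : ∀ j z f π {b} → b ∈ extend j z f π → b ∈ f π × colour (z − b) ≡ ζ (V.lookup π j)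
    ∈-extend j z f π i = ∈-refine⁻ z (ζ (V.lookup π j)) {f π} i

    ∈-candidates₄ : ∀ {z₁ z₂ z₃ z₄ π b} → b ∈ candidates₄ z₁ z₂ z₃ z₄ π → sees z₁ z₂ z₃ z₄ b ≡ V.map ζ π
    ∈-candidates₄ {z₁} {z₂} {z₃} {z₄} {π@(_ ∷ _ ∷ _ ∷ _ ∷ _ ∷ [])} i =
      let i₃ , e₄ = ∈-extend 4ᵢ z₄ (extend 3ᵢ z₃ (extend 2ᵢ z₂ (extend 1ᵢ z₁ candidates₀))) π i
          i₂ , e₃ = ∈-extend 3ᵢ z₃ (extend 2ᵢ z₂ (extend 1ᵢ z₁ candidates₀)) π i₃
          i₁ , e₂ = ∈-extend 2ᵢ z₂ (extend 1ᵢ z₁ candidates₀) π i₂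
          i₀ , e₁ = ∈-extend 1ᵢ z₁ candidates₀ π i₁
      in cong₂ _∷_ (∈-candidates₀ {π} i₀) (cong₂ _∷_ e₁ (cong₂ _∷_ e₂ (cong₂ _∷_ e₃ (cong₂ _∷_ e₄ refl))))

    candidates₄-unique : ∀ z₁ z₂ z₃ z₄ π → Unique (candidates₄ z₁ z₂ z₃ z₄ π)
    candidates₄-unique z₁ z₂ z₃ z₄ = extend-unique 4ᵢ z₄ _ (extend-unique 3ᵢ z₃ _ (extend-unique 2ᵢ z₂ _ (extend-unique 1ᵢ z₁ _ candidates₀-unique)))

    map-ζ-injective : ∀ {m} {u v : Vec (Fin 7) m} → V.map ζ u ≡ V.map ζ v → u ≡ v
    map-ζ-injective {u = []} {[]} e = refl
    map-ζ-injective {u = _ ∷ _} {_ ∷ _} e = cong₂ _∷_ (ζ-injective (cong V.head e)) (map-ζ-injective (cong V.tail e))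

    -- A candidate determines its profile because ζ is injective. So the sets for different profiles
    -- are disjoint and their sizes add up, which is the gain of 6 for x and of 2 for y₁.
    union-unique : ∀ z₁ z₂ z₃ z₄ {Π} → Unique Π → Unique (concatMap (candidates₄ z₁ z₂ z₃ z₄) Π)
    union-unique z₁ z₂ z₃ z₄ {Π} u = Uniqueₚ.concat⁺ (Allₚ.map⁺ (All.tabulate (λ {π} _ → candidates₄-unique z₁ z₂ z₃ z₄ π)))
      (AllPairsₚ.map⁺ (AllPairs.map disjoint u))
      where
      disjoint : ∀ {π π′} → π ≢ π′ → Disjoint (candidates₄ z₁ z₂ z₃ z₄ π) (candidates₄ z₁ z₂ z₃ z₄ π′)
      disjoint {π} {π′} ne (i , j) = ne (map-ζ-injective (trans (sym (∈-candidates₄ {π = π} i)) (∈-candidates₄ {π = π′} j)))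

    nonempty : ∀ {B : List A} → 1 ≤ length B → ∃[ b ] b ∈ B
    nonempty {b ∷ _} _ = b , here refl

    opposite : ∀ {x x′} z {c} → x ≡ ⊟ x′ → colour (z − x′) ≡ c → colour (x ⊞ z) ≡ c
    opposite {x} z x≡ e = trans (cong colour (trans (⊞-comm x z) (cong (z ⊞_) x≡))) e

    infixr 5 _∷≡_
    _∷≡_ : ∀ {b c : A} {bs cs : List A} → b ≡ c → bs ≡ cs → _≡_ {A = List A} (b ∷ bs) (c ∷ cs)
    e ∷≡ es = cong₂ _∷_ e es

    at : ∀ i {u v : Vec A 5} → u ≡ v → V.lookup u i ≡ V.lookup v i
    at i e = cong (λ u → V.lookup u i) e

    ∈-candidates₁ : ∀ {z₁ π b} → b ∈ extend 1ᵢ z₁ candidates₀ π → colour b ≡ ζ (V.lookup π 0ᵢ) × colour (z₁ − b) ≡ ζ (V.lookup π 1ᵢ)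
    ∈-candidates₁ {z₁} {π} i = let i₀ , e = ∈-extend 1ᵢ z₁ candidates₀ π i in ∈-candidates₀ {π} i₀ , e

    ∈-candidates₂ : ∀ {z₁ z₂ π b} → b ∈ extend 2ᵢ z₂ (extend 1ᵢ z₁ candidates₀) π →
      (colour b ≡ ζ (V.lookup π 0ᵢ) × colour (z₁ − b) ≡ ζ (V.lookup π 1ᵢ)) × colour (z₂ − b) ≡ ζ (V.lookup π 2ᵢ)
    ∈-candidates₂ {z₁} {z₂} {π} i = let i₁ , e = ∈-extend 2ᵢ z₂ (extend 1ᵢ z₁ candidates₀) π i in ∈-candidates₁ {z₁} {π} i₁ , e

    ∈-candidates₃ : ∀ {z₁ z₂ z₃ π b} → b ∈ extend 3ᵢ z₃ (extend 2ᵢ z₂ (extend 1ᵢ z₁ candidates₀)) π →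
      ((colour b ≡ ζ (V.lookup π 0ᵢ) × colour (z₁ − b) ≡ ζ (V.lookup π 1ᵢ)) × colour (z₂ − b) ≡ ζ (V.lookup π 2ᵢ)) × colour (z₃ − b) ≡ ζ (V.lookup π 3ᵢ)
    ∈-candidates₃ {z₁} {z₂} {z₃} {π} i =
      let i₂ , e = ∈-extend 3ᵢ z₃ (extend 2ᵢ z₂ (extend 1ᵢ z₁ candidates₀)) π i in ∈-candidates₂ {z₁} {z₂} {π} i₂ , e

    build : ∀ {x y₁ y₂ z₁ z₂ z₃ z₄} x′ {πˣ πʸ} → πˣ ∈ xProfiles → πʸ ∈ yProfiles → x ≡ ⊟ x′ →
      colour (y₁ − x) ≡ ζ κ₃ → colour (y₂ − x) ≡ ζ κ₆ → colour (y₂ − y₁) ≡ ζ κ₄ →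
      sees z₁ z₂ z₃ z₄ x′ ≡ V.map ζ πˣ → sees z₁ z₂ z₃ z₄ y₁ ≡ V.map ζ πʸ → sees z₁ z₂ z₃ z₄ y₂ ≡ V.map ζ y₂Profile →
      colour z₁ ≡ ζ κ₃ →
      colour z₂ ≡ ζ κ₄ × colour (z₁ − z₂) ≡ ζ κ₀ →
      (colour z₃ ≡ ζ κ₅ × colour (z₁ − z₃) ≡ ζ κ₅) × colour (z₂ − z₃) ≡ ζ κ₃ →
      ((colour z₄ ≡ ζ κ₆ × colour (z₁ − z₄) ≡ ζ κ₁) × colour (z₂ − z₄) ≡ ζ κ₂) × colour (z₃ − z₄) ≡ ζ κ₀ →
      Configuration
    build {x} {y₁} {y₂} {z₁} {z₂} {z₃} {z₄} x′ {πˣ@(_ ∷ _ ∷ _ ∷ _ ∷ _ ∷ [])} {πʸ@(_ ∷ _ ∷ _ ∷ _ ∷ _ ∷ [])} πˣ∈ πʸ∈ x≡ xy₁ xy₂ y₁y₂ sx sy sy₂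
      c₁ (c₂ , e₁₂) ((c₃ , e₁₃) , e₂₃) (((c₄ , e₁₄) , e₂₄) , e₃₄) = record
      { x = x ; y₁ = y₁ ; y₂ = y₂ ; z₁ = z₁ ; z₂ = z₂ ; z₃ = z₃ ; z₄ = z₄
      ; πˣ = πˣ ; πʸ = πʸ ; πˣ∈ = πˣ∈ ; πʸ∈ = πʸ∈
      ; vertexColours =
          trans (cong colour x≡) (trans (colour-⊟ x′) (at 0ᵢ sx)) ∷≡ at 0ᵢ sy ∷≡ at 0ᵢ sy₂ ∷≡ c₁ ∷≡ c₂ ∷≡ c₃ ∷≡ c₄ ∷≡ refl
      ; edgeColours =
          xy₁ ∷≡ xy₂ ∷≡ y₁y₂ ∷≡ opposite z₁ x≡ (at 1ᵢ sx) ∷≡ opposite z₂ x≡ (at 2ᵢ sx) ∷≡ opposite z₃ x≡ (at 3ᵢ sx) ∷≡ opposite z₄ x≡ (at 4ᵢ sx) ∷≡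
          e₁₂ ∷≡ e₁₃ ∷≡ e₁₄ ∷≡ e₂₃ ∷≡ e₂₄ ∷≡ e₃₄ ∷≡
          y₁y₂ ∷≡ at 1ᵢ sy ∷≡ at 2ᵢ sy ∷≡ at 3ᵢ sy ∷≡ at 4ᵢ sy ∷≡ at 1ᵢ sy₂ ∷≡ at 2ᵢ sy₂ ∷≡ at 3ᵢ sy₂ ∷≡ at 4ᵢ sy₂ ∷≡
          e₁₂ ∷≡ e₁₃ ∷≡ e₁₄ ∷≡ e₂₃ ∷≡ e₂₄ ∷≡ e₃₄ ∷≡ refl }

    -- n L / K bounds the candidate sets below: the first three choices lose a factor 7 · 50/49, the fourth 7 · 8/7 and the fifth 7 · 7/5.
    K₁ K₂ K₃ K₄ K₅ L₁ L₂ L₃ L₄ : ℕ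
    K₁ = 350
    K₂ = 122500
    K₃ = 42875000
    K₄ = 2401000000
    K₅ = 117649000000
    L₁ = 98
    L₂ = 4802
    L₃ = 235298
    L₄ = 1647086

    module LastChoices (z₁ z₂ z₃ z₄ : A)
      (z₁∈ : z₁ ∈ candidates₀ z₁Profile)
      (z₂∈ : z₂ ∈ extend 1ᵢ z₁ candidates₀ z₂Profile)
      (z₃∈ : z₃ ∈ extend 2ᵢ z₂ (extend 1ᵢ z₁ candidates₀) z₃Profile)
      (z₄∈ : z₄ ∈ extend 3ᵢ z₃ (extend 2ᵢ z₂ (extend 1ᵢ z₁ candidates₀)) z₄Profile)
      (ample : All (Ample K₄ L₄ (candidates₄ z₁ z₂ z₃ z₄)) Π₄) where

      f : Profile → List A
      f = candidates₄ z₁ z₂ z₃ z₄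

      -- The profiles for x describe -x, the point that shares a block with z₁, ..., z₄; negation
      -- leads to x itself, which shares a block with y₁ and y₂.
      X₀ Y₀ : List A
      X₀ = map ⊟_ (concatMap f xProfiles)
      Y₀ = concatMap f yProfiles

      X₀-unique : Unique X₀
      X₀-unique = map-Unique ⊟_ (λ _ _ → ⊟-injective) (union-unique z₁ z₂ z₃ z₄ (toWitness {a? = unique? (Vₚ.≡-dec Fₚ._≟_) xProfiles} tt))

      Y₀-unique : Unique Y₀
      Y₀-unique = union-unique z₁ z₂ z₃ z₄ (toWitness {a? = unique? (Vₚ.≡-dec Fₚ._≟_) yProfiles} tt)

      X₀-length : n * (6 * L₄) ≤ length X₀ * K₄
      X₀-length = subst (λ l → n * (6 * L₄) ≤ l * K₄) (sym (Lₚ.length-map ⊟_ (concatMap f xProfiles)))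
        (∑-ample {K₄} {L₄} {f} xProfiles (Allₚ.++⁻ˡ xProfiles (All.tail ample)))

      Y₀-length : n * (2 * L₄) ≤ length Y₀ * K₄
      Y₀-length = ∑-ample {K₄} {L₄} {f} yProfiles (Allₚ.++⁻ʳ xProfiles (All.tail ample))

      cˣ¹ cˣ² c¹² : A
      cˣ¹ = ζ κ₃
      cˣ² = ζ κ₆
      c¹² = ζ κ₄

      module _ (y₂ : A) (y₂∈ : y₂ ∈ f y₂Profile) (good-x : ¬ Bad 2 7 (X₀ , cˣ²) y₂) (good-y : ¬ Bad 2 7 (Y₀ , c¹²) y₂) where

        X₁ Y₁ : List A
        X₁ = refine y₂ cˣ² X₀
        Y₁ = refine y₂ c¹² Y₀

        X₁-length : n * (30 * L₄) ≤ length X₁ * K₅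
        X₁-length = refine-length 5 2 K₄ (6 * L₄) {X₀} {cˣ²} {y₂} X₀-length good-x

        Y₁-length : n * (10 * L₄) ≤ length Y₁ * K₅
        Y₁-length = refine-length 5 2 K₄ (2 * L₄) {Y₀} {c¹²} {y₂} Y₀-length good-y

        assemble : ∀ y₁ x → y₁ ∈ Y₁ → x ∈ refine y₁ cˣ¹ X₁ → Configuration
        assemble y₁ x y₁∈ x∈ =
          let x∈X₁ , xy₁ = ∈-refine⁻ y₁ cˣ¹ {X₁} x∈
              x∈X₀ , xy₂ = ∈-refine⁻ y₂ cˣ² {X₀} x∈X₁
              x′ , x′∈ , x≡ = ∈-map⁻ ⊟_ {xs = concatMap f xProfiles} x∈X₀
              πˣ , πˣ∈ , x′∈f = find (∈-concatMap⁻ f {xs = xProfiles} x′∈)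
              y₁∈Y₀ , y₁y₂ = ∈-refine⁻ y₂ c¹² {Y₀} y₁∈
              πʸ , πʸ∈ , y₁∈f = find (∈-concatMap⁻ f {xs = yProfiles} y₁∈Y₀)
          in build x′ πˣ∈ πʸ∈ x≡ xy₁ xy₂ y₁y₂ (∈-candidates₄ {π = πˣ} x′∈f) (∈-candidates₄ {π = πʸ} y₁∈f) (∈-candidates₄ {π = y₂Profile} y₂∈)
               (∈-candidates₀ {z₁Profile} z₁∈) (∈-candidates₁ {π = z₂Profile} z₂∈) (∈-candidates₂ {π = z₃Profile} z₃∈) (∈-candidates₃ {π = z₄Profile} z₄∈)

        -- A single x adjacent to y₁ suffices, so nearly all of the expected neighbours may be
        -- missing. With r / s = 99/100 the requirement is close to |X₁| |Y₁| > 589 n, the weakest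
        -- that this second moment bound gives.
        choose-xy₁ : Configuration
        choose-xy₁ = case select 99 100 K₅ (30 * L₄) (10 * L₄) (refine-unique y₂ c¹² Y₀-unique) Y₁-length {(X₁ , cˣ¹) ∷ []}
            ((refine-unique y₂ cˣ² X₀-unique , ζ-∈μ₇ _ , X₁-length) ∷ []) (below _ (99 * 99 * (30 * L₄ * (10 * L₄))) tt) of λ
          (y₁ , y₁∈ , good) → case nonempty (positive y₁ (All.head good)) of λ (x , x∈) → assemble y₁ x y₁∈ x∈
          where
          positive : ∀ y₁ → ¬ Bad 99 100 (X₁ , cˣ¹) y₁ → 1 ≤ length (refine y₁ cˣ¹ X₁)
          positive y₁ good = n≢0⇒n>0 λ e → <⇒≱ (below 0 (1 * (30 * L₄)) tt)
            (subst (λ l → n * (1 * (30 * L₄)) ≤ l * (7 * 100 * K₅)) e (refine-length 1 99 K₅ (30 * L₄) {X₁} {cˣ¹} {y₁} X₁-length good))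

      -- The tolerance 2/7 is close to the smallest affordable one: the number of bad points grows
      -- as the sets shrink, and at these sizes the union bound already asks for n above 1.53 ·
      -- 10¹⁰.
      choose-y₂ : Configuration
      choose-y₂ = case select 2 7 K₄ (2 * L₄) L₄ (candidates₄-unique z₁ z₂ z₃ z₄ y₂Profile) (All.head ample) {(X₀ , cˣ²) ∷ (Y₀ , c¹²) ∷ []}
          -- `select` takes one size bound for all targets, so the 6 L₄ of `X₀` is lowered to the 2
          -- L₄ of `Y₀`.
          ((X₀-unique , ζ-∈μ₇ _ , ≤-trans (*-monoʳ-≤ n (*-monoˡ-≤ L₄ (<ᵇ⇒< 1 6 tt))) X₀-length) ∷ (Y₀-unique , ζ-∈μ₇ _ , Y₀-length) ∷ [])
          (below _ (2 * 2 * (2 * L₄ * L₄)) tt) of λ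
        (y₂ , y₂∈ , good) → choose-xy₁ y₂ y₂∈ (All.head good) (All.head (All.tail good))

    stage₄ : ∀ z₁ z₂ z₃ → z₁ ∈ candidates₀ z₁Profile → z₂ ∈ extend 1ᵢ z₁ candidates₀ z₂Profile → z₃ ∈ extend 2ᵢ z₂ (extend 1ᵢ z₁ candidates₀) z₃Profile →
      All (Ample K₃ L₃ (extend 3ᵢ z₃ (extend 2ᵢ z₂ (extend 1ᵢ z₁ candidates₀)))) Π₃ → Configuration
    stage₄ z₁ z₂ z₃ z₁∈ z₂∈ z₃∈ as = case choose (extend 3ᵢ z₃ (extend 2ᵢ z₂ (extend 1ᵢ z₁ candidates₀))) 4ᵢ 7 1 K₃ L₃
        (extend-unique 3ᵢ z₃ _ (extend-unique 2ᵢ z₂ _ (extend-unique 1ᵢ z₁ _ candidates₀-unique)))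
        z₄Profile Π₄ (All.head as) (All.tail as) (below _ (1 * 1 * (L₃ * L₃)) tt) of λ
      (z₄ , z₄∈ , as′) → LastChoices.choose-y₂ z₁ z₂ z₃ z₄ z₁∈ z₂∈ z₃∈ z₄∈ as′

    stage₃ : ∀ z₁ z₂ → z₁ ∈ candidates₀ z₁Profile → z₂ ∈ extend 1ᵢ z₁ candidates₀ z₂Profile →
      All (Ample K₂ L₂ (extend 2ᵢ z₂ (extend 1ᵢ z₁ candidates₀))) Π₂ → Configuration
    stage₃ z₁ z₂ z₁∈ z₂∈ as = case choose (extend 2ᵢ z₂ (extend 1ᵢ z₁ candidates₀)) 3ᵢ 49 1 K₂ L₂
        (extend-unique 2ᵢ z₂ _ (extend-unique 1ᵢ z₁ _ candidates₀-unique))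
        z₃Profile Π₃ (All.head as) (All.tail as) (below _ (1 * 1 * (L₂ * L₂)) tt) of λ
      (z₃ , z₃∈ , as′) → stage₄ z₁ z₂ z₃ z₁∈ z₂∈ z₃∈ as′

    stage₂ : ∀ z₁ → z₁ ∈ candidates₀ z₁Profile → All (Ample K₁ L₁ (extend 1ᵢ z₁ candidates₀)) Π₁ → Configuration
    stage₂ z₁ z₁∈ as = case choose (extend 1ᵢ z₁ candidates₀) 2ᵢ 49 1 K₁ L₁ (extend-unique 1ᵢ z₁ _ candidates₀-unique)
        z₂Profile Π₂ (All.head as) (All.tail as) (below _ (1 * 1 * (L₁ * L₁)) tt) of λ
      (z₂ , z₂∈ , as′) → stage₃ z₁ z₂ z₁∈ z₂∈ as′

  configuration : Configuration
  configuration = case choose candidates₀ 1ᵢ 49 1 1 2 candidates₀-unique z₁Profile Π₁ (candidates₀-length z₁Profile)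
      (All.tabulate (λ {π} _ → candidates₀-length π)) (below _ (1 * 1 * (2 * 2)) tt) of λ
    (z₁ , z₁∈ , as) → stage₂ z₁ z₁∈ as

-- The labels of the base blocks and the starter that they form.

private
  pattern l₀ = fzero , fzero
  pattern l₁ = fzero , fsuc fzero
  pattern l₂ = fsuc fzero , fzero
  pattern l₃ = fsuc fzero , fsuc fzero

-- The labels of the pairs in the blocks of `Crossing`, in the order of `edges`. Each label occurs
-- exactly seven times, as it must in order to meet every colour once; the labels of the fourteen
-- points are arranged to this end.
edgeLabels : List Label
edgeLabels =
  l₁ ∷ l₁ ∷ l₀ ∷ l₃ ∷ l₃ ∷ l₃ ∷ l₁ ∷ l₀ ∷ l₀ ∷ l₂ ∷ l₀ ∷ l₂ ∷ l₂ ∷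
  l₂ ∷ l₃ ∷ l₀ ∷ l₂ ∷ l₃ ∷ l₁ ∷ l₂ ∷ l₀ ∷ l₁ ∷ l₃ ∷ l₁ ∷ l₀ ∷ l₂ ∷ l₃ ∷ l₁ ∷ []

label-edges : ∀ {A : Set} → List A → List (Label × A)
label-edges = L.zipWith _,_ edgeLabels

zipWith-map : ∀ {A B C : Set} (f : B → C) (as : List A) bs → L.zipWith _,_ as (map f bs) ≡ map (λ (a , b) → a , f b) (L.zipWith _,_ as bs)
zipWith-map f [] bs = refl
zipWith-map f (a ∷ as) [] = refl
zipWith-map f (a ∷ as) (b ∷ bs) = cong ((a , f b) ∷_) (zipWith-map f as bs)

All-zipWith : ∀ {A B : Set} {P : B → Set} (as : List A) {bs} → All P bs → All (P ∘ proj₂) (L.zipWith _,_ as bs)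
All-zipWith [] _ = []
All-zipWith (a ∷ as) [] = []
All-zipWith (a ∷ as) (p ∷ ps) = p ∷ All-zipWith as ps

Distinct : Profile → Profile → Set
Distinct πˣ πʸ = Unique (vertexPattern πˣ πʸ) × Unique (label-edges (edgePattern πˣ πʸ))

patterns-distinct : All (λ πˣ → All (Distinct πˣ) yProfiles) xProfiles
patterns-distinct = toWitness {a? = All.all? (λ πˣ → All.all? (λ πʸ →
  unique? Fₚ._≟_ (vertexPattern πˣ πʸ) ×-dec unique? (×-≡-dec _≟ₗ_ Fₚ._≟_) (label-edges (edgePattern πˣ πʸ))) yProfiles) xProfiles} tt

All-map⁻ : ∀ {A B : Set} {P : B → Set} (f : A → B) xs → All P (map f xs) → All (P ∘ f) xs
All-map⁻ f [] [] = []
All-map⁻ f (x ∷ xs) (p ∷ ps) = p ∷ All-map⁻ f xs ps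

module Crossing (p k : ℕ) .{{_ : NonZero p}} {_⊠_ : Vec (Fin p) k → Vec (Fin p) k → Vec (Fin p) k} {1ᶠ : Vec (Fin p) k} {q : ℕ}
  (D : IsFiniteDomain (zipWith (addMod p)) _⊠_ (V.map (negMod p)) (replicate k (zeroMod p)) 1ᶠ q)
  (n : ℕ) (1≤n : 1 ≤ n) (q≡ : q ≡ 14 * n + 1) where

  open Development p k D n 1≤n q≡

  private
    ⊟_ : F → F
    ⊟_ = V.map (negMod p)

    at : Label → F → Γ p k
    at (a , b) x = a , b , x

  vertices : (x y₁ y₂ z₁ z₂ z₃ z₄ : F) → List F
  vertices x y₁ y₂ z₁ z₂ z₃ z₄ = x ∷ y₁ ∷ y₂ ∷ z₁ ∷ z₂ ∷ z₃ ∷ z₄ ∷ []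

  module _ (x y₁ y₂ z₁ z₂ z₃ z₄ : F) where

    private
      A B C : List (Γ p k)
      A = at l₀ x ∷ at l₁ y₁ ∷ at l₁ y₂ ∷ []
      B = at l₀ (⊟ x) ∷ at l₃ z₁ ∷ at l₃ z₂ ∷ at l₃ z₃ ∷ at l₁ z₄ ∷ []
      C = at l₀ (⊟ y₁) ∷ at l₂ (⊟ y₂) ∷ at l₃ (⊟ z₁) ∷ at l₀ (⊟ z₂) ∷ at l₂ (⊟ z₃) ∷ at l₃ (⊟ z₄) ∷ []

      vs es : List F
      vs = vertices x y₁ y₂ z₁ z₂ z₃ z₄
      es = edges _⊞_ ⊟_ x y₁ y₂ z₁ z₂ z₃ z₄

      reversed : ∀ a b → colour (a − b) ≡ colour (b − a)
      reversed a b = trans (sym (colour-⊟ (a − b))) (cong colour (⊟−⊟ a b))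

      summed : ∀ a b → colour ((⊟ a) − b) ≡ colour (a ⊞ b)
      summed a b = trans (cong colour (solve 2 (λ a b → :- a :- b := :- (a :+ b)) refl a b)) (colour-⊟ (a ⊞ b))

      negated : ∀ a b → colour ((⊟ a) − (⊟ b)) ≡ colour (b − a)
      negated a b = cong colour (solve 2 (λ a b → :- a :- :- b := b :- a) refl a b)

      negated′ : ∀ a b → colour ((⊟ a) − (⊟ b)) ≡ colour (a − b)
      negated′ a b = trans (negated a b) (reversed b a)

      infixr 5 _∷≡_
      _∷≡_ : ∀ {l : Label} {b c : F} {bs cs : List (Label × F)} → b ≡ c → bs ≡ cs → _≡_ {A = List (Label × F)} ((l , b) ∷ bs) ((l , c) ∷ cs)
      refl ∷≡ refl = refl

      keys≡ : map (key ∘ proj₂) (basePairs A B C) ≡ label-edges (map colour es)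
      keys≡ =
        reversed x y₁ ∷≡ reversed x y₂ ∷≡ reversed y₁ y₂ ∷≡
        summed x z₁ ∷≡ summed x z₂ ∷≡ summed x z₃ ∷≡ summed x z₄ ∷≡
        refl ∷≡ refl ∷≡ refl ∷≡ refl ∷≡ refl ∷≡ refl ∷≡
        negated y₁ y₂ ∷≡ negated y₁ z₁ ∷≡ negated y₁ z₂ ∷≡ negated y₁ z₃ ∷≡ negated y₁ z₄ ∷≡
        negated y₂ z₁ ∷≡ negated y₂ z₂ ∷≡ negated y₂ z₃ ∷≡ negated y₂ z₄ ∷≡
        negated′ z₁ z₂ ∷≡ negated′ z₁ z₃ ∷≡ negated′ z₁ z₄ ∷≡ negated′ z₂ z₃ ∷≡ negated′ z₂ z₄ ∷≡ negated′ z₃ z₄ ∷≡ refl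

    crossing : Unique (map colour vs) → All (_≢ 0ᶠ) (map colour vs) →
      Unique (label-edges (map colour es)) → All (_≢ 0ᶠ) (map colour es) →
      ∃[ P ] (G.IsPDF P (Ktype n) 4 × G.IsHSBase P)
    crossing vs-unique vs≢0 es-unique es≢0 = parallelClass A B C , isPDF , isHSBase
      where
      keys≢0 : All ((_≢ 0ᶠ) ∘ proj₂) (map (key ∘ proj₂) (basePairs A B C))
      keys≢0 = subst (All ((_≢ 0ᶠ) ∘ proj₂)) (sym keys≡) (All-zipWith edgeLabels es≢0)
      starter : Starter A B C
      starter = record
        { |A| = refl ; |B| = refl ; |C| = refl
        ; halves = vs
        ; |halves| = refl
        -- The concatenation of the blocks has -x between y₂ and z₁; it moves behind z₄, where it
        -- heads the list of negatives.
        ; halves-± = prep x (prep y₁ (prep y₂ (↭-sym (Permₚ.shift (⊟ x) (z₁ ∷ z₂ ∷ z₃ ∷ z₄ ∷ []) (map ⊟_ (y₁ ∷ y₂ ∷ z₁ ∷ z₂ ∷ z₃ ∷ z₄ ∷ []))))))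
        ; halves-colours = vs-unique
        ; halves-≢0 = All.map colour≢0⇒≢0 (All-map⁻ colour vs vs≢0)
        ; keys-unique = subst Unique (sym keys≡) es-unique
        ; keys-≢0 = All.map colour≢0⇒≢0 (All-map⁻ (key ∘ proj₂) (basePairs A B C) keys≢0) }
      open StarterProperties starter

  module _ (big : threshold ≤ n) where

    open LargeField D n 1≤n q≡ big

    private
      ζ-≢0 : ∀ is → All (_≢ 0ᶠ) (map ζ is)
      ζ-≢0 is = Allₚ.map⁺ (All.tabulate (λ {i} _ → ∈μ₇⇒≢0 (ζ-∈μ₇ i)))

      ζ-unique : ∀ {is} → Unique is → Unique (map ζ is)
      ζ-unique = map-Unique ζ (λ _ _ → ζ-injective)

      ζ-edges-unique : ∀ {is} → Unique (label-edges is) → Unique (label-edges (map ζ is))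
      ζ-edges-unique {is} u = subst Unique (sym (zipWith-map ζ edgeLabels is))
        (map-Unique (λ (l , c) → l , ζ c) (λ _ _ e → cong₂ _,_ (cong proj₁ e) (ζ-injective (cong proj₂ e))) u)

    fromConfiguration : Configuration → ∃[ P ] (G.IsPDF P (Ktype n) 4 × G.IsHSBase P)
    fromConfiguration c = crossing x y₁ y₂ z₁ z₂ z₃ z₄
        (subst Unique (sym vertexColours) (ζ-unique (proj₁ patterns)))
        (subst (All (_≢ 0ᶠ)) (sym vertexColours) (ζ-≢0 (vertexPattern πˣ πʸ)))
        (subst (λ cs → Unique (label-edges cs)) (sym edgeColours) (ζ-edges-unique {edgePattern πˣ πʸ} (proj₂ patterns)))
        (subst (All (_≢ 0ᶠ)) (sym edgeColours) (ζ-≢0 (edgePattern πˣ πʸ)))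
      where
      open Configuration c
      patterns : Distinct πˣ πʸ
      patterns = All.lookup (All.lookup patterns-distinct πˣ∈) πʸ∈

    large : ∃[ P ] (G.IsPDF P (Ktype n) 4 × G.IsHSBase P)
    large = fromConfiguration configuration

-- Evaluation of the colour conditions on natural numbers.

fastPower : ∀ {A : Set} → (A → A → A) → A → ℕ → ℕ → A → A
fastPower mul one zero e x = one
fastPower {A} mul one (suc f) e x = step (e % 2) (fastPower mul one f (e / 2) (mul x x))
  where
  step : ℕ → A → A
  step zero y = y
  step (suc _) y = mul x y

-- This is stated for bare operations because natural numbers under `mulₘ` obey the unit law only on
-- reduced residues. The power evaluated there is compared with the power in the quotient ring
-- through the map `⌊_⌋`.
fastPower-homomorphic : ∀ {A B : Set} {mul : A → A → A} {one : A} {mul′ : B → B → B} {one′ : B} (h : A → B) →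
  (∀ x y → h (mul x y) ≡ mul′ (h x) (h y)) → h one ≡ one′ → ∀ f e x → h (fastPower mul one f e x) ≡ fastPower mul′ one′ f e (h x)
fastPower-homomorphic h h-mul h-one zero e x = h-one
fastPower-homomorphic {mul = mul} {one} {mul′} {one′} h h-mul h-one (suc f) e x with e % 2 | fastPower-homomorphic {mul = mul} {one} {mul′} {one′} h h-mul h-one f (e / 2) (mul x x)
... | zero | ih = trans ih (cong (fastPower mul′ one′ f (e / 2)) (h-mul x x))
... | suc _ | ih = trans (h-mul x _) (cong (mul′ (h x)) (trans ih (cong (fastPower mul′ one′ f (e / 2)) (h-mul x x))))

module FastPower {A : Set} {_⊞_ _⊠_ : A → A → A} {⊟_ : A → A} {0ᶠ 1ᶠ : A}
  (isCR : IsCommutativeRing _≡_ _⊞_ _⊠_ ⊟_ 0ᶠ 1ᶠ) where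

  open RingTheory isCR

  fastPower-correct : ∀ f e x → e < 2 ^ f → fastPower _⊠_ 1ᶠ f e x ≡ x ^ᶠ e
  fastPower-correct zero zero x l = refl
  fastPower-correct zero (suc e) x (s≤s ())
  fastPower-correct (suc f) e x l with e % 2 | m≡m%n+[m/n]*n e 2 | m%n<n e 2
    | fastPower-correct f (e / 2) (x ⊠ x) (m<n*o⇒m/o<n (subst (e <_) (*-comm 2 (2 ^ f)) l))
  ... | zero | e≡ | _ | ih = trans ih (trans (halved x (e / 2)) (cong (x ^ᶠ_) (sym e≡)))
    where
    halved : ∀ x m → (x ⊠ x) ^ᶠ m ≡ x ^ᶠ (m * 2)
    halved x m = trans (cong (_^ᶠ m) (cong (x ⊠_) (sym (⊠-identityʳ x)))) (trans (^ᶠ-* x 2 m) (cong (x ^ᶠ_) (*-comm 2 m)))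
  ... | suc zero | e≡ | _ | ih = trans (cong (x ⊠_) (trans ih (halved x (e / 2)))) (cong (x ^ᶠ_) (sym e≡))
    where
    halved : ∀ x m → (x ⊠ x) ^ᶠ m ≡ x ^ᶠ (m * 2)
    halved x m = trans (cong (_^ᶠ m) (cong (x ⊠_) (sym (⊠-identityʳ x)))) (trans (^ᶠ-* x 2 m) (cong (x ^ᶠ_) (*-comm 2 m)))
  ... | suc (suc _) | _ | s≤s (s≤s ()) | _

≡ᵇ-refl : ∀ n → T (n ≡ᵇ n)
≡ᵇ-refl n = ≡⇒≡ᵇ n n refl

sameᵇ : ∀ {k} → Vec ℕ k → Vec ℕ k → Bool
sameᵇ [] [] = true
sameᵇ (x ∷ xs) (y ∷ ys) = (x ≡ᵇ y) ∧ sameᵇ xs ys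

sameᵇ-refl : ∀ {k} (v : Vec ℕ k) → T (sameᵇ v v)
sameᵇ-refl [] = tt
sameᵇ-refl (x ∷ v) = Equivalence.from T-∧ (≡ᵇ-refl x , sameᵇ-refl v)

sameᵇ-sound : ∀ {k} (u v : Vec ℕ k) → T (sameᵇ u v) → u ≡ v
sameᵇ-sound [] [] t = refl
sameᵇ-sound (x ∷ u) (y ∷ v) t = let e , t′ = Equivalence.to T-∧ t in cong₂ _∷_ (≡ᵇ⇒≡ x y e) (sameᵇ-sound u v t′)

sameₗᵇ : ∀ {k} → Label × Vec ℕ k → Label × Vec ℕ k → Bool
sameₗᵇ ((a , b) , u) ((c , d) , v) = ((toℕ a ≡ᵇ toℕ c) ∧ (toℕ b ≡ᵇ toℕ d)) ∧ sameᵇ u v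

sameₗᵇ-refl : ∀ {k} (x : Label × Vec ℕ k) → T (sameₗᵇ x x)
sameₗᵇ-refl ((a , b) , v) = Equivalence.from (T-∧ {(toℕ a ≡ᵇ toℕ a) ∧ (toℕ b ≡ᵇ toℕ b)})
  (Equivalence.from (T-∧ {toℕ a ≡ᵇ toℕ a}) (≡ᵇ-refl (toℕ a) , ≡ᵇ-refl (toℕ b)) , sameᵇ-refl v)

not-sound : ∀ {A : Set} (same : A → A → Bool) → (∀ x → T (same x x)) → ∀ {x y} → T (not (same x y)) → x ≢ y
not-sound same same-refl {x} t refl with same x x | same-refl x
... | true | _ = t

distinctᵇ : ∀ {A : Set} → (A → A → Bool) → List A → Bool
distinctᵇ same [] = true
distinctᵇ same (x ∷ xs) = all (λ y → not (same x y)) xs ∧ distinctᵇ same xs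

distinctᵇ-sound : ∀ {A : Set} (same : A → A → Bool) → (∀ x → T (same x x)) → ∀ xs → T (distinctᵇ same xs) → Unique xs
distinctᵇ-sound same same-refl [] t = []
distinctᵇ-sound same same-refl (x ∷ xs) t = let a , t′ = Equivalence.to T-∧ t in
  All.map (not-sound same same-refl) (Allₚ.all⁺ (λ y → not (same x y)) xs a) ∷ distinctᵇ-sound same same-refl xs t′

-- Arithmetic of (ℤ/p)[X]/(X^k − g) on vectors of natural numbers, for evaluation.
module Residues (p : ℕ) .{{_ : NonZero p}} where

  addₘ mulₘ : ℕ → ℕ → ℕ
  addₘ a b = (a + b) % p
  mulₘ a b = (a * b) % p

  negₘ : ℕ → ℕ
  negₘ a = (p ∸ a) % p

  open RawQuotient addₘ mulₘ negₘ (0 % p) public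

  module _ {k : ℕ} (g : Vec ℕ k) where

    zeroₘ oneₘ : Vec ℕ k
    zeroₘ = replicate k (0 % p)
    oneₘ = extend k (1 % p ∷ [])

    Separatedₘ : Set
    Separatedₘ = iter (mulX g) (p ^ k) oneₘ ≡ mulX g oneₘ × separator p (mulX g) (pred k) oneₘ ≢ zeroₘ

    colourₘ : ℕ → ℕ → Vec ℕ k → Vec ℕ k
    colourₘ f n = fastPower (act (mulX g)) oneₘ f (2 * n)

    Distinguished : ℕ → ℕ → (x y₁ y₂ z₁ z₂ z₃ z₄ : Vec ℕ k) → Set
    Distinguished f n x y₁ y₂ z₁ z₂ z₃ z₄ =
      Unique (map (colourₘ f n) vs) × All (_≢ zeroₘ) (map (colourₘ f n) vs) ×
      Unique (label-edges (map (colourₘ f n) es)) × All (_≢ zeroₘ) (map (colourₘ f n) es)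
      where
      vs es : List (Vec ℕ k)
      vs = x ∷ y₁ ∷ y₂ ∷ z₁ ∷ z₂ ∷ z₃ ∷ z₄ ∷ []
      es = edges _⊕_ ⊝_ x y₁ y₂ z₁ z₂ z₃ z₄

    separatedᵇ : Bool
    separatedᵇ = sameᵇ (iter (mulX g) (p ^ k) oneₘ) (mulX g oneₘ) ∧ not (sameᵇ (separator p (mulX g) (pred k) oneₘ) zeroₘ)

    distinguishedᵇ : ℕ → ℕ → (x y₁ y₂ z₁ z₂ z₃ z₄ : Vec ℕ k) → Bool
    distinguishedᵇ f n x y₁ y₂ z₁ z₂ z₃ z₄ =
      distinctᵇ sameᵇ vs ∧ all (λ v → not (sameᵇ v zeroₘ)) vs ∧
      distinctᵇ sameₗᵇ (label-edges es) ∧ all (λ v → not (sameᵇ v zeroₘ)) es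
      where
      vs es : List (Vec ℕ k)
      vs = map (colourₘ f n) (x ∷ y₁ ∷ y₂ ∷ z₁ ∷ z₂ ∷ z₃ ∷ z₄ ∷ [])
      es = map (colourₘ f n) (edges _⊕_ ⊝_ x y₁ y₂ z₁ z₂ z₃ z₄)

    separatedᵇ-sound : T separatedᵇ → Separatedₘ
    separatedᵇ-sound t = let e , ne = Equivalence.to T-∧ t in sameᵇ-sound _ _ e , not-sound sameᵇ sameᵇ-refl ne

    distinguishedᵇ-sound : ∀ f n x y₁ y₂ z₁ z₂ z₃ z₄ → T (distinguishedᵇ f n x y₁ y₂ z₁ z₂ z₃ z₄) → Distinguished f n x y₁ y₂ z₁ z₂ z₃ z₄
    distinguishedᵇ-sound f n x y₁ y₂ z₁ z₂ z₃ z₄ t =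
      let u , t₁ = Equivalence.to T-∧ t
          v , t₂ = Equivalence.to T-∧ t₁
          w , a = Equivalence.to T-∧ t₂
      in distinctᵇ-sound sameᵇ sameᵇ-refl _ u , All.map (not-sound sameᵇ sameᵇ-refl) (Allₚ.all⁺ (λ v → not (sameᵇ v zeroₘ)) _ v) ,
         distinctᵇ-sound sameₗᵇ sameₗᵇ-refl _ w ,
         All.map (not-sound sameᵇ sameᵇ-refl) (Allₚ.all⁺ (λ v → not (sameᵇ v zeroₘ)) _ a)

module Evaluation {p : ℕ} (pp : Prime p) (k : ℕ) (1≤k : 1 ≤ k) where

  private instance
    p≢0 : NonZero p
    p≢0 = prime⇒nonZero pp

  open PrimeField p
  module R = Residues p
  open VecModule ℤₚ-isCommutativeRing using (_⊕_; ⊝_; _·_; shift; lastOr; mulX; act; extend; separator; 𝟎)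

  private
    ⌊_⌋ : ∀ {d} → Vec (Fin p) d → Vec ℕ d
    ⌊_⌋ = V.map toℕ

    ⌊⌋-injective : ∀ {d} {u v : Vec (Fin p) d} → ⌊ u ⌋ ≡ ⌊ v ⌋ → u ≡ v
    ⌊⌋-injective {u = []} {[]} e = refl
    ⌊⌋-injective {u = _ ∷ _} {_ ∷ _} e = cong₂ _∷_ (toℕ-injective (cong V.head e)) (⌊⌋-injective (cong V.tail e))

    ⌊⌋-⊕ : ∀ {d} (u v : Vec (Fin p) d) → ⌊ u ⊕ v ⌋ ≡ ⌊ u ⌋ R.⊕ ⌊ v ⌋
    ⌊⌋-⊕ [] [] = refl
    ⌊⌋-⊕ (a ∷ u) (b ∷ v) = cong₂ _∷_ (toℕ-mod (toℕ a + toℕ b)) (⌊⌋-⊕ u v)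

    ⌊⌋-⊝ : ∀ {d} (v : Vec (Fin p) d) → ⌊ ⊝ v ⌋ ≡ R.⊝ ⌊ v ⌋
    ⌊⌋-⊝ [] = refl
    ⌊⌋-⊝ (a ∷ v) = cong₂ _∷_ (toℕ-mod (p ∸ toℕ a)) (⌊⌋-⊝ v)

    ⌊⌋-· : ∀ {d} c (v : Vec (Fin p) d) → ⌊ c · v ⌋ ≡ toℕ c R.· ⌊ v ⌋
    ⌊⌋-· c [] = refl
    ⌊⌋-· c (a ∷ v) = cong₂ _∷_ (toℕ-mod (toℕ c * toℕ a)) (⌊⌋-· c v)

    ⌊⌋-shift : ∀ {d} c (v : Vec (Fin p) d) → ⌊ shift c v ⌋ ≡ R.shift (toℕ c) ⌊ v ⌋
    ⌊⌋-shift c [] = refl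
    ⌊⌋-shift c (a ∷ v) = cong (toℕ c ∷_) (⌊⌋-shift a v)

    ⌊⌋-lastOr : ∀ {d} c (v : Vec (Fin p) d) → toℕ (lastOr c v) ≡ R.lastOr (toℕ c) ⌊ v ⌋
    ⌊⌋-lastOr c [] = refl
    ⌊⌋-lastOr c (a ∷ v) = ⌊⌋-lastOr a v

    ⌊⌋-mulX : ∀ {d} (g v : Vec (Fin p) d) → ⌊ mulX g v ⌋ ≡ R.mulX ⌊ g ⌋ ⌊ v ⌋
    ⌊⌋-mulX g v = trans (⌊⌋-⊕ (shift 0ₚ v) (lastOr 0ₚ v · g)) (cong₂ R._⊕_
      (trans (⌊⌋-shift 0ₚ v) (cong (λ c → R.shift c ⌊ v ⌋) (toℕ-mod 0)))
      (trans (⌊⌋-· (lastOr 0ₚ v) g) (cong (R._· ⌊ g ⌋) (trans (⌊⌋-lastOr 0ₚ v) (cong (λ c → R.lastOr c ⌊ v ⌋) (toℕ-mod 0))))))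

    ⌊⌋-𝟎 : ∀ d → ⌊ 𝟎 {d} ⌋ ≡ replicate d (0 % p)
    ⌊⌋-𝟎 zero = refl
    ⌊⌋-𝟎 (suc d) = cong₂ _∷_ (toℕ-mod 0) (⌊⌋-𝟎 d)

    ⌊⌋-extend : ∀ {m} d (v : Vec (Fin p) m) → ⌊ extend d v ⌋ ≡ R.extend d ⌊ v ⌋
    ⌊⌋-extend zero v = refl
    ⌊⌋-extend (suc d) [] = cong₂ _∷_ (toℕ-mod 0) (⌊⌋-extend d [])
    ⌊⌋-extend (suc d) (a ∷ v) = cong (toℕ a ∷_) (⌊⌋-extend d v)

    module _ (g : Vec (Fin p) k) where

      ⌊⌋-act : ∀ {m} (as : Vec (Fin p) m) v → ⌊ act (mulX g) as v ⌋ ≡ R.act (R.mulX ⌊ g ⌋) ⌊ as ⌋ ⌊ v ⌋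
      ⌊⌋-act [] v = ⌊⌋-𝟎 k
      ⌊⌋-act (a ∷ as) v = trans (⌊⌋-⊕ (a · v) (mulX g (act (mulX g) as v))) (cong₂ R._⊕_ (⌊⌋-· a v)
        (trans (⌊⌋-mulX g _) (cong (R.mulX ⌊ g ⌋) (⌊⌋-act as v))))

      ⌊⌋-iter : ∀ m v → ⌊ iter (mulX g) m v ⌋ ≡ iter (R.mulX ⌊ g ⌋) m ⌊ v ⌋
      ⌊⌋-iter zero v = refl
      ⌊⌋-iter (suc m) v = trans (⌊⌋-mulX g _) (cong (R.mulX ⌊ g ⌋) (⌊⌋-iter m v))

      ⌊⌋-separator : ∀ j v → ⌊ separator p (mulX g) j v ⌋ ≡ R.separator p (R.mulX ⌊ g ⌋) j ⌊ v ⌋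
      ⌊⌋-separator zero v = refl
      ⌊⌋-separator (suc j) v = trans (⌊⌋-⊕ (iter (mulX g) (p ^ suc j) (separator p (mulX g) j v)) (⊝ mulX g (separator p (mulX g) j v))) (cong₂ R._⊕_
        (trans (⌊⌋-iter (p ^ suc j) _) (cong (iter (R.mulX ⌊ g ⌋) (p ^ suc j)) (⌊⌋-separator j v)))
        (trans (⌊⌋-⊝ (mulX g (separator p (mulX g) j v))) (cong R.⊝_ (trans (⌊⌋-mulX g _) (cong (R.mulX ⌊ g ⌋) (⌊⌋-separator j v))))))

  private module FE = FieldExtensions (ℤₚ-isFiniteDomain pp) pp ℤₚ-char k 1≤k

  open FE public using (Separated; ∃-separated; quotient-isFiniteDomain)

  module _ (g : Vec (Fin p) k) where

    open VecModule.QuotientRing ℤₚ-isCommutativeRing g using (𝟏; _⊛_; X)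

    ⌊⌋-𝟏 : ⌊ 𝟏 ⌋ ≡ R.oneₘ ⌊ g ⌋
    ⌊⌋-𝟏 = trans (⌊⌋-extend k (1ₚ ∷ [])) (cong (λ c → R.extend k (c ∷ [])) (toℕ-mod 1))

    separatedₘ⇒separated : R.Separatedₘ ⌊ g ⌋ → Separated g
    separatedₘ⇒separated (e , ne) =
      ⌊⌋-injective (trans (⌊⌋-iter g (p ^ k) 𝟏) (trans (cong (iter (R.mulX ⌊ g ⌋) (p ^ k)) ⌊⌋-𝟏)
        (trans e (sym (trans (⌊⌋-mulX g 𝟏) (cong (R.mulX ⌊ g ⌋) ⌊⌋-𝟏)))))) ,
      λ z → ne (trans (cong (R.separator p (R.mulX ⌊ g ⌋) (pred k)) (sym ⌊⌋-𝟏)) (trans (sym (⌊⌋-separator g (pred k) 𝟏)) (trans (cong ⌊_⌋ z) (⌊⌋-𝟎 k))))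

    evaluate : Separated g → ∀ f n → 1 ≤ n → 2 * n < 2 ^ f → p ^ k ≡ 14 * n + 1 →
      ∀ x y₁ y₂ z₁ z₂ z₃ z₄ → R.Distinguished ⌊ g ⌋ f n ⌊ x ⌋ ⌊ y₁ ⌋ ⌊ y₂ ⌋ ⌊ z₁ ⌋ ⌊ z₂ ⌋ ⌊ z₃ ⌋ ⌊ z₄ ⌋ →
      ∃[ P ] (Group.IsPDF p k P (Ktype n) 4 × Group.IsHSBase p k P)
    evaluate sep f n 1≤n 2n< q≡ x y₁ y₂ z₁ z₂ z₃ z₄ (vs-unique , vs≢0 , es-unique , es≢0) =
      Crossing.crossing p k D n 1≤n q≡ x y₁ y₂ z₁ z₂ z₃ z₄
        (Uniqueₚ.map⁻ {f = ⌊_⌋} (subst Unique vs≡ vs-unique))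
        (nonzero {map colour vs} (subst (All (_≢ R.zeroₘ ⌊ g ⌋)) vs≡ vs≢0))
        (Uniqueₚ.map⁻ {f = λ (l , c) → l , ⌊ c ⌋} (subst Unique (zipWith-map ⌊_⌋ edgeLabels (map colour es)) (subst (Unique ∘ label-edges) es≡ es-unique)))
        (nonzero {map colour es} (subst (All (_≢ R.zeroₘ ⌊ g ⌋)) es≡ es≢0))
      where
      D = quotient-isFiniteDomain g sep
      open Colours D n 1≤n q≡ using (colour; isCommutativeRing)
      ⌊⌋-colour : ∀ v → R.colourₘ ⌊ g ⌋ f n ⌊ v ⌋ ≡ ⌊ colour v ⌋
      ⌊⌋-colour v = trans (sym (fastPower-homomorphic {mul = _⊛_} {one = 𝟏} ⌊_⌋ (⌊⌋-act g) ⌊⌋-𝟏 f (2 * n) v))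
        (cong ⌊_⌋ (FastPower.fastPower-correct isCommutativeRing f (2 * n) v 2n<))
      mapped : ∀ vs → map (R.colourₘ ⌊ g ⌋ f n) (map ⌊_⌋ vs) ≡ map ⌊_⌋ (map colour vs)
      mapped [] = refl
      mapped (v ∷ vs) = cong₂ _∷_ (⌊⌋-colour v) (mapped vs)
      vs es : List (Vec (Fin p) k)
      vs = x ∷ y₁ ∷ y₂ ∷ z₁ ∷ z₂ ∷ z₃ ∷ z₄ ∷ []
      es = edges _⊕_ ⊝_ x y₁ y₂ z₁ z₂ z₃ z₄
      vs≡ : map (R.colourₘ ⌊ g ⌋ f n) (⌊ x ⌋ ∷ ⌊ y₁ ⌋ ∷ ⌊ y₂ ⌋ ∷ ⌊ z₁ ⌋ ∷ ⌊ z₂ ⌋ ∷ ⌊ z₃ ⌋ ∷ ⌊ z₄ ⌋ ∷ []) ≡ map ⌊_⌋ (map colour vs)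
      vs≡ = mapped vs
      ⌊⌋-− : ∀ u v → ⌊ u ⌋ R.⊕ (R.⊝ ⌊ v ⌋) ≡ ⌊ u ⊕ (⊝ v) ⌋
      ⌊⌋-− u v = trans (cong (⌊ u ⌋ R.⊕_) (sym (⌊⌋-⊝ v))) (sym (⌊⌋-⊕ u (⊝ v)))
      infixr 5 _∷≡_
      _∷≡_ : ∀ {b c : Vec ℕ k} {bs cs : List (Vec ℕ k)} → b ≡ c → bs ≡ cs → _≡_ {A = List (Vec ℕ k)} (b ∷ bs) (c ∷ cs)
      e ∷≡ es = cong₂ _∷_ e es
      edges≡ : edges R._⊕_ R.⊝_ ⌊ x ⌋ ⌊ y₁ ⌋ ⌊ y₂ ⌋ ⌊ z₁ ⌋ ⌊ z₂ ⌋ ⌊ z₃ ⌋ ⌊ z₄ ⌋ ≡ map ⌊_⌋ es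
      edges≡ =
        ⌊⌋-− y₁ x ∷≡ ⌊⌋-− y₂ x ∷≡ ⌊⌋-− y₂ y₁ ∷≡
        sym (⌊⌋-⊕ x z₁) ∷≡ sym (⌊⌋-⊕ x z₂) ∷≡ sym (⌊⌋-⊕ x z₃) ∷≡ sym (⌊⌋-⊕ x z₄) ∷≡
        ⌊⌋-− z₁ z₂ ∷≡ ⌊⌋-− z₁ z₃ ∷≡ ⌊⌋-− z₁ z₄ ∷≡ ⌊⌋-− z₂ z₃ ∷≡ ⌊⌋-− z₂ z₄ ∷≡ ⌊⌋-− z₃ z₄ ∷≡
        ⌊⌋-− y₂ y₁ ∷≡ ⌊⌋-− z₁ y₁ ∷≡ ⌊⌋-− z₂ y₁ ∷≡ ⌊⌋-− z₃ y₁ ∷≡ ⌊⌋-− z₄ y₁ ∷≡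
        ⌊⌋-− z₁ y₂ ∷≡ ⌊⌋-− z₂ y₂ ∷≡ ⌊⌋-− z₃ y₂ ∷≡ ⌊⌋-− z₄ y₂ ∷≡
        ⌊⌋-− z₁ z₂ ∷≡ ⌊⌋-− z₁ z₃ ∷≡ ⌊⌋-− z₁ z₄ ∷≡ ⌊⌋-− z₂ z₃ ∷≡ ⌊⌋-− z₂ z₄ ∷≡ ⌊⌋-− z₃ z₄ ∷≡ refl
      es≡ : map (R.colourₘ ⌊ g ⌋ f n) (edges R._⊕_ R.⊝_ ⌊ x ⌋ ⌊ y₁ ⌋ ⌊ y₂ ⌋ ⌊ z₁ ⌋ ⌊ z₂ ⌋ ⌊ z₃ ⌋ ⌊ z₄ ⌋) ≡ map ⌊_⌋ (map colour es)
      es≡ = trans (cong (map (R.colourₘ ⌊ g ⌋ f n)) edges≡) (mapped es)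
      nonzero : ∀ {vs} → All (_≢ R.zeroₘ ⌊ g ⌋) (map ⌊_⌋ vs) → All (_≢ 𝟎) vs
      nonzero {vs} h = All.map (λ ne e → ne (trans (cong ⌊_⌋ e) (⌊⌋-𝟎 k))) (All-map⁻ ⌊_⌋ vs h)

-- cert p k g x y₁ y₂ z₁ z₂ z₃ z₄: the vertices of the construction in (ℤ/(p+1))[X]/(X^k − g), as coefficient vectors.
data Certificate : Set where
  cert : (p k : ℕ) (g x y₁ y₂ z₁ z₂ z₃ z₄ : Vec ℕ k) → Certificate

-- prime n x y₁ y₂ z₁ z₂ z₃ z₄: the vertices in the prime field with 14 n + 1 elements.
data PrimeCertificate : Set where
  prime : (n x y₁ y₂ z₁ z₂ z₃ z₄ : ℕ) → PrimeCertificate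

-- The proper prime powers between 71 and 9941 that are 1 modulo 14: 13², 29², 41², 43², 71², 83²,
-- 97², 11³ and 3⁶.
extensionCertificates : List Certificate
extensionCertificates =
  cert 12 2 (2 ∷ 0 ∷ []) (9 ∷ 1 ∷ []) (11 ∷ 8 ∷ []) (9 ∷ 11 ∷ []) (1 ∷ 0 ∷ []) (9 ∷ 10 ∷ []) (12 ∷ 11 ∷ []) (5 ∷ 8 ∷ []) ∷
  cert 28 2 (2 ∷ 0 ∷ []) (27 ∷ 27 ∷ []) (10 ∷ 18 ∷ []) (14 ∷ 1 ∷ []) (1 ∷ 0 ∷ []) (23 ∷ 24 ∷ []) (10 ∷ 14 ∷ []) (3 ∷ 12 ∷ []) ∷
  cert 40 2 (3 ∷ 0 ∷ []) (30 ∷ 4 ∷ []) (5 ∷ 31 ∷ []) (39 ∷ 39 ∷ []) (1 ∷ 0 ∷ []) (34 ∷ 7 ∷ []) (15 ∷ 3 ∷ []) (24 ∷ 18 ∷ []) ∷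
  cert 42 2 (2 ∷ 0 ∷ []) (23 ∷ 21 ∷ []) (30 ∷ 11 ∷ []) (24 ∷ 16 ∷ []) (1 ∷ 0 ∷ []) (2 ∷ 28 ∷ []) (39 ∷ 36 ∷ []) (17 ∷ 17 ∷ []) ∷
  cert 70 2 (7 ∷ 0 ∷ []) (34 ∷ 58 ∷ []) (40 ∷ 47 ∷ []) (34 ∷ 5 ∷ []) (1 ∷ 0 ∷ []) (11 ∷ 45 ∷ []) (4 ∷ 31 ∷ []) (24 ∷ 3 ∷ []) ∷
  cert 82 2 (2 ∷ 0 ∷ []) (60 ∷ 56 ∷ []) (53 ∷ 41 ∷ []) (58 ∷ 65 ∷ []) (1 ∷ 0 ∷ []) (81 ∷ 19 ∷ []) (64 ∷ 68 ∷ []) (73 ∷ 60 ∷ []) ∷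
  cert 96 2 (5 ∷ 0 ∷ []) (6 ∷ 9 ∷ []) (26 ∷ 54 ∷ []) (23 ∷ 19 ∷ []) (1 ∷ 0 ∷ []) (87 ∷ 15 ∷ []) (42 ∷ 95 ∷ []) (48 ∷ 53 ∷ []) ∷
  cert 10 3 (1 ∷ 0 ∷ 4 ∷ []) (0 ∷ 2 ∷ 9 ∷ []) (3 ∷ 6 ∷ 8 ∷ []) (7 ∷ 10 ∷ 10 ∷ []) (1 ∷ 0 ∷ 0 ∷ []) (1 ∷ 1 ∷ 9 ∷ []) (3 ∷ 0 ∷ 4 ∷ []) (7 ∷ 6 ∷ 6 ∷ []) ∷
  cert 2 6 (1 ∷ 0 ∷ 0 ∷ 0 ∷ 0 ∷ 1 ∷ []) (2 ∷ 0 ∷ 1 ∷ 2 ∷ 1 ∷ 1 ∷ []) (1 ∷ 0 ∷ 1 ∷ 0 ∷ 2 ∷ 2 ∷ []) (1 ∷ 0 ∷ 1 ∷ 0 ∷ 0 ∷ 2 ∷ []) (1 ∷ 0 ∷ 0 ∷ 0 ∷ 0 ∷ 0 ∷ []) (0 ∷ 0 ∷ 2 ∷ 1 ∷ 1 ∷ 0 ∷ []) (0 ∷ 1 ∷ 1 ∷ 2 ∷ 1 ∷ 0 ∷ []) (2 ∷ 1 ∷ 0 ∷ 0 ∷ 2 ∷ 0 ∷ []) ∷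
  []

-- Throughout z₁ = 1: dilating all seven points by a nonzero element multiplies every colour by the
-- same factor and so preserves all the distinctness conditions.
primeCertificates : List PrimeCertificate
primeCertificates =
  prime 5 35 43 39 1 67 60 41 ∷ prime 8 9 36 37 1 87 50 31 ∷ prime 9 104 92 73 1 32 96 98 ∷
  prime 14 99 79 49 1 154 67 147 ∷ prime 15 85 129 94 1 148 58 194 ∷ prime 17 80 117 156 1 98 92 32 ∷
  prime 20 46 8 141 1 101 5 105 ∷ prime 24 231 287 159 1 245 75 108 ∷ prime 27 117 373 244 1 343 167 149 ∷
  prime 30 138 307 237 1 129 55 247 ∷ prime 32 157 168 18 1 302 238 305 ∷ prime 33 359 270 65 1 54 297 190 ∷
  prime 35 396 119 122 1 157 403 330 ∷ prime 39 221 110 514 1 436 58 465 ∷ prime 44 524 490 134 1 599 345 227 ∷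
  prime 45 224 396 63 1 239 24 463 ∷ prime 47 571 638 25 1 316 537 632 ∷ prime 48 618 145 268 1 578 398 511 ∷
  prime 50 539 502 334 1 425 191 254 ∷ prime 53 690 676 346 1 478 297 41 ∷ prime 54 562 689 439 1 606 216 62 ∷
  prime 59 265 557 666 1 520 553 79 ∷ prime 63 437 564 492 1 803 60 302 ∷ prime 65 183 648 411 1 665 530 419 ∷
  prime 68 87 763 375 1 913 125 397 ∷ prime 69 631 678 478 1 767 799 588 ∷ prime 72 518 323 69 1 865 513 970 ∷
  prime 75 874 852 113 1 143 764 838 ∷ prime 78 437 209 1026 1 834 455 195 ∷ prime 83 254 164 28 1 595 720 46 ∷
  prime 92 860 535 1186 1 1012 611 913 ∷ prime 93 1108 958 45 1 1267 583 716 ∷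
  prime 98 338 270 921 1 27 1013 263 ∷ prime 102 1172 1375 1095 1 326 366 288 ∷
  prime 105 348 1055 1433 1 864 1078 145 ∷ prime 107 57 452 1167 1 968 471 869 ∷
  prime 113 1319 46 484 1 347 915 171 ∷ prime 114 1089 970 99 1 1025 448 1031 ∷
  prime 119 363 1169 1417 1 1454 1290 1241 ∷ prime 122 486 230 603 1 404 1592 1265 ∷
  prime 123 1125 1721 1160 1 443 137 908 ∷ prime 134 1240 1134 438 1 749 1244 677 ∷
  prime 138 1195 1328 151 1 469 1607 1839 ∷ prime 143 788 1749 1189 1 203 286 1762 ∷
  prime 144 1522 1324 388 1 1464 1179 1617 ∷ prime 149 1717 630 1198 1 1185 550 1495 ∷
  prime 152 1208 276 1400 1 884 278 1143 ∷ prime 153 725 285 1836 1 1351 1911 265 ∷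
  prime 158 2031 975 1093 1 777 1689 2113 ∷ prime 162 2045 1579 1557 1 140 1924 400 ∷
  prime 164 1088 1376 520 1 887 1601 2137 ∷ prime 165 1399 1722 406 1 428 10 192 ∷
  prime 167 1155 1366 1767 1 423 1319 1440 ∷ prime 170 1941 1051 1114 1 1935 76 140 ∷
  prime 173 845 1204 860 1 2391 1436 223 ∷ prime 174 530 268 1659 1 54 1878 1410 ∷
  prime 180 19 1005 1681 1 2440 87 963 ∷ prime 182 1324 1882 1912 1 1014 2130 996 ∷
  prime 185 276 1814 2239 1 1508 1316 1619 ∷ prime 188 2450 1111 1675 1 1362 1698 954 ∷
  prime 189 2645 2047 2368 1 991 2125 1340 ∷ prime 192 1830 1481 1773 1 1036 2143 2602 ∷
  prime 195 881 825 2103 1 1773 1694 29 ∷ prime 200 2605 634 1555 1 1035 1900 302 ∷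
  prime 203 1251 535 2396 1 660 855 1457 ∷ prime 204 1956 348 86 1 44 2086 1926 ∷
  prime 209 2732 1496 1522 1 2815 693 1637 ∷ prime 212 1485 232 769 1 1941 1153 335 ∷
  prime 215 2177 1895 2645 1 681 767 1479 ∷ prime 219 1500 2962 2648 1 2190 2432 2179 ∷
  prime 222 651 2514 1261 1 2855 1467 2422 ∷ prime 224 2330 729 2415 1 455 1677 2529 ∷
  prime 230 719 1491 1930 1 1996 1132 1424 ∷ prime 237 899 1897 2065 1 1787 3092 1394 ∷
  prime 239 682 2034 607 1 1897 2749 395 ∷ prime 240 387 2626 447 1 3067 2106 1636 ∷
  prime 242 536 2935 225 1 916 3309 2301 ∷ prime 252 2582 1056 1994 1 2605 3158 806 ∷
  prime 254 1639 1085 2273 1 323 2772 825 ∷ prime 255 1579 577 3285 1 507 957 3380 ∷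
  prime 258 1236 1693 2102 1 381 569 1873 ∷ prime 264 2341 2086 3036 1 3462 3582 1427 ∷
  prime 267 916 728 2417 1 172 1148 1397 ∷ prime 269 2651 270 29 1 701 970 3748 ∷
  prime 273 3160 1231 2757 1 3107 2968 743 ∷ prime 275 3401 2608 3521 1 2636 2390 2310 ∷
  prime 279 170 1753 1572 1 2595 2088 3552 ∷ prime 287 1855 3582 1760 1 1346 3631 1131 ∷
  prime 297 2327 1877 3992 1 1868 136 3101 ∷ prime 300 1031 2175 493 1 555 2688 3730 ∷
  prime 302 3596 3945 3096 1 1809 3183 3233 ∷ prime 303 3615 1148 2078 1 1231 3805 1123 ∷
  prime 305 4223 1924 683 1 562 2155 3747 ∷ prime 309 2449 1791 2102 1 1104 217 3758 ∷
  prime 314 2782 1039 841 1 4266 1213 1688 ∷ prime 320 3633 2349 1139 1 1164 2407 2588 ∷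
  prime 323 2876 2599 3413 1 3408 4060 4050 ∷ prime 330 1165 1079 4491 1 2850 3872 2285 ∷
  prime 332 713 3335 538 1 1397 1169 3461 ∷ prime 333 808 1570 3519 1 246 1910 3701 ∷
  prime 335 1063 947 2116 1 1893 1316 337 ∷ prime 338 3064 3556 3017 1 87 4612 2687 ∷
  prime 342 2821 679 1350 1 3820 1797 2069 ∷ prime 344 1734 3246 2606 1 3123 2239 407 ∷
  prime 345 3412 4120 1319 1 1660 2994 1817 ∷ prime 353 4002 2443 50 1 3041 1955 284 ∷
  prime 354 2792 3605 4861 1 2820 1622 1620 ∷ prime 357 3191 4710 1388 1 3969 1556 4265 ∷
  prime 368 2976 3234 4529 1 4255 4003 5135 ∷ prime 369 2335 299 1564 1 565 1682 4831 ∷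
  prime 372 4502 2033 3814 1 5132 3830 2532 ∷ prime 374 4752 1333 4297 1 3840 3477 1621 ∷
  prime 377 1168 2788 1507 1 5063 3442 3363 ∷ prime 387 1176 2220 1396 1 450 3218 1442 ∷
  prime 393 2016 3166 3145 1 3857 2318 1922 ∷ prime 395 3856 5511 994 1 2311 393 4476 ∷
  prime 398 2587 2585 3974 1 3812 782 3894 ∷ prime 404 2303 4694 5008 1 980 4383 1386 ∷
  prime 410 5310 961 1825 1 4978 4552 2460 ∷ prime 413 4479 1358 861 1 611 396 5177 ∷
  prime 417 4795 4147 4510 1 3994 4296 2730 ∷ prime 419 2696 440 15 1 670 3486 4060 ∷
  prime 420 5659 414 4324 1 1527 2614 1102 ∷ prime 423 5529 5355 4475 1 2848 1733 5011 ∷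
  prime 429 602 2226 3106 1 1755 4351 4222 ∷ prime 435 785 1910 4377 1 4694 3123 5020 ∷
  prime 438 290 230 4568 1 4166 5380 2299 ∷ prime 443 375 1987 5692 1 980 2061 3990 ∷
  prime 444 3379 1482 1283 1 886 1515 4027 ∷ prime 449 688 2742 468 1 3495 1466 1215 ∷
  prime 450 4598 2863 3893 1 407 1493 4157 ∷ prime 452 3399 3483 880 1 4902 5825 1495 ∷
  prime 453 5482 3294 4227 1 5766 3611 188 ∷ prime 459 2692 2968 449 1 463 2539 2086 ∷
  prime 462 2507 5317 2529 1 3703 2150 1437 ∷ prime 468 802 4473 5717 1 528 4805 3970 ∷
  prime 470 2053 1332 4258 1 1720 6193 2253 ∷ prime 474 6476 2383 1368 1 3798 5713 2717 ∷
  prime 477 6006 5497 4145 1 6279 4294 6164 ∷ prime 483 3609 1706 906 1 3088 97 3519 ∷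
  prime 485 2649 75 4661 1 2721 6230 6054 ∷ prime 488 3711 2246 475 1 2155 5378 142 ∷
  prime 494 5079 3727 5007 1 3586 4965 6879 ∷ prime 497 3363 2842 2529 1 1787 3105 2888 ∷
  prime 500 3724 1168 923 1 5428 703 4762 ∷ prime 503 1032 4632 3430 1 2480 2989 4935 ∷
  prime 504 871 2953 171 1 3766 3562 1392 ∷ prime 509 4033 6517 6580 1 6714 855 4770 ∷
  prime 515 7138 2239 3130 1 557 7060 3485 ∷ prime 518 6773 6704 1441 1 3637 1339 6129 ∷
  prime 522 2437 93 3933 1 4483 1442 789 ∷ prime 525 6562 4637 5309 1 390 3264 401 ∷
  prime 528 5195 734 3761 1 1505 4013 1708 ∷ prime 534 4332 2821 553 1 370 7267 25 ∷
  prime 539 641 4935 310 1 2508 2481 677 ∷ prime 540 6059 2511 1188 1 5495 2831 283 ∷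
  prime 542 179 3660 837 1 6518 7063 6312 ∷ prime 543 178 6432 6616 1 2667 1069 580 ∷
  prime 548 6686 6633 65 1 5688 3668 7427 ∷ prime 549 3453 6977 2383 1 7474 168 2084 ∷
  prime 554 3508 899 3812 1 598 2312 6000 ∷ prime 560 3754 6830 233 1 7714 6643 4582 ∷
  prime 563 5543 7479 7150 1 3685 67 6743 ∷ prime 572 3192 6500 6305 1 6083 3136 1027 ∷
  prime 578 862 6685 7373 1 1420 6300 1081 ∷ prime 585 4973 7550 7016 1 349 8185 406 ∷
  prime 587 7211 5984 1396 1 5975 4507 776 ∷ prime 588 421 4489 3817 1 6752 6486 116 ∷
  prime 594 3971 5541 3990 1 3516 6354 7340 ∷ prime 599 5971 2385 5284 1 3840 4454 4072 ∷
  prime 602 2388 5873 2272 1 4803 3247 7754 ∷ prime 603 7768 8015 1679 1 6755 7168 4215 ∷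
  prime 608 8327 4347 8443 1 1329 7539 1734 ∷ prime 609 7313 7061 7019 1 1029 3356 5317 ∷
  prime 614 3905 8467 3532 1 2749 1144 6268 ∷ prime 620 3626 510 7974 1 5146 6789 4333 ∷
  prime 624 6254 2607 982 1 5352 7631 5047 ∷ prime 627 2745 8107 5209 1 4320 2368 1252 ∷
  prime 629 3797 6137 3581 1 6236 1410 1585 ∷ prime 630 1278 5057 4938 1 1681 4578 46 ∷
  prime 632 6539 4690 8707 1 6918 8230 5466 ∷ prime 633 7770 4907 4839 1 4729 1887 8356 ∷
  prime 638 8576 2405 2873 1 1022 1456 7656 ∷ prime 647 7782 74 8215 1 7880 2909 90 ∷
  prime 654 3100 9115 891 1 5224 387 7092 ∷ prime 657 1948 1352 6821 1 8761 3624 6222 ∷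
  prime 659 8645 3491 5868 1 3365 730 83 ∷ prime 660 8330 6589 5051 1 270 1596 495 ∷
  prime 663 8366 7442 6818 1 4953 2788 4501 ∷ prime 665 5458 626 3060 1 6864 883 4313 ∷
  prime 674 2411 2255 1175 1 3715 8811 8617 ∷ prime 677 1894 2025 8544 1 6494 7451 2118 ∷
  prime 680 9162 9394 1583 1 7786 9160 4481 ∷ prime 687 6043 6615 6239 1 3086 9016 8335 ∷
  prime 690 7865 1006 7947 1 1620 6286 3766 ∷ prime 692 4633 9408 8904 1 1845 4319 1882 ∷
  prime 699 4424 9511 7128 1 7811 3853 8640 ∷ prime 702 229 5594 8972 1 1366 5467 348 ∷
  prime 704 8656 4501 5500 1 3496 8831 1003 ∷ prime 705 2794 8662 2653 1 9616 2702 6946 ∷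
  prime 710 8211 5598 4832 1 3789 4969 2753 ∷
  []

-- Checking the certificates for q ≤ 9941, and the passage from q > Q(7,6) to `threshold`.

private
  allFrom : (ℕ → Bool) → ℕ → ℕ → Bool
  allFrom f zero m = true
  allFrom f (suc l) m = f m ∧ allFrom f l (m + 1)

  allFrom-sound : ∀ f l m → T (allFrom f l m) → ∀ n → n < l → T (f (n + m))
  allFrom-sound f (suc l) m t zero _ = proj₁ (Equivalence.to T-∧ t)
  allFrom-sound f (suc l) m t (suc n) (s≤s h) = subst (λ i → T (f i)) (trans (cong (n +_) (+-comm m 1)) (+-suc n m))
    (allFrom-sound f l (m + 1) (proj₂ (Equivalence.to T-∧ t)) n h)

  allFrom-0 : ∀ f l → allFrom f l 0 ≡ true → ∀ n → n < l → f n ≡ true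
  allFrom-0 f l e n h = Equivalence.to T-≡ (subst (λ i → T (f i)) (+-identityʳ n) (allFrom-sound f l 0 (Equivalence.from T-≡ e) n h))

  reduced : ∀ p .{{_ : NonZero p}} {k} → Vec ℕ k → Vec ℕ k
  reduced p = V.map (_% p)

  certifiesᵇ : ∀ f p .{{_ : NonZero p}} {k} (g x y₁ y₂ z₁ z₂ z₃ z₄ : Vec ℕ k) → ℕ → Bool
  certifiesᵇ f p g x y₁ y₂ z₁ z₂ z₃ z₄ n = Residues.distinguishedᵇ p (reduced p g) f n
    (reduced p x) (reduced p y₁) (reduced p y₂) (reduced p z₁) (reduced p z₂) (reduced p z₃) (reduced p z₄)

  certifiesᵇ-sound : ∀ f p .{{_ : NonZero p}} {k} (g x y₁ y₂ z₁ z₂ z₃ z₄ : Vec ℕ k) n → certifiesᵇ f p g x y₁ y₂ z₁ z₂ z₃ z₄ n ≡ true →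
    Residues.Distinguished p (reduced p g) f n
      (reduced p x) (reduced p y₁) (reduced p y₂) (reduced p z₁) (reduced p z₂) (reduced p z₃) (reduced p z₄)
  certifiesᵇ-sound f p g x y₁ y₂ z₁ z₂ z₃ z₄ n e = Residues.distinguishedᵇ-sound p (reduced p g) f n (reduced p x) (reduced p y₁) (reduced p y₂)
    (reduced p z₁) (reduced p z₂) (reduced p z₃) (reduced p z₄) (Equivalence.from T-≡ e)

  factorᵇ : ℕ → ℕ → Bool
  factorᵇ m d = (2 + d <ᵇ m) ∧ (m % (2 + d) ≡ᵇ 0)

  -- Trial division by 2, ..., 99, which exposes every composite number below 100².
  hasFactorᵇ : ℕ → Bool
  hasFactorᵇ m = any (factorᵇ m) (upTo 98)

  prime⇒¬hasFactor : ∀ {p} → Prime p → hasFactorᵇ p ≡ true → ⊥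
  prime⇒¬hasFactor {p} pp t =
    let d , t′ = Any.satisfied (any⁻ (factorᵇ p) (upTo 98) (Equivalence.from T-≡ t))
        l , e = Equivalence.to (T-∧ {2 + d <ᵇ p}) t′
    in contradict d (<ᵇ⇒< (2 + d) p l) (prime⇒irreducible pp (m%n≡0⇒n∣m p (2 + d) (≡ᵇ⇒≡ (p % (2 + d)) 0 e)))
    where
    contradict : ∀ d → 2 + d < p → 2 + d ≡ 1 ⊎ 2 + d ≡ p → ⊥
    contradict d l (inj₂ e) = <⇒≢ l e

  primeᵇ : ℕ → ℕ → PrimeCertificate → Bool
  primeᵇ f n (prime m x y₁ y₂ z₁ z₂ z₃ z₄) = (m ≡ᵇ n) ∧
    certifiesᵇ f (suc (14 * n)) (0 ∷ []) (x ∷ []) (y₁ ∷ []) (y₂ ∷ []) (z₁ ∷ []) (z₂ ∷ []) (z₃ ∷ []) (z₄ ∷ []) n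

  settledᵇ : ℕ → ℕ → Bool
  settledᵇ f n = (n <ᵇ 5) ∨ (hasFactorᵇ (suc (14 * n)) ∨ any (primeᵇ f n) primeCertificates)

  -- For each n ≤ 710, either n is too small, or 14 n + 1 has a proper factor, or a certificate
  -- checks. The exponent 2n of a colour is at most 1420 < 2¹¹, whence the 11 binary digits.
  settled : allFrom (settledᵇ 11) 711 0 ≡ true
  settled = refl

  extensionᵇ : ℕ → ℕ → ℕ → Certificate → Bool
  extensionᵇ f p k (cert p′ k′ g x y₁ y₂ z₁ z₂ z₃ z₄) = (suc p′ ≡ᵇ p) ∧ ((k′ ≡ᵇ k) ∧
    (Residues.separatedᵇ (suc p′) (reduced (suc p′) g) ∧ certifiesᵇ f (suc p′) g x y₁ y₂ z₁ z₂ z₃ z₄ ((suc p′ ^ k′) / 14)))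

  settledPowerᵇ : ℕ → ℕ → ℕ → Bool
  settledPowerᵇ f p k = (k <ᵇ 2) ∨ ((p ^ k <ᵇ 71) ∨ ((9941 <ᵇ p ^ k) ∨ (not (p ^ k % 14 ≡ᵇ 1) ∨ (hasFactorᵇ p ∨
    any (extensionᵇ f p k) extensionCertificates))))

  -- The ranges suffice because p^k ≤ 9941 with k ≥ 2 forces p < 100, and p ≥ 2 forces k < 14.
  settledPowers : allFrom (λ p → allFrom (settledPowerᵇ 11 p) 14 0) 100 0 ≡ true
  settledPowers = refl

  ∨-cases : ∀ a {b} {G : Set} → a ∨ b ≡ true → (a ≡ true → ⊥) → (b ≡ true → G) → G
  ∨-cases true e ¬a rest = ⊥-elim (¬a refl)
  ∨-cases false e ¬a rest = rest e

  ∧-true : ∀ a {b} → a ∧ b ≡ true → a ≡ true × b ≡ true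
  ∧-true true e = refl , e

  settled-cases : ∀ f n {G : Set} → settledᵇ f n ≡ true → ((n <ᵇ 5) ≡ true → ⊥) → (hasFactorᵇ (suc (14 * n)) ≡ true → ⊥) →
    (any (primeᵇ f n) primeCertificates ≡ true → G) → G
  settled-cases f n e h₁ h₂ rest = ∨-cases (n <ᵇ 5) e h₁ λ e → ∨-cases (hasFactorᵇ (suc (14 * n))) e h₂ rest

  settledPower-cases : ∀ f p k {G : Set} → settledPowerᵇ f p k ≡ true → ((k <ᵇ 2) ≡ true → ⊥) → ((p ^ k <ᵇ 71) ≡ true → ⊥) →
    ((9941 <ᵇ p ^ k) ≡ true → ⊥) → (not (p ^ k % 14 ≡ᵇ 1) ≡ true → ⊥) → (hasFactorᵇ p ≡ true → ⊥) →
    (any (extensionᵇ f p k) extensionCertificates ≡ true → G) → G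
  settledPower-cases f p k e h₁ h₂ h₃ h₄ h₅ rest = ∨-cases (k <ᵇ 2) e h₁ λ e → ∨-cases (p ^ k <ᵇ 71) e h₂ λ e →
    ∨-cases (9941 <ᵇ p ^ k) e h₃ λ e → ∨-cases (not (p ^ k % 14 ≡ᵇ 1)) e h₄ λ e → ∨-cases (hasFactorᵇ p) e h₅ rest

  71≰ : ∀ {n} → (n <ᵇ 5) ≡ true → ¬ 71 ≤ 14 * n + 1
  71≰ {n} t h = <⇒≱ (+-monoˡ-< 1 (*-monoʳ-< 14 (<ᵇ⇒< n 5 (Equivalence.from T-≡ t)))) h

  module _ (n p k : ℕ) (pp : Prime p) (1≤k : 1 ≤ k) (q≡ : p ^ k ≡ 14 * n + 1) where

    private instance
      p≢0 : NonZero p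
      p≢0 = prime⇒nonZero pp

    Goal : Set
    Goal = ∃[ P ] (Group.IsPDF p k P (Ktype n) 4 × Group.IsHSBase p k P)

    open Evaluation pp k 1≤k

    toFin : Vec ℕ k → Vec (Fin p) k
    toFin = V.map (_mod p)

    toℕ-toFin : ∀ v → V.map toℕ (toFin v) ≡ reduced p v
    toℕ-toFin v = trans (sym (Vₚ.map-∘ toℕ (_mod p) v)) (Vₚ.map-cong (PrimeField.toℕ-mod p) v)

    fromCertificate : ∀ f → 1 ≤ n → 2 * n < 2 ^ f → ∀ g x y₁ y₂ z₁ z₂ z₃ z₄ → Separated (toFin g) →
      certifiesᵇ f p g x y₁ y₂ z₁ z₂ z₃ z₄ n ≡ true → Goal
    fromCertificate f 1≤n 2n< g x y₁ y₂ z₁ z₂ z₃ z₄ sep e = evaluate (toFin g) sep f n 1≤n 2n< q≡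
      (toFin x) (toFin y₁) (toFin y₂) (toFin z₁) (toFin z₂) (toFin z₃) (toFin z₄)
      (rewritten (toℕ-toFin g) (toℕ-toFin x) (toℕ-toFin y₁) (toℕ-toFin y₂) (toℕ-toFin z₁) (toℕ-toFin z₂) (toℕ-toFin z₃) (toℕ-toFin z₄)
        (certifiesᵇ-sound f p g x y₁ y₂ z₁ z₂ z₃ z₄ n e))
      where
      rewritten : ∀ {g g′ x x′ y₁ y₁′ y₂ y₂′ z₁ z₁′ z₂ z₂′ z₃ z₃′ z₄ z₄′ : Vec ℕ k} →
        g ≡ g′ → x ≡ x′ → y₁ ≡ y₁′ → y₂ ≡ y₂′ → z₁ ≡ z₁′ → z₂ ≡ z₂′ → z₃ ≡ z₃′ → z₄ ≡ z₄′ →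
        R.Distinguished g′ f n x′ y₁′ y₂′ z₁′ z₂′ z₃′ z₄′ → R.Distinguished g f n x y₁ y₂ z₁ z₂ z₃ z₄
      rewritten refl refl refl refl refl refl refl refl d = d

    large-case : threshold ≤ n → Goal
    large-case big = let g , sep = ∃-separated in Crossing.large p k (quotient-isFiniteDomain g sep) n (≤-trans (<ᵇ⇒< 0 threshold tt) big) q≡ big

  -- Here 487404 = U(7,6). From U² q < (q - c)² ≤ q² follows q > U², and `threshold` is U² / 14
  -- rounded down.
  U²<q⇒threshold≤n : ∀ {n} → AboveQ 7 6 (14 * n + 1) → threshold ≤ n
  U²<q⇒threshold≤n {n} (c<q , above) = ≮⇒≥ λ n< → <⇒≱ U²<q
      (≤-trans (+-monoˡ-≤ 1 (*-monoʳ-≤ 14 (<⇒≤ n<))) (<⇒≤ (<ᵇ⇒< (14 * threshold + 1) (487404 * 487404) tt)))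
    where
    q : ℕ
    q = 14 * n + 1
    U²<q : 487404 * 487404 < q
    U²<q = *-cancelʳ-< q (487404 * 487404) q (<-≤-trans above (*-mono-≤ (m∸n≤m q (6 * 7 ^ 5)) (m∸n≤m q (6 * 7 ^ 5))))

  [14n+1]%14≡1 : ∀ n → (14 * n + 1) % 14 ≡ 1
  [14n+1]%14≡1 n = trans (cong (_% 14) (trans (+-comm (14 * n) 1) (cong (1 +_) (*-comm 14 n)))) ([m+kn]%n≡m%n 1 n 14)

  [14n+1]/14≡n : ∀ n → (14 * n + 1) / 14 ≡ n
  [14n+1]/14≡n n = *-cancelʳ-≡ ((14 * n + 1) / 14) n 14 (suc-injective (begin
    1 + (14 * n + 1) / 14 * 14                    ≡⟨ cong (_+ (14 * n + 1) / 14 * 14) ([14n+1]%14≡1 n) ⟨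
    (14 * n + 1) % 14 + (14 * n + 1) / 14 * 14    ≡⟨ m≡m%n+[m/n]*n (14 * n + 1) 14 ⟨
    14 * n + 1                                    ≡⟨ trans (+-comm (14 * n) 1) (cong suc (*-comm 14 n)) ⟩
    1 + n * 14                                    ∎))
    where
    open ≡-Reasoning

  module _ (n : ℕ) (71≤q : 71 ≤ 14 * n + 1) (n≤710 : n ≤ 710) (f : ℕ) (2n< : 2 * n < 2 ^ f) where

    5≤n : 5 ≤ n
    5≤n = ≮⇒≥ λ n<5 → 71≰ {n} (Equivalence.to T-≡ (<⇒<ᵇ n<5)) 71≤q

    1≤n : 1 ≤ n
    1≤n = ≤-trans (s≤s z≤n) 5≤n

    module _ (pp : Prime (suc (14 * n))) (q≡ : suc (14 * n) ^ 1 ≡ 14 * n + 1) where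

      open Evaluation pp 1 (s≤s z≤n)

      -- For k = 1 the modulus is X itself: X acts as 0, so both sides of X^q = X vanish, and the
      -- separator is the empty product 𝟏.
      prime-separated : Separated (toFin n (suc (14 * n)) 1 pp (s≤s z≤n) q≡ (0 ∷ []))
      prime-separated = trans (X≡𝟎 _) (sym (X≡𝟎 𝟏)) , λ e → IsFiniteDomain.1≢0 (ℤₚ-isFiniteDomain pp) (cong V.head e)
        where
        open PrimeField (suc (14 * n))
        open VecModule ℤₚ-isCommutativeRing using (𝟎; module QuotientRing; zeroʳ; ⊞-identityˡ)
        open QuotientRing (0ₚ ∷ []) using (X; 𝟏)
        X≡𝟎 : ∀ v → X v ≡ 𝟎
        X≡𝟎 (a ∷ []) = cong (_∷ []) (trans (cong (0ₚ +ₚ_) (zeroʳ a)) (⊞-identityˡ 0ₚ))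

      fromPrimeCertificate : ∀ c → primeᵇ f n c ≡ true → Goal n (suc (14 * n)) 1 pp (s≤s z≤n) q≡
      fromPrimeCertificate (prime m x y₁ y₂ z₁ z₂ z₃ z₄) e = fromCertificate n (suc (14 * n)) 1 pp (s≤s z≤n) q≡ f 1≤n 2n<
        (0 ∷ []) (x ∷ []) (y₁ ∷ []) (y₂ ∷ []) (z₁ ∷ []) (z₂ ∷ []) (z₃ ∷ []) (z₄ ∷ []) prime-separated
        (proj₂ (∧-true (m ≡ᵇ n) e))

      prime-case′ : settledᵇ f n ≡ true → Goal n (suc (14 * n)) 1 pp (s≤s z≤n) q≡
      prime-case′ settled-n = settled-cases f n settled-n (λ e → 71≰ {n} e 71≤q) (prime⇒¬hasFactor pp)
        λ e → let c , t = Any.satisfied (any⁻ (primeᵇ f n) primeCertificates (Equivalence.from T-≡ e)) in fromPrimeCertificate c (Equivalence.to T-≡ t)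

    prime-case : ∀ p (pp : Prime p) (q≡ : p ^ 1 ≡ 14 * n + 1) → settledᵇ f n ≡ true → p ≡ suc (14 * n) → Goal n p 1 pp (s≤s z≤n) q≡
    prime-case _ pp q≡ s refl = prime-case′ pp q≡ s

    module _ (p k : ℕ) (pp : Prime p) (1≤k : 1 ≤ k) (q≡ : p ^ k ≡ 14 * n + 1) where

      private instance
        p≢0 : NonZero p
        p≢0 = prime⇒nonZero pp

      fromExtension : ∀ g x y₁ y₂ z₁ z₂ z₃ z₄ → Residues.separatedᵇ p (reduced p {k} g) ≡ true →
        certifiesᵇ f p g x y₁ y₂ z₁ z₂ z₃ z₄ (p ^ k / 14) ≡ true → Goal n p k pp 1≤k q≡
      fromExtension g x y₁ y₂ z₁ z₂ z₃ z₄ s t = fromCertificate n p k pp 1≤k q≡ f 1≤n 2n< g x y₁ y₂ z₁ z₂ z₃ z₄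
        (separatedₘ⇒separated _ (subst (Residues.Separatedₘ p) (sym (toℕ-toFin n p k pp 1≤k q≡ g)) (Residues.separatedᵇ-sound p (reduced p g) (Equivalence.from T-≡ s))))
        (subst (λ m → certifiesᵇ f p g x y₁ y₂ z₁ z₂ z₃ z₄ m ≡ true) (trans (cong (_/ 14) q≡) ([14n+1]/14≡n n)) t)
        where
        open Evaluation pp k 1≤k

    fromExtensionCertificate : ∀ p k (pp : Prime p) 1≤k (q≡ : p ^ k ≡ 14 * n + 1) c → extensionᵇ f p k c ≡ true → Goal n p k pp 1≤k q≡
    fromExtensionCertificate p k pp 1≤k q≡ (cert p′ k′ g x y₁ y₂ z₁ z₂ z₃ z₄) h =
      let e , h₁ = ∧-true (suc p′ ≡ᵇ p) h
          e′ , h₂ = ∧-true (k′ ≡ᵇ k) h₁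
          s , c = ∧-true (Residues.separatedᵇ (suc p′) (reduced (suc p′) g)) h₂
      in matched (≡ᵇ⇒≡ (suc p′) p (Equivalence.from T-≡ e)) (≡ᵇ⇒≡ k′ k (Equivalence.from T-≡ e′)) s c
      where
      matched : suc p′ ≡ p → k′ ≡ k → Residues.separatedᵇ (suc p′) (reduced (suc p′) g) ≡ true →
        certifiesᵇ f (suc p′) g x y₁ y₂ z₁ z₂ z₃ z₄ ((suc p′ ^ k′) / 14) ≡ true → Goal n p k pp 1≤k q≡
      matched refl refl s c = fromExtension p k pp 1≤k q≡ g x y₁ y₂ z₁ z₂ z₃ z₄ s c

    power-case : ∀ p k (pp : Prime p) 1≤k (q≡ : p ^ k ≡ 14 * n + 1) → 2 ≤ k → (p < 100 → k < 14 → settledPowerᵇ f p k ≡ true) → Goal n p k pp 1≤k q≡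
    power-case p k pp 1≤k q≡ 2≤k settled-pk =
      settledPower-cases f p k (settled-pk p<100 k<14)
        (λ e → <⇒≱ (<ᵇ⇒< k 2 (Equivalence.from T-≡ e)) 2≤k)
        (λ e → <⇒≱ (<ᵇ⇒< (p ^ k) 71 (Equivalence.from T-≡ e)) (subst (71 ≤_) (sym q≡) 71≤q))
        (λ e → <⇒≱ (<ᵇ⇒< 9941 (p ^ k) (Equivalence.from T-≡ e)) q≤9941)
        (λ e → absurd (p ^ k % 14) e (trans (cong (_% 14) q≡) ([14n+1]%14≡1 n)))
        (prime⇒¬hasFactor pp)
        λ e → let c , t = Any.satisfied (any⁻ (extensionᵇ f p k) extensionCertificates (Equivalence.from T-≡ e)) in
          fromExtensionCertificate p k pp 1≤k q≡ c (Equivalence.to T-≡ t)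
      where
      instance
        p≢0 : NonZero p
        p≢0 = prime⇒nonZero pp
      absurd : ∀ r → not (r ≡ᵇ 1) ≡ true → r ≡ 1 → ⊥
      absurd _ () refl
      q≤9941 : p ^ k ≤ 9941
      q≤9941 = subst (_≤ 9941) (sym q≡) (+-monoˡ-≤ 1 (*-monoʳ-≤ 14 n≤710))
      p<100 : p < 100
      p<100 = ≰⇒> λ 100≤p → <⇒≱ (<ᵇ⇒< 9941 (100 ^ 2) tt) (≤-trans (≤-trans (^-monoˡ-≤ 2 100≤p) (^-monoʳ-≤ p 2≤k)) q≤9941)
      k<14 : k < 14
      k<14 = ≰⇒> λ 14≤k → <⇒≱ (<ᵇ⇒< 9941 (2 ^ 14) tt) (≤-trans (≤-trans (^-monoˡ-≤ 14 (1<p pp)) (^-monoʳ-≤ p 14≤k)) q≤9941)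

private
  n≤710 : ∀ {n} → 14 * n + 1 ≤ 9941 → n ≤ 710
  n≤710 {n} h = *-cancelˡ-≤ 14 (+-cancelʳ-≤ 1 (14 * n) (14 * 710) h)

  2n<2¹¹ : ∀ n → 14 * n + 1 ≤ 9941 → 2 * n < 2 ^ 11
  2n<2¹¹ n h = ≤-<-trans (*-monoʳ-≤ 2 (n≤710 {n} h)) (<ᵇ⇒< 1420 2048 tt)

theorem6p4 : (n p k : ℕ) → (pp : Prime p) → 1 ≤ k → p ^ k ≡ 14 * n + 1 →
    ((71 ≤ 14 * n + 1 × 14 * n + 1 ≤ 9941) ⊎ AboveQ 7 6 (14 * n + 1)) →
    ∃[ P ] (Group.IsPDF p k {{prime⇒nonZero pp}} P (Ktype n) 4
            × Group.IsHSBase p k {{prime⇒nonZero pp}} P)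
theorem6p4 n p k pp 1≤k q≡ (inj₂ above) = large-case n p k pp 1≤k q≡ (U²<q⇒threshold≤n above)
theorem6p4 n p k pp 1≤k q≡ (inj₁ (71≤q , q≤9941)) with m≤n⇒m<n∨m≡n 1≤k
... | inj₁ 2≤k = power-case n 71≤q (n≤710 {n} q≤9941) 11 (2n<2¹¹ n q≤9941) p k pp 1≤k q≡ 2≤k λ p<100 k<14 →
  allFrom-0 (settledPowerᵇ 11 p) 14 (allFrom-0 (λ p → allFrom (settledPowerᵇ 11 p) 14 0) 100 settledPowers p p<100) k k<14
... | inj₂ refl = prime-case n 71≤q (n≤710 {n} q≤9941) 11 (2n<2¹¹ n q≤9941) p pp q≡ (allFrom-0 (settledᵇ 11) 711 settled n (s≤s (n≤710 {n} q≤9941)))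
  (trans (sym (*-identityʳ p)) (trans q≡ (+-comm (14 * n) 1)))
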